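{- Let $\beta\ge 1$ be an integer. Then \begin{align*} X_{K_{(3,2^\beta)}} =\beta!\Bigl(&\beta(2\beta+3)\,a_{\beta+1}\,e_{2\beta+3} +\beta\sum_{d=0}^{\beta-1}(2d+1)\,a_d\,e_{(\beta+2+d,\;\beta+1-d)}\\ &+\bigl(a_{\beta+1}+(2\beta^2+\beta-1)a_\beta\bigr)e_{(2\beta+2,\,1)} +e_{(\beta+1,\,\beta+1,\,1)}\\ &+\sum_{d=2}^{\beta}\bigl((4d-3)a_{d-1}+a_{d-2}\bigr)e_{(\beta+d+1,\;\beta+1-d,\;1)}\Bigr), \end{align*} where, for $d\ge 0$, $$a_d=\#\bigl\{f\colon[d]\to[2d]\ \text{injective}\ :\ f(i)\ne i\text{ for every }i\in[d]\bigr\}.$$ Consequently, the complete multipartite graph $K_{(3,2^\beta)}$ is $e$-positive.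
   Context: For $d\ge1$, $[d]=\{1,\dots,d\}$, and $[0]=\varnothing$ (so $a_0=1$). For a partition $\lambda$ of a positive integer, $K_\lambda$ is the complete multipartite graph whose partite sets have sizes equal to the parts of $\lambda$. The partition $(3,2^\beta)$ has one part equal to $3$ and $\beta$ parts equal to $2$. For a finite simple graph $G=(V,E)$, the chromatic symmetric function is $X_G(x)=\sum_{\kappa}\prod_{v\in V}x_{\kappa(v)}$, where $x=(x_1,x_2,\dots)$ are commuting indeterminates and the sum is over all proper colorings $\kappa\colon V\to\mathbb Z_{>0}$ (adjacent vertices get distinct colors). It lies in the ring of symmetric functions over $\mathbb Q$. $e_\mu=e_{\mu_1}e_{\mu_2}\cdots$ denotes the elementary symmetric function indexed by the partition $\mu$; $e_n$ means $e_{(n)}$. A graph $G$ is $e$-positive if all coefficients of $X_G$ in the basis $\{e_\mu\}$ are nonnegative. Empty sums are $0$. -}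

module Defs where

open import Data.Bool.Base using (if_then_else_)
open import Data.Fin.Base using (Fin; zero; suc; toℕ; splitAt)
import Data.Fin.Properties as Fin
open import Data.Integer.Base using (+_)
open import Data.List.Base as List
  using (List; []; _∷_; filter; foldr; length; allFin; applyUpTo; upTo;
         cartesianProductWith; replicate)
open import Data.List.Membership.Propositional using (_∉_)
open import Data.List.Relation.Unary.All using (All; []; _∷_)
open import Data.List.Relation.Unary.Linked using (Linked; []; [-]; _∷_)
open import Data.List.Relation.Unary.Unique.Propositional using (Unique)
open import Data.Nat.Base using (ℕ; zero; suc; _∸_; _<_; _≥_; z≤n; s≤s)
import Data.Nat.Base as ℕ
open import Data.Nat.ListAction using (sum)
import Data.Nat.Properties as ℕ
open import Data.Product.Base using (_×_; _,_; ∃-syntax)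
open import Data.Rational.Base as ℚ using (ℚ; 0ℚ; 1ℚ)
open import Data.Sum.Base using ([_,_]′)
open import Data.Vec.Base as Vec using (Vec; []; _∷_; lookup; tabulate; count)
open import Data.Vec.Properties using (≡-dec)
import Data.Vec.Relation.Unary.All as VecAll
open import Function.Base using (_∘_; const)
open import Function.Definitions using (Injective)
open import Relation.Binary.Definitions using (Decidable; Symmetric; Irreflexive)
open import Relation.Binary.PropositionalEquality using (_≡_; _≢_; refl; sym)
open import Relation.Nullary.Decidable
  using (does; map′; ¬?; _×-dec_; _→-dec_)
import Relation.Unary as U

------------------------------------------------------------------------
-- Counting functions between finite sets

-- A function Fin n → Fin k is represented by the vector of its values, so
-- that propositional equality is equality of functions.

functions : ∀ n k → List (Vec (Fin k) n)
functions zero    k = [] ∷ []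
functions (suc n) k = cartesianProductWith _∷_ (allFin k) (functions n k)

#functions : ∀ {n k} {P : Vec (Fin k) n → Set} → U.Decidable P → ℕ
#functions {n} {k} P? = length (filter P? (functions n k))

-- [d] and [2d] are Fin d and Fin (2 * d), both shifted down by one; the
-- condition f(i) ≠ i is therefore a comparison of the underlying numbers.

InjectiveWithoutFixedPoint : ∀ {d m} → Vec (Fin m) d → Set
InjectiveWithoutFixedPoint f =
  Injective _≡_ _≡_ (lookup f) × (∀ i → toℕ (lookup f i) ≢ toℕ i)

injectiveWithoutFixedPoint? : ∀ {d m} →
  U.Decidable (InjectiveWithoutFixedPoint {d} {m})
injectiveWithoutFixedPoint? f =
  map′ (λ inj {i} {j} → inj i j) (λ inj i j → inj {i} {j})
    (Fin.all? λ i → Fin.all? λ j →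
      (lookup f i Fin.≟ lookup f j) →-dec (i Fin.≟ j))
  ×-dec
  Fin.all? (λ i → ¬? (toℕ (lookup f i) ℕ.≟ toℕ i))

a : ℕ → ℕ
a d = #functions {d} {2 ℕ.* d} injectiveWithoutFixedPoint?

------------------------------------------------------------------------
-- Formal power series over ℚ in x₁, x₂, …

-- F k (α₁ ∷ … ∷ αₖ) is the coefficient of x₁^α₁ ⋯ xₖ^αₖ in F.  Every
-- monomial arises in this way, for each k bounding the indices of the
-- variables occurring in it.

Series : Set
Series = ∀ k → Vec ℕ k → ℚ

infix  4 _≈_
infixl 6 _⊕_
infixl 7 _⊗_
infixr 8 _·_

_≈_ : Series → Series → Set
F ≈ G = ∀ k (α : Vec ℕ k) → F k α ≡ G k α

𝟘 : Series
𝟘 k α = 0ℚ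

𝟙 : Series
𝟙 k α = if does (VecAll.all? (ℕ._≟ 0) α) then 1ℚ else 0ℚ

_⊕_ : Series → Series → Series
(F ⊕ G) k α = F k α ℚ.+ G k α

_·_ : ℚ → Series → Series
(c · F) k α = c ℚ.* F k α

-- All pairs (β , γ) with β + γ = α, i.e. factorisations of the monomial x^α.

splittings : ∀ {k} → Vec ℕ k → List (Vec ℕ k × Vec ℕ k)
splittings []      = ([] , []) ∷ []
splittings (n ∷ α) = cartesianProductWith
  (λ { i (β , γ) → (i ∷ β) , ((n ∸ i) ∷ γ) }) (upTo (suc n)) (splittings α)

_⊗_ : Series → Series → Series
(F ⊗ G) k α =
  foldr ℚ._+_ 0ℚ (List.map (λ { (β , γ) → F k β ℚ.* G k γ }) (splittings α))

sumOver : {A : Set} → List A → (A → Series) → Series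
sumOver xs F = foldr _⊕_ 𝟘 (List.map F xs)

-- ∑[ m ⋯ n ] F sums F d over m ≤ d ≤ n, and is 𝟘 when n < m.

∑[_⋯_] : ℕ → ℕ → (ℕ → Series) → Series
∑[ m ⋯ n ] F = sumOver (applyUpTo (m ℕ.+_) (suc n ∸ m)) F

fromℕ : ℕ → ℚ
fromℕ n = + n ℚ./ 1

------------------------------------------------------------------------
-- Partitions and elementary symmetric functions

-- The proofs are irrelevant, so partitions are equal when their parts are.

record Partition : Set where
  constructor partition
  field
    parts               : List ℕ
    .weaklyDecreasing   : Linked _≥_ parts
    .positive           : All (0 <_) parts

open Partition public using (parts)

-- The monomials x_{i₁} ⋯ x_{iₙ} with i₁ < ⋯ < iₙ are exactly those of
-- degree n with all exponents at most 1.

eₙ : ℕ → Series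
eₙ n k α =
  if does (VecAll.all? (ℕ._≤? 1) α ×-dec (Vec.sum α ℕ.≟ n)) then 1ℚ else 0ℚ

e : List ℕ → Series
e μ = foldr _⊗_ 𝟙 (List.map eₙ μ)

------------------------------------------------------------------------
-- Graphs and chromatic symmetric functions

record Graph : Set₁ where
  field
    order  : ℕ
    Adj    : Fin order → Fin order → Set
    adj?   : Decidable Adj
    symm   : Symmetric Adj
    irrefl : Irreflexive _≡_ Adj

module _ (G : Graph) where
  open Graph G

  Proper : ∀ {k} → Vec (Fin k) order → Set
  Proper κ = ∀ u v → Adj u v → lookup κ u ≢ lookup κ v

  proper? : ∀ {k} → U.Decidable (Proper {k})
  proper? κ = Fin.all? λ u → Fin.all? λ v →
    adj? u v →-dec ¬? (lookup κ u Fin.≟ lookup κ v)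

  -- The exponent vector of ∏_{v ∈ V} x_{κ(v)}.

  weight : ∀ {k} → Vec (Fin k) order → Vec ℕ k
  weight κ = tabulate λ i → count (Fin._≟ i) κ

  -- The coefficient of x₁^α₁ ⋯ xₖ^αₖ in ∑_κ ∏_v x_{κ(v)} is the number of
  -- proper colourings with that weight; these use no colour beyond k.

  X : Series
  X k α = fromℕ (#functions {order} {k}
    λ κ → proper? κ ×-dec ≡-dec ℕ._≟_ (weight κ) α)

-- The e_μ form a basis, so the coefficients are determined by the expansion;
-- they are nonzero only for finitely many partitions.

record EExpansion (F : Series) (c : Partition → ℚ) : Set where
  field
    support  : List Partition
    unique   : Unique support
    vanishes : ∀ μ → μ ∉ support → c μ ≡ 0ℚ
    expands  : F ≈ sumOver support (λ μ → c μ · e (parts μ))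

EPositive : Graph → Set
EPositive G = ∃[ c ] EExpansion (X G) c × (∀ μ → 0ℚ ℚ.≤ c μ)

-- The vertices are numbered part by part: the first λ₁ of them form the
-- first partite set, and so on.

partOf : (λs : List ℕ) → Fin (sum λs) → Fin (length λs)
partOf (p ∷ ps) v = [ const zero , suc ∘ partOf ps ]′ (splitAt p v)

K : Partition → Graph
K μ = record
  { order  = sum (parts μ)
  ; Adj    = λ u v → partOf (parts μ) u ≢ partOf (parts μ) v
  ; adj?   = λ u v → ¬? (partOf (parts μ) u Fin.≟ partOf (parts μ) v)
  ; symm   = λ u≁v → u≁v ∘ sym
  ; irrefl = λ { refl u≁u → u≁u refl }
  }

⟨3,2^_⟩ : ℕ → Partition
⟨3,2^ β ⟩ = partition (3 ∷ replicate β 2) (decreasing β) (s≤s z≤n ∷ positive β)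
  where
  twos : ∀ n → Linked _≥_ (replicate n 2)
  twos zero          = []
  twos (suc zero)    = [-]
  twos (suc (suc n)) = ℕ.≤-refl ∷ twos (suc n)

  decreasing : ∀ n → Linked _≥_ (3 ∷ replicate n 2)
  decreasing zero    = [-]
  decreasing (suc n) = s≤s (s≤s z≤n) ∷ twos (suc n)

  positive : ∀ n → All (0 <_) (replicate n 2)
  positive zero    = []
  positive (suc n) = s≤s z≤n ∷ positive n

{-# OPTIONS --safe #-}

-- Both sides are compared coefficientwise. The coefficient of x^α depends
-- only on the numbers n₁, n₂, n₃ of exponents 1, 2, 3 and vanishes when some
-- exponent exceeds 3. In X it is found by splitting the three-element part,
-- then the two-element parts, into colour classes; each colour fills one class.
-- On the other side e_p e_q has coefficient C(n₁, p − n₂), and a factor e₁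
-- lowers one exponent. As the degree is 2β + 3, either n₁ = 2t + 1 and n₃ = 0
-- or n₁ = 2s and n₃ = 1, and after division by β! everything reduces to
--   Σ_d (2d + 1) a_d C(2t + 1, t + 1 + d) = (2t + 1) (2t)! / t!,
--   Σ_d (a_d − a_{d−1}) C(2s, s + d) = (2s)! / s!,   with a_{−1} = 0.
-- Both follow by induction from the recurrence
-- a_{d+2} = (4d + 6) a_{d+1} + a_d, which comes from counting injections of
-- n points into n + r values, only some of the points being restricted.
module Submission where

open import Defs
open import Algebra.Properties.Semiring.Sum using ()
open import Data.Bool.Base using (Bool; true; false; if_then_else_; _∧_; not)
import Data.Bool.Properties as Bool
open import Data.Bool.Properties using (∧-assoc; ∧-zeroʳ; ∧-identityʳ)
open import Data.Fin.Base using (Fin; zero; suc; toℕ; fromℕ<; splitAt; _↑ˡ_; _↑ʳ_)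
import Data.Fin.Properties as Fin
import Data.Integer.Base as ℤ
import Data.Integer.Properties as ℤ
open import Data.List.Base as List
  using (List; []; _∷_; filter; foldr; length; cartesianProductWith; applyUpTo; upTo; replicate; deduplicate)
import Data.List.Properties as List
open import Data.List.Membership.Propositional using (_∈_; _∉_)
open import Data.List.Membership.Propositional.Properties using (∈-deduplicate⁺)
open import Data.List.Relation.Unary.All as All using (All; []; _∷_)
open import Data.List.Relation.Unary.AllPairs using (_∷_)
open import Data.List.Relation.Unary.Any using (here; there)
open import Data.List.Relation.Unary.Linked using ([-]; _∷_)
open import Data.List.Relation.Unary.Unique.Propositional using (Unique)
import Data.List.Relation.Unary.Unique.DecPropositional.Properties as Unique
open import Data.Nat.Base
open import Data.Nat.Combinatorics using (_C_; nCk+nC[k+1]≡[n+1]C[k+1]; nCk≡nC[n∸k]; k>n⇒nCk≡0; nCn≡1)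
open import Data.Nat.ListAction using () renaming (sum to total)
open import Data.Nat.ListAction.Properties using (sum-++)
import Data.Nat.Properties as ℕ
open import Data.Nat.Properties
open import Data.Nat.Tactic.RingSolver using (solve-∀)
open import Data.Product.Base using (_×_; _,_; proj₁; proj₂; ∃-syntax)
open import Data.Rational.Base as ℚ using (ℚ; 0ℚ; 1ℚ)
import Data.Rational.Properties as ℚ
import Data.Rational.Unnormalised.Base as ℚᵘ
import Data.Rational.Unnormalised.Properties as ℚᵘ
open import Data.Sum.Base using (inj₁; inj₂)
open import Data.Unit.Base using (⊤; tt)
open import Data.Vec.Base as Vec using (Vec; []; _∷_; lookup; count; tabulate; _++_; _[_]≔_)
import Data.Vec.Properties as Vec
import Data.Vec.Relation.Unary.All as VecAll
open import Function.Base using (_∘_; id)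
open import Function.Bundles using (_⇔_; mk⇔; Equivalence)
open import Relation.Binary.Definitions using (DecidableEquality)
open import Relation.Binary.PropositionalEquality
open import Relation.Nullary using (¬_; yes; no; Dec; does; contradiction)
open import Relation.Nullary.Decidable using (map′; dec-true; dec-false; does-⇔; _×-dec_; ¬?; _→-dec_)
import Relation.Unary as U

open Algebra.Properties.Semiring.Sum +-*-semiring
  using (sum; sum-cong-≗; ∑-distrib-+; *-distribʳ-sum; sum-replicate-zero)
open ≡-Reasoning


-- With e₀ = 1 the right side is β! times β Σ_d (2d + 1) a_d e_(β+2+d, β+1-d) + Σ_d (a_d - a_{d-1})
-- e_(β+1+d, β+1-d, 1), 0 ≤ d ≤ β + 1. The irregular terms of the theorem are the ends of these
-- sums: e_(2β+2, 1) arises in both, and the term d = 1 of the second is absent because a_1 = a_0.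
-- The recurrence makes a_d - a_{d-1} a combination of earlier values with nonnegative coefficients.
-- One induction proves both binomial identities alternately. (2d + 1) C(2t + 1, t + 1 + d) is 2t +
-- 1 times a difference of neighbours in row 2t, which carries the second identity at t to the
-- first; summation by parts with 2 (2d + 1) a_d = a_{d+1} - a_{d-1} carries the first at t to the
-- second at t + 1. The maps counted by a_d do not keep their form when one value is fixed: if it
-- was forbidden to another point, that point loses its restriction. Hence the count is kept for p
-- restricted and q unrestricted points at once. All identities stay in ℕ, with subtracted terms
-- moved to the other side.

-- Finite sums over initial segments of ℕ

∑< : ℕ → (ℕ → ℕ) → ℕ
∑< zero    f = 0
∑< (suc n) f = ∑< n f + f n

∑<-cong : ∀ n {f g : ℕ → ℕ} → (∀ d → d < n → f d ≡ g d) → ∑< n f ≡ ∑< n g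
∑<-cong zero    eq = refl
∑<-cong (suc n) eq = cong₂ _+_ (∑<-cong n λ d d<n → eq d (m<n⇒m<1+n d<n)) (eq n ≤-refl)

∑<-distrib-+ : ∀ n (f g : ℕ → ℕ) → ∑< n (λ d → f d + g d) ≡ ∑< n f + ∑< n g
∑<-distrib-+ zero    f g = refl
∑<-distrib-+ (suc n) f g = trans (cong (_+ (f n + g n)) (∑<-distrib-+ n f g)) (swap (∑< n f) (∑< n g) (f n) (g n))
  where
  swap : ∀ w x y z → w + x + (y + z) ≡ w + y + (x + z)
  swap = solve-∀

*-distribˡ-∑< : ∀ n c (f : ℕ → ℕ) → c * ∑< n f ≡ ∑< n (λ d → c * f d)
*-distribˡ-∑< zero    c f = *-zeroʳ c
*-distribˡ-∑< (suc n) c f = trans (*-distribˡ-+ c (∑< n f) (f n)) (cong (_+ c * f n) (*-distribˡ-∑< n c f))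

∑<-zero : ∀ n → ∑< n (λ _ → 0) ≡ 0
∑<-zero zero    = refl
∑<-zero (suc n) = trans (+-identityʳ _) (∑<-zero n)

∑<-suc : ∀ n (f : ℕ → ℕ) → ∑< (suc n) f ≡ f 0 + ∑< n (λ d → f (suc d))
∑<-suc zero    f = +-comm 0 (f 0)
∑<-suc (suc n) f = trans (cong (_+ f (suc n)) (∑<-suc n f)) (+-assoc (f 0) _ _)

-- Injections and forbidden values

-- derangements r n counts the injections of n points into n + r values in
-- which no point takes its own forbidden value; these values are distinct.

derangements : ℕ → ℕ → ℕ
derangements r zero          = 1
derangements r (suc zero)    = r
derangements r (suc (suc n)) = (suc n + r) * derangements r (suc n) + suc n * derangements r n

-- Among p + q points only p have a forbidden value; allowing the
-- forbidden value of one point adds the injections in which it is taken.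

injections : ℕ → ℕ → ℕ → ℕ
injections r p zero    = derangements r p
injections r p (suc q) = injections r (suc p) q + injections r p q

-- The next point takes the forbidden value of another point or a value
-- that is forbidden to no point.

injections-restricted : ∀ r p q →
  injections r (suc p) q ≡ p * injections r (pred p) (suc q) + (q + r) * injections r p q
injections-restricted r zero    zero    = sym (*-identityʳ r)
-- For `q = 0` the identity is the defining recurrence of `derangements`; the cases for `suc q` add
-- two instances for `q`.
injections-restricted r (suc p) zero    = lemma p r (derangements r (suc p)) (derangements r p)
  where
  lemma : ∀ p r x y → (suc p + r) * x + suc p * y ≡ suc p * (x + y) + r * x
  lemma = solve-∀
injections-restricted r zero    (suc q) = begin
  injections r 2 q + injections r 1 q
    ≡⟨ cong₂ _+_ (injections-restricted r 1 q) (injections-restricted r 0 q) ⟩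
  1 * (x + y) + (q + r) * x + (q + r) * y
    ≡⟨ lemma q r x y ⟩
  x + y + (q + r) * (x + y)
    ∎
  where
  x = injections r 1 q
  y = injections r 0 q
  lemma : ∀ q r x y → 1 * (x + y) + (q + r) * x + (q + r) * y ≡ x + y + (q + r) * (x + y)
  lemma = solve-∀
injections-restricted r (suc p) (suc q) = begin
  injections r (3 + p) q + z
    ≡⟨ cong₂ _+_ (injections-restricted r (2 + p) q) (injections-restricted r (1 + p) q) ⟩
  (2 + p) * (z + x) + (q + r) * z + (suc p * (x + y) + (q + r) * x)
    ≡⟨ lemma p q r x y z ⟩
  suc p * (z + x + (x + y)) + (suc q + r) * (z + x)
    ∎
  where
  x = injections r (1 + p) q
  y = injections r p q
  z = injections r (2 + p) q
  lemma : ∀ p q r x y z →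
    (2 + p) * (z + x) + (q + r) * z + (suc p * (x + y) + (q + r) * x) ≡
    suc p * (z + x + (x + y)) + (suc q + r) * (z + x)
  lemma = solve-∀

-- Lifting the prohibition on the next point makes its own value one more value forbidden to nobody,
-- so the `q + r` of `injections-restricted` becomes `suc q + r`.
injections-unrestricted : ∀ r p q →
  injections r p (suc q) ≡ p * injections r (pred p) (suc q) + (suc q + r) * injections r p q
injections-unrestricted r p q =
  trans (cong (_+ injections r p q) (injections-restricted r p q))
        (lemma (p * injections r (pred p) (suc q)) q r (injections r p q))
  where
  lemma : ∀ w q r x → w + (q + r) * x + x ≡ w + (suc q + r) * x
  lemma = solve-∀

-- Both sides count `n` restricted points and one unrestricted point in `n + 1 + r` values. On the
-- left the restricted points go first and leave `r + 1` values to the other; on the right the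
-- unrestricted point avoids one chosen value or takes it.
derangements-suc : ∀ r n →
  suc r * derangements (suc r) n ≡ derangements r (suc n) + derangements r n
derangements-suc r zero          = lemma r
  where
  lemma : ∀ r → suc r * 1 ≡ r + 1
  lemma = solve-∀
derangements-suc r (suc zero)    = lemma r
  where
  lemma : ∀ r → suc r * suc r ≡ (1 + r) * r + 1 * 1 + r
  lemma = solve-∀
derangements-suc r (suc (suc n)) = begin
  suc r * ((suc n + suc r) * d′ (suc n) + suc n * d′ n)
    ≡⟨ distrib r n (d′ (suc n)) (d′ n) ⟩
  (suc n + suc r) * (suc r * d′ (suc n)) + suc n * (suc r * d′ n)
    ≡⟨ cong₂ (λ x y → (suc n + suc r) * x + suc n * y) (derangements-suc r (suc n)) (derangements-suc r n) ⟩
  (suc n + suc r) * (d (2 + n) + d (suc n)) + suc n * (d (suc n) + d n)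
    ≡⟨ lemma r n (d (2 + n)) (d (suc n)) (d n) ⟩
  (suc (suc n) + r) * d (2 + n) + suc (suc n) * d (suc n) + d (2 + n)
    ∎
  where
  d = derangements r
  d′ = derangements (suc r)
  distrib : ∀ r n x y → suc r * ((suc n + suc r) * x + suc n * y) ≡
    (suc n + suc r) * (suc r * x) + suc n * (suc r * y)
  distrib = solve-∀
  lemma : ∀ r n z x y →
    (suc n + suc r) * (z + x) + suc n * (x + y) ≡
    (suc (suc n) + r) * z + suc (suc n) * x + ((suc n + r) * x + suc n * y)
  lemma = solve-∀

derangements-suc-suc : ∀ r n →
  derangements (suc r) (suc n) ≡ derangements r (suc n) + suc n * derangements (suc r) n
derangements-suc-suc r n = *-cancelˡ-≡ _ _ (suc r) (begin
  suc r * derangements (suc r) (suc n)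
    ≡⟨ derangements-suc r (suc n) ⟩
  (suc n + r) * x + suc n * y + x
    ≡⟨ lemma r n x y ⟩
  suc r * x + suc n * (x + y)
    ≡⟨ cong (λ w → suc r * x + suc n * w) (derangements-suc r n) ⟨
  suc r * x + suc n * (suc r * derangements (suc r) n)
    ≡⟨ factor r n x (derangements (suc r) n) ⟩
  suc r * (x + suc n * derangements (suc r) n)
    ∎)
  where
  x = derangements r (suc n)
  y = derangements r n
  lemma : ∀ r n x y → (suc n + r) * x + suc n * y + x ≡ suc r * x + suc n * (x + y)
  lemma = solve-∀
  factor : ∀ r n x y → suc r * x + suc n * (suc r * y) ≡ suc r * (x + suc n * y)
  factor = solve-∀

-- With `d` points and `d + d` values this is a_d, by `a≡diagonal`; the arithmetic uses only this
-- recursive form.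
diagonal : ℕ → ℕ
diagonal d = derangements d d

-- The relations between neighbouring `r` lead from the diagonal to the entries beside it and back.
-- Of the two copies of `suc d * y`, one is `w + diagonal d`; the other joins this `w` to form a
-- further `x`, which turns `4 * d + 5` into `4 * d + 6`.
diagonal-suc-suc : ∀ d → diagonal (2 + d) ≡ (4 * d + 6) * diagonal (suc d) + diagonal d
diagonal-suc-suc d = begin
  diagonal (2 + d)
    ≡⟨ derangements-suc-suc (suc d) (suc d) ⟩
  z + (2 + d) * derangements (2 + d) (suc d)
    ≡⟨ cong (z +_) (derangements-suc (suc d) (suc d)) ⟩
  z + (z + x)
    ≡⟨ expand d x y ⟩
  (4 * d + 5) * x + (suc d * y + suc d * y)
    ≡⟨ cong (λ v → (4 * d + 5) * x + (v + suc d * y)) (derangements-suc d d) ⟩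
  (4 * d + 5) * x + (w + diagonal d + suc d * y)
    ≡⟨ regroup ((4 * d + 5) * x) w (diagonal d) (suc d * y) ⟩
  (4 * d + 5) * x + (w + suc d * y) + diagonal d
    ≡⟨ cong (λ v → (4 * d + 5) * x + v + diagonal d) (derangements-suc-suc d d) ⟨
  (4 * d + 5) * x + x + diagonal d
    ≡⟨ collect d x (diagonal d) ⟩
  (4 * d + 6) * x + diagonal d
    ∎
  where
  x = diagonal (suc d)
  y = derangements (suc d) d
  z = derangements (suc d) (2 + d)
  w = derangements d (suc d)
  expand : ∀ d x y →
    (suc d + suc d) * x + suc d * y + ((suc d + suc d) * x + suc d * y + x) ≡
    (4 * d + 5) * x + (suc d * y + suc d * y)
  expand = solve-∀
  regroup : ∀ p q r s → p + (q + r + s) ≡ p + (q + s) + r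
  regroup = solve-∀
  collect : ∀ d x y → (4 * d + 5) * x + x + y ≡ (4 * d + 6) * x + y
  collect = solve-∀

-- Binomial sums

-- g s = (2s)! / s!

g : ℕ → ℕ
g zero    = 1
g (suc s) = 2 * (2 * s + 1) * g s

differences : ℕ → ℕ
differences zero          = 1
differences (suc zero)    = 0
differences (suc (suc d)) = (4 * d + 5) * diagonal (suc d) + diagonal d

differences-diagonal : ∀ d → differences (suc d) + diagonal d ≡ diagonal (suc d)
differences-diagonal zero    = refl
differences-diagonal (suc d) = trans (lemma d (diagonal (suc d)) (diagonal d)) (sym (diagonal-suc-suc d))
  where
  lemma : ∀ d x y → (4 * d + 5) * x + y + x ≡ (4 * d + 6) * x + y
  lemma = solve-∀

pascal : ∀ n k → suc n C suc k ≡ n C k + n C suc k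
pascal n k = sym (nCk+nC[k+1]≡[n+1]C[k+1] n k)

nC0≡1 : ∀ n → n C 0 ≡ 1
nC0≡1 n = trans (nCk≡nC[n∸k] {k = 0} {n = n} z≤n) (nCn≡1 n)

absorption : ∀ n k → suc k * (suc n C suc k) ≡ suc n * (n C k)
absorption zero    zero    = refl
absorption zero    (suc k) = *-zeroʳ k
absorption (suc n) zero    = begin
  1 * ((2 + n) C 1)            ≡⟨ cong (1 *_) (pascal (suc n) 0) ⟩
  1 * ((1 + n) C 0 + (1 + n) C 1) ≡⟨ lemma (suc n C 0) (suc n C 1) ⟩
  (1 + n) C 0 + 1 * ((1 + n) C 1) ≡⟨ cong₂ _+_ (nC0≡1 (suc n)) (absorption n 0) ⟩
  1 + suc n * (n C 0)          ≡⟨ cong (λ x → 1 + suc n * x) (nC0≡1 n) ⟩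
  1 + suc n * 1                ≡⟨ cong ((2 + n) *_) (nC0≡1 (suc n)) ⟨
  (2 + n) * (suc n C 0)        ∎
  where
  lemma : ∀ x y → 1 * (x + y) ≡ x + 1 * y
  lemma = solve-∀
absorption (suc n) (suc k) = begin
  (2 + k) * ((2 + n) C (2 + k))
    ≡⟨ cong ((2 + k) *_) (pascal (suc n) (suc k)) ⟩
  (2 + k) * (x + suc n C (2 + k))
    ≡⟨ expand k x (suc n C (2 + k)) ⟩
  x + suc k * x + (2 + k) * (suc n C (2 + k))
    ≡⟨ cong₂ (λ v w → x + v + w) (absorption n k) (absorption n (suc k)) ⟩
  x + suc n * (n C k) + suc n * (n C suc k)
    ≡⟨ collect n x (n C k) (n C suc k) ⟩
  x + suc n * (n C k + n C suc k)
    ≡⟨ cong (λ v → x + suc n * v) (pascal n k) ⟨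
  (2 + n) * x
    ∎
  where
  x = suc n C suc k
  expand : ∀ k x y → (2 + k) * (x + y) ≡ x + suc k * x + (2 + k) * y
  expand = solve-∀
  collect : ∀ n x y z → x + suc n * y + suc n * z ≡ x + suc n * (y + z)
  collect = solve-∀

-- Entries of the rows 2s and 2s + 1 of Pascal's triangle, indexed by their distance from the
-- middle.
even : ℕ → ℕ → ℕ
even s d = (2 * s) C (s + d)

odd : ℕ → ℕ → ℕ
odd s d = suc (2 * s) C suc (s + d)

odd-pascal : ∀ s d → odd s d ≡ even s d + even s (suc d)
odd-pascal s d rewrite +-suc s d = pascal (2 * s) (s + d)

even-pascal : ∀ s d → even (suc s) (suc d) ≡ odd s d + odd s (suc d)
even-pascal s d rewrite +-suc s d | +-suc s (s + 0) = pascal (suc (2 * s)) (suc (s + d))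

-- In the middle column one of the two upper neighbours lies across the axis of the triangle; by
-- symmetry it equals the other.
even-pascal₀ : ∀ s → even (suc s) 0 ≡ odd s 0 + odd s 0
even-pascal₀ s rewrite +-identityʳ s | +-suc s s = begin
  suc (suc (s + s)) C suc s
    ≡⟨ pascal (suc (s + s)) s ⟩
  suc (s + s) C s + suc (s + s) C suc s
    ≡⟨ cong (_+ suc (s + s) C suc s) (nCk≡nC[n∸k] (m≤n⇒m≤1+n (m≤m+n s s))) ⟩
  suc (s + s) C (suc (s + s) ∸ s) + suc (s + s) C suc s
    ≡⟨ cong (λ k → suc (s + s) C k + suc (s + s) C suc s) (m+n∸n≡m (suc s) s) ⟩
  suc (s + s) C suc s + suc (s + s) C suc s
    ∎

even-vanishes : ∀ {s d} → s < d → even s d ≡ 0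
even-vanishes {s} {d} s<d = k>n⇒nCk≡0 (subst (_< s + d) (cong (s +_) (sym (+-identityʳ s))) (+-monoʳ-< s s<d))

odd-vanishes : ∀ {s d} → s < d → odd s d ≡ 0
odd-vanishes {s} {d} s<d = k>n⇒nCk≡0 (s≤s (subst (_< s + d) (cong (s +_) (sym (+-identityʳ s))) (+-monoʳ-< s s<d)))

-- Additive form of the ballot number formula: the difference of neighbours C(2s, s + d) - C(2s, s +
-- d + 1) is (2d + 1) / (2s + 1) times C(2s + 1, s + d + 1). After adding `(2 * s + 1) * x` to both
-- sides it is twice the absorption identity.
ballot : ∀ s d → (2 * d + 1) * odd s d + (2 * s + 1) * even s (suc d) ≡ (2 * s + 1) * even s d
ballot s d = +-cancelʳ-≡ ((2 * s + 1) * x) _ _ (begin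
  (2 * d + 1) * odd s d + (2 * s + 1) * y + (2 * s + 1) * x
    ≡⟨ cong (λ v → (2 * d + 1) * v + (2 * s + 1) * y + (2 * s + 1) * x) (odd-pascal s d) ⟩
  (2 * d + 1) * (x + y) + (2 * s + 1) * y + (2 * s + 1) * x
    ≡⟨ lemma s d x y ⟩
  2 * (suc (s + d) * (x + y))
    ≡⟨ cong (λ v → 2 * (suc (s + d) * v)) (odd-pascal s d) ⟨
  2 * (suc (s + d) * odd s d)
    ≡⟨ cong (2 *_) (absorption (2 * s) (s + d)) ⟩
  2 * (suc (2 * s) * x)
    ≡⟨ double s x ⟩
  (2 * s + 1) * x + (2 * s + 1) * x
    ∎)
  where
  x = even s d
  y = even s (suc d)
  lemma : ∀ s d x y → (2 * d + 1) * (x + y) + (2 * s + 1) * y + (2 * s + 1) * x ≡ 2 * (suc (s + d) * (x + y))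
  lemma = solve-∀
  double : ∀ s x → 2 * (suc (2 * s) * x) ≡ (2 * s + 1) * x + (2 * s + 1) * x
  double = solve-∀

-- The two sums telescope because 2 (2d + 1) a d = a (d + 1) − a (d − 1).

odd-even-telescope : ∀ s n →
  2 * ∑< (suc n) (λ d → (2 * d + 1) * diagonal d * odd s d) + ∑< (suc n) (λ d → diagonal d * even (suc s) (suc d)) ≡
  ∑< (suc n) (λ d → diagonal d * even (suc s) d) + (diagonal (suc n) * odd s n + diagonal n * odd s (suc n))
odd-even-telescope s zero    rewrite even-pascal s 0 | even-pascal₀ s = lemma (odd s 0) (odd s 1)
  where
  lemma : ∀ x y → 2 * (0 + (2 * 0 + 1) * 1 * x) + (0 + 1 * (x + y)) ≡ 0 + 1 * (x + x) + (1 * x + 1 * y)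
  lemma = solve-∀
odd-even-telescope s (suc n) = begin
  2 * (w + (2 * suc n + 1) * a′ * y) + (v + a′ * even (suc s) (2 + n))
    ≡⟨ cong (λ t → 2 * (w + (2 * suc n + 1) * a′ * y) + (v + a′ * t)) (even-pascal s (suc n)) ⟩
  2 * (w + (2 * suc n + 1) * a′ * y) + (v + a′ * (y + z))
    ≡⟨ regroup w v n a′ y z ⟩
  2 * w + v + ((4 * n + 6) * a′ * y + a′ * (y + z))
    ≡⟨ cong (_+ ((4 * n + 6) * a′ * y + a′ * (y + z))) (odd-even-telescope s n) ⟩
  u + (a′ * x + diagonal n * y) + ((4 * n + 6) * a′ * y + a′ * (y + z))
    ≡⟨ collect u x y z n a′ (diagonal n) ⟩
  u + a′ * (x + y) + (((4 * n + 6) * a′ + diagonal n) * y + a′ * z)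
    ≡⟨ cong₂ (λ p q → u + a′ * p + (q * y + a′ * z)) (even-pascal s n) (diagonal-suc-suc n) ⟨
  u + a′ * even (suc s) (suc n) + (diagonal (2 + n) * y + a′ * z)
    ∎
  where
  a′ = diagonal (suc n)
  x = odd s n
  y = odd s (suc n)
  z = odd s (2 + n)
  u = ∑< (suc n) (λ d → diagonal d * even (suc s) d)
  v = ∑< (suc n) (λ d → diagonal d * even (suc s) (suc d))
  w = ∑< (suc n) (λ d → (2 * d + 1) * diagonal d * odd s d)
  regroup : ∀ w v n a′ y z →
    2 * (w + (2 * suc n + 1) * a′ * y) + (v + a′ * (y + z)) ≡
    2 * w + v + ((4 * n + 6) * a′ * y + a′ * (y + z))
  regroup = solve-∀
  collect : ∀ u x y z n a′ a →
    u + (a′ * x + a * y) + ((4 * n + 6) * a′ * y + a′ * (y + z)) ≡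
    u + a′ * (x + y) + (((4 * n + 6) * a′ + a) * y + a′ * z)
  collect = solve-∀

-- A mutual induction: `ballot` leads from `even-sum` at `s` to `odd-sum` at `s`, and the telescope
-- together with g (s + 1) = 2 (2s + 1) g s leads on to `even-sum` at `suc s`. The bound `n` is left
-- free because both sums are later taken up to the same β + 1.
even-sum : ∀ s n → s ≤ n →
  ∑< (suc n) (λ d → diagonal d * even s d) ≡ g s + ∑< (suc n) (λ d → diagonal d * even s (suc d))
odd-sum : ∀ s n → s ≤ n →
  ∑< (suc n) (λ d → (2 * d + 1) * diagonal d * odd s d) ≡ (2 * s + 1) * g s

even-sum zero n _ = begin
  ∑< (suc n) (λ d → diagonal d * even 0 d)
    ≡⟨ ∑<-suc n (λ d → diagonal d * even 0 d) ⟩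
  1 + ∑< n (λ d → diagonal (suc d) * even 0 (suc d))
    ≡⟨ cong suc (vanish n suc) ⟩
  1 + 0
    ≡⟨ cong suc (vanish (suc n) (λ d → d)) ⟨
  1 + ∑< (suc n) (λ d → diagonal d * even 0 (suc d))
    ∎
  where
  vanish : ∀ n (f : ℕ → ℕ) → ∑< n (λ d → diagonal (f d) * even 0 (suc d)) ≡ 0
  vanish n f = trans (∑<-cong n λ d _ → *-zeroʳ (diagonal (f d))) (∑<-zero n)
even-sum (suc s) n s<n = begin
  u
    ≡⟨ +-identityʳ u ⟨
  u + 0
    ≡⟨ cong (u +_) boundary ⟨
  u + (diagonal (suc n) * odd s n + diagonal n * odd s (suc n))
    ≡⟨ odd-even-telescope s n ⟨
  2 * ∑< (suc n) (λ d → (2 * d + 1) * diagonal d * odd s d) + v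
    ≡⟨ cong (λ t → 2 * t + v) (odd-sum s n (<⇒≤ s<n)) ⟩
  2 * ((2 * s + 1) * g s) + v
    ≡⟨ cong (_+ v) (*-assoc 2 (2 * s + 1) (g s)) ⟨
  g (suc s) + v
    ∎
  where
  u = ∑< (suc n) (λ d → diagonal d * even (suc s) d)
  v = ∑< (suc n) (λ d → diagonal d * even (suc s) (suc d))
  -- Here `n` exceeds `s`, so the end terms of the telescope lie beyond the row 2s + 1.
  boundary : diagonal (suc n) * odd s n + diagonal n * odd s (suc n) ≡ 0
  boundary rewrite odd-vanishes s<n | odd-vanishes (m<n⇒m<1+n s<n) =
    cong₂ _+_ (*-zeroʳ (diagonal (suc n))) (*-zeroʳ (diagonal n))

odd-sum s n s≤n = +-cancelʳ-≡ (c * v) _ _ (begin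
  ∑< (suc n) (λ d → (2 * d + 1) * diagonal d * odd s d) + c * v
    ≡⟨ cong (∑< (suc n) (λ d → (2 * d + 1) * diagonal d * odd s d) +_) (*-distribˡ-∑< (suc n) c (λ d → diagonal d * even s (suc d))) ⟩
  ∑< (suc n) (λ d → (2 * d + 1) * diagonal d * odd s d) + ∑< (suc n) (λ d → c * (diagonal d * even s (suc d)))
    ≡⟨ ∑<-distrib-+ (suc n) (λ d → (2 * d + 1) * diagonal d * odd s d) (λ d → c * (diagonal d * even s (suc d))) ⟨
  ∑< (suc n) (λ d → (2 * d + 1) * diagonal d * odd s d + c * (diagonal d * even s (suc d)))
    ≡⟨ ∑<-cong (suc n) (λ d _ → step d) ⟩
  ∑< (suc n) (λ d → c * (diagonal d * even s d))
    ≡⟨ *-distribˡ-∑< (suc n) c (λ d → diagonal d * even s d) ⟨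
  c * ∑< (suc n) (λ d → diagonal d * even s d)
    ≡⟨ cong (c *_) (even-sum s n s≤n) ⟩
  c * (g s + v)
    ≡⟨ *-distribˡ-+ c (g s) v ⟩
  c * g s + c * v
    ∎)
  where
  c = 2 * s + 1
  v = ∑< (suc n) (λ d → diagonal d * even s (suc d))
  factor : ∀ p q x y z → p * x * y + q * (x * z) ≡ x * (p * y + q * z)
  factor = solve-∀
  swap : ∀ p q r → p * (q * r) ≡ q * (p * r)
  swap = solve-∀
  step : ∀ d → (2 * d + 1) * diagonal d * odd s d + c * (diagonal d * even s (suc d)) ≡ c * (diagonal d * even s d)
  step d = begin
    (2 * d + 1) * diagonal d * odd s d + c * (diagonal d * even s (suc d))
      ≡⟨ factor (2 * d + 1) c (diagonal d) (odd s d) (even s (suc d)) ⟩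
    diagonal d * ((2 * d + 1) * odd s d + c * even s (suc d))
      ≡⟨ cong (diagonal d *_) (ballot s d) ⟩
    diagonal d * (c * even s d)
      ≡⟨ swap (diagonal d) c (even s d) ⟩
    c * (diagonal d * even s d)
      ∎

-- Every a_{d+1} is split into its difference and a_d, which moves the subtracted part of the sum
-- one column outwards.
differences-summation : ∀ s n →
  ∑< (suc n) (λ d → differences d * even s d) + ∑< n (λ d → diagonal d * even s (suc d)) ≡
  ∑< (suc n) (λ d → diagonal d * even s d)
differences-summation s zero    = +-identityʳ _
differences-summation s (suc n) = begin
  w + differences (suc n) * y + (v + diagonal n * y)
    ≡⟨ regroup w v (differences (suc n)) (diagonal n) y ⟩
  w + v + (differences (suc n) + diagonal n) * y
    ≡⟨ cong₂ (λ p q → p + q * y) (differences-summation s n) (differences-diagonal n) ⟩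
  ∑< (suc n) (λ d → diagonal d * even s d) + diagonal (suc n) * y
    ∎
  where
  y = even s (suc n)
  w = ∑< (suc n) (λ d → differences d * even s d)
  v = ∑< n (λ d → diagonal d * even s (suc d))
  regroup : ∀ w v b a y → w + b * y + (v + a * y) ≡ w + v + (b + a) * y
  regroup = solve-∀

differences-sum : ∀ s n → s ≤ n → ∑< (suc n) (λ d → differences d * even s d) ≡ g s
differences-sum s n s≤n = +-cancelʳ-≡ v _ _ (begin
  ∑< (suc n) (λ d → differences d * even s d) + v ≡⟨ differences-summation s n ⟩
  ∑< (suc n) (λ d → diagonal d * even s d)              ≡⟨ even-sum s n s≤n ⟩
  -- The subtracted sum in `even-sum` has one term more than `v`; as `s ≤ n`, that term lies outside
  -- the row.
  g s + (v + diagonal n * even s (suc n))               ≡⟨ cong (λ t → g s + (v + diagonal n * t)) (even-vanishes (s≤s s≤n)) ⟩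
  g s + (v + diagonal n * 0)                            ≡⟨ cong (λ t → g s + (v + t)) (*-zeroʳ (diagonal n)) ⟩
  g s + (v + 0)                                   ≡⟨ cong (g s +_) (+-identityʳ v) ⟩
  g s + v                                         ∎)
  where
  v = ∑< n (λ d → diagonal d * even s (suc d))

-- Counting functions

length-filter-≐ : ∀ {A : Set} {P Q : A → Set} (P? : U.Decidable P) (Q? : U.Decidable Q) →
  (∀ x → P x ⇔ Q x) → ∀ xs → length (filter P? xs) ≡ length (filter Q? xs)
length-filter-≐ P? Q? P⇔Q xs =
  cong length (List.filter-≐ P? Q? ((λ {x} → Equivalence.to (P⇔Q x)) , (λ {x} → Equivalence.from (P⇔Q x))) xs)

#functions-cong : ∀ {n k} {P Q : Vec (Fin k) n → Set} (P? : U.Decidable P) (Q? : U.Decidable Q) →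
  (∀ f → P f ⇔ Q f) → #functions P? ≡ #functions Q?
#functions-cong P? Q? P⇔Q = length-filter-≐ P? Q? P⇔Q (functions _ _)

#functions-none : ∀ {n k} {P : Vec (Fin k) n → Set} (P? : U.Decidable P) →
  (∀ f → ¬ P f) → #functions P? ≡ 0
#functions-none P? ¬P = cong length (List.filter-none P? (All.universal ¬P (functions _ _)))

#functions-suc : ∀ {n k} {P : Vec (Fin k) (suc n) → Set} (P? : U.Decidable P) →
  #functions P? ≡ sum (λ c → #functions (P? ∘ (c ∷_)))
#functions-suc {n} {k} P? = go k id
  where
  filter-map : ∀ {c} fs → length (filter P? (List.map (c ∷_) fs)) ≡ length (filter (P? ∘ (c ∷_)) fs)
  filter-map [] = refl
  filter-map {c} (f ∷ fs) with does (P? (c ∷ f))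
  ... | true  = cong suc (filter-map fs)
  ... | false = filter-map fs
  go : ∀ m (ι : Fin m → Fin k) →
    length (filter P? (cartesianProductWith _∷_ (List.tabulate ι) (functions n k))) ≡
    sum (λ c → #functions (P? ∘ (ι c ∷_)))
  go zero    ι = refl
  go (suc m) ι = begin
    length (filter P? (xs List.++ ys))                      ≡⟨ cong length (List.filter-++ P? xs ys) ⟩
    length (filter P? xs List.++ filter P? ys)              ≡⟨ List.length-++ (filter P? xs) ⟩
    length (filter P? xs) + length (filter P? ys)      ≡⟨ cong₂ _+_ (filter-map (functions n k)) (go m (ι ∘ suc)) ⟩
    sum (λ c → #functions (P? ∘ (ι c ∷_)))             ∎
    where
    xs = List.map (ι zero ∷_) (functions n k)
    ys = cartesianProductWith _∷_ (List.tabulate (ι ∘ suc)) (functions n k)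

sum-extract : ∀ {n} (c : Fin n) (f : Fin n → ℕ) →
  sum f ≡ f c + sum (λ x → if does (x Fin.≟ c) then 0 else f x)
sum-extract zero    f = refl
sum-extract (suc c) f = trans (cong (f zero +_) (sum-extract c (f ∘ suc))) (swap (f zero) (f (suc c)) _)
  where
  swap : ∀ x y z → x + (y + z) ≡ y + (x + z)
  swap = solve-∀

-- Counting injections without fixed points

module _ {m : ℕ} where

  indicator : Bool → ℕ
  indicator b = if b then 1 else 0

  card : (Fin m → Bool) → ℕ
  card S = sum (indicator ∘ S)

  _∖_ : (Fin m → Bool) → Fin m → Fin m → Bool
  (S ∖ c) x = not (does (x Fin.≟ c)) ∧ S x

  card-cong : ∀ {S T : Fin m → Bool} → (∀ c → S c ≡ T c) → card S ≡ card T
  card-cong S≗T = sum-cong-≗ (cong indicator ∘ S≗T)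

  card-∖ : ∀ (S : Fin m → Bool) c → card S ≡ indicator (S c) + card (S ∖ c)
  card-∖ S c = trans (sum-extract c (indicator ∘ S)) (cong (indicator (S c) +_) (sum-cong-≗ pointwise))
    where
    pointwise : ∀ x → (if does (x Fin.≟ c) then 0 else indicator (S x)) ≡ indicator ((S ∖ c) x)
    pointwise x with does (x Fin.≟ c)
    ... | true  = refl
    ... | false = refl

  card-split : ∀ (S T : Fin m → Bool) → card S ≡ card (λ x → S x ∧ T x) + card (λ x → S x ∧ not (T x))
  card-split S T = trans (sum-cong-≗ pointwise) (∑-distrib-+ (λ x → indicator (S x ∧ T x)) (λ x → indicator (S x ∧ not (T x))))
    where
    pointwise : ∀ x → indicator (S x) ≡ indicator (S x ∧ T x) + indicator (S x ∧ not (T x))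
    pointwise x with S x | T x
    ... | false | _     = refl
    ... | true  | true  = refl
    ... | true  | false = refl

  sum-split : ∀ (S T : Fin m → Bool) x y →
    sum (λ c → if S c then (if T c then x else y) else 0) ≡
    card (λ c → S c ∧ T c) * x + card (λ c → S c ∧ not (T c)) * y
  sum-split S T x y = begin
    sum (λ c → if S c then (if T c then x else y) else 0)
      ≡⟨ sum-cong-≗ pointwise ⟩
    sum (λ c → indicator (S c ∧ T c) * x + indicator (S c ∧ not (T c)) * y)
      ≡⟨ ∑-distrib-+ (λ c → indicator (S c ∧ T c) * x) (λ c → indicator (S c ∧ not (T c)) * y) ⟩
    sum (λ c → indicator (S c ∧ T c) * x) + sum (λ c → indicator (S c ∧ not (T c)) * y)
      ≡⟨ cong₂ _+_ (*-distribʳ-sum x (λ c → indicator (S c ∧ T c))) (*-distribʳ-sum y (λ c → indicator (S c ∧ not (T c)))) ⟨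
    card (λ c → S c ∧ T c) * x + card (λ c → S c ∧ not (T c)) * y
      ∎
    where
    pointwise : ∀ c → (if S c then (if T c then x else y) else 0) ≡
      indicator (S c ∧ T c) * x + indicator (S c ∧ not (T c)) * y
    pointwise c with S c | T c
    ... | false | _     = refl
    ... | true  | true  = sym (trans (+-identityʳ _) (+-identityʳ x))
    ... | true  | false = sym (+-identityʳ y)

  -- The points i, i + 1, … receive distinct values in S, the set of values
  -- that are still available.

  Admissible : ∀ {n} → ℕ → (Fin m → Bool) → Vec (Fin m) n → Set
  Admissible i S []      = ⊤
  Admissible i S (c ∷ f) = (S c ≡ true × toℕ c ≢ i) × Admissible (suc i) (S ∖ c) f

  admissible? : ∀ {n} i S → U.Decidable (Admissible {n} i S)
  admissible? i S []      = yes tt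
  admissible? i S (c ∷ f) = ((S c Bool.≟ true) ×-dec ¬? (toℕ c ℕ.≟ i)) ×-dec admissible? (suc i) (S ∖ c) f

  module _ (d : ℕ) (d≤m : d ≤ m) where

    -- The forbidden values of the points i, ..., d - 1, which are still to be placed.
    window : ℕ → Fin m → Bool
    window i c = (i ≤ᵇ toℕ c) ∧ (toℕ c <ᵇ d)

    -- A remaining point is restricted only while its forbidden value is available. So the sizes of
    -- `free` and `taken` are the numbers of restricted and unrestricted points, the `p` and `q` of
    -- `injections`.
    free taken : ℕ → (Fin m → Bool) → Fin m → Bool
    free  i S c = S c ∧ window i c
    taken i S c = not (S c) ∧ window i c

    window-∖ : ∀ {i} (i<d : i < d) c → let c₀ = fromℕ< (<-≤-trans i<d d≤m) in
      not (does (c Fin.≟ c₀)) ∧ window i c ≡ window (suc i) c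
    window-∖ {i} i<d c with c Fin.≟ fromℕ< (<-≤-trans i<d d≤m)
    ... | yes refl rewrite Fin.toℕ-fromℕ< (<-≤-trans i<d d≤m) | dec-false (i ℕ.<? i) (<-irrefl refl) = refl
    ... | no  c≢c₀ = cong (_∧ (toℕ c <ᵇ d)) (does-⇔ (mk⇔ (λ i≤c → ≤∧≢⇒< i≤c (i≢c ∘ sym)) <⇒≤) (i ℕ.≤? toℕ c) (i ℕ.<? toℕ c))
      where
      i≢c : toℕ c ≢ i
      i≢c c≡i = c≢c₀ (Fin.toℕ-injective (trans c≡i (sym (Fin.toℕ-fromℕ< _))))

    window-fromℕ< : ∀ {i} (i<d : i < d) → window i (fromℕ< (<-≤-trans i<d d≤m)) ≡ true
    window-fromℕ< {i} i<d rewrite Fin.toℕ-fromℕ< (<-≤-trans i<d d≤m)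
      | dec-true (i ℕ.≤? i) ≤-refl | dec-true (i ℕ.<? d) i<d = refl

    window-end : ∀ {i} → i ≡ d → ∀ c → window i c ≡ false
    window-end refl c with d ℕ.≤? toℕ c
    ... | yes d≤c = trans (cong ((d ≤ᵇ toℕ c) ∧_) (dec-false (toℕ c ℕ.<? d) (≤⇒≯ d≤c))) (∧-zeroʳ (d ≤ᵇ toℕ c))
    ... | no  d≰c = cong (_∧ (toℕ c <ᵇ d)) (dec-false (d ℕ.≤? toℕ c) d≰c)

    -- The surplus `r` of values over points never changes. Placing point `i` excludes its own value
    -- `c₀`; a value in `later` turns a restricted point into an unrestricted one, any other leaves
    -- `l` and `u` as they are. Whether `c₀` is still available decides which of the two recurrences
    -- for `injections` applies.
    #admissible : ∀ n i S p q r → i + n ≡ d →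
      card (free i S) ≡ p → card (taken i S) ≡ q → card S ≡ p + q + r →
      #functions (admissible? {n} i S) ≡ injections r p q
    #admissible zero i S p q r i+0≡d refl refl _ =
      -- No point remains, so the window is empty and `p` and `q` are both 0.
      sym (cong₂ (injections r) (none S) (none (not ∘ S)))
      where
      i≡d : i ≡ d
      i≡d = trans (sym (+-identityʳ i)) i+0≡d
      none : ∀ (T : Fin m → Bool) → card (λ c → T c ∧ window i c) ≡ 0
      none T = trans (sum-cong-≗ λ c → cong indicator (trans (cong (T c ∧_) (window-end i≡d c)) (∧-zeroʳ (T c))))
        (sum-replicate-zero m)
    #admissible (suc n) i S p q r i+n≡d #free #taken #S = begin
      #functions (admissible? {suc n} i S)
        ≡⟨ #functions-suc (admissible? {suc n} i S) ⟩
      sum (λ c → #functions (λ f → admissible? {suc n} i S (c ∷ f)))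
        ≡⟨ sum-cong-≗ first ⟩
      sum (λ c → if (S ∖ c₀) c then (if later c then x else y) else 0)
        ≡⟨ sum-split (S ∖ c₀) later x y ⟩
      card (λ c → (S ∖ c₀) c ∧ later c) * x + o * y
        ≡⟨ cong (λ v → v * x + o * y) #later ⟩
      l * x + o * y
        ≡⟨ combine (S c₀) refl ⟩
      injections r p q
        ∎
      where
      i<d : i < d
      i<d = subst (i <_) i+n≡d (m<m+n i z<s)
      c₀ = fromℕ< (<-≤-trans i<d d≤m)
      later = window (suc i)
      l = card (free (suc i) S)
      u = card (taken (suc i) S)
      o = card (λ c → (S ∖ c₀) c ∧ not (later c))
      x = injections r (pred l) (suc u)
      y = injections r l u

      -- `c₀` is the smallest value of the window, so advancing to `later` removes only `c₀`. This
      -- is used for `S` and for its complement.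
      shrink : ∀ (T : Fin m → Bool) → card (λ c → T c ∧ window i c) ≡ indicator (T c₀) + card (λ c → T c ∧ later c)
      shrink T = begin
        card (λ c → T c ∧ window i c)
          ≡⟨ card-∖ (λ c → T c ∧ window i c) c₀ ⟩
        indicator (T c₀ ∧ window i c₀) + card ((λ c → T c ∧ window i c) ∖ c₀)
          ≡⟨ cong₂ _+_ (cong indicator (trans (cong (T c₀ ∧_) (window-fromℕ< i<d)) (∧-identityʳ (T c₀)))) (card-cong pointwise) ⟩
        indicator (T c₀) + card (λ c → T c ∧ later c)
          ∎
        where
        pointwise : ∀ c → ((λ c → T c ∧ window i c) ∖ c₀) c ≡ T c ∧ later c
        pointwise c rewrite sym (window-∖ i<d c) with does (c Fin.≟ c₀)
        ... | true  = sym (∧-zeroʳ (T c))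
        ... | false = refl

      #later : card (λ c → (S ∖ c₀) c ∧ later c) ≡ l
      #later = card-cong pointwise
        where
        pointwise : ∀ c → (S ∖ c₀) c ∧ later c ≡ S c ∧ later c
        pointwise c rewrite sym (window-∖ i<d c) with does (c Fin.≟ c₀)
        ... | true  = sym (∧-zeroʳ (S c))
        ... | false = refl

      #S-split : indicator (S c₀) + (l + o) ≡ p + q + r
      #S-split = begin
        indicator (S c₀) + (l + o)   ≡⟨ cong (λ v → indicator (S c₀) + (v + o)) #later ⟨
        indicator (S c₀) + (card (λ c → (S ∖ c₀) c ∧ later c) + o)
                                     ≡⟨ cong (indicator (S c₀) +_) (card-split (S ∖ c₀) later) ⟨
        indicator (S c₀) + card (S ∖ c₀) ≡⟨ card-∖ S c₀ ⟨
        card S                       ≡⟨ #S ⟩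
        p + q + r                    ∎

      combine : ∀ b → S c₀ ≡ b → l * x + o * y ≡ injections r p q
      combine true  S∋c₀ = sym (begin
        injections r p q                                   ≡⟨ cong₂ (injections r) p≡ q≡ ⟩
        injections r (suc l) u                             ≡⟨ injections-restricted r l u ⟩
        l * x + (u + r) * y                                ≡⟨ cong (λ v → l * x + v * y) o≡ ⟨
        l * x + o * y                                      ∎)
        where
        p≡ : p ≡ suc l
        p≡ = trans (sym #free) (trans (shrink S) (cong (λ b → indicator b + l) S∋c₀))
        q≡ : q ≡ u
        q≡ = trans (sym #taken) (trans (shrink (not ∘ S)) (cong (λ b → indicator (not b) + u) S∋c₀))
        o≡ : o ≡ u + r
        o≡ = +-cancelˡ-≡ (suc l) o (u + r) (begin
          suc l + o                   ≡⟨ cong (λ b → indicator b + (l + o)) S∋c₀ ⟨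
          indicator (S c₀) + (l + o)  ≡⟨ #S-split ⟩
          p + q + r                   ≡⟨ cong₂ (λ v w → v + w + r) p≡ q≡ ⟩
          suc l + u + r               ≡⟨ +-assoc (suc l) u r ⟩
          suc l + (u + r)             ∎)
      combine false S∌c₀ = sym (begin
        injections r p q                                   ≡⟨ cong₂ (injections r) p≡ q≡ ⟩
        injections r l (suc u)                             ≡⟨ injections-unrestricted r l u ⟩
        l * x + (suc u + r) * y                            ≡⟨ cong (λ v → l * x + v * y) o≡ ⟨
        l * x + o * y                                      ∎)
        where
        p≡ : p ≡ l
        p≡ = trans (sym #free) (trans (shrink S) (cong (λ b → indicator b + l) S∌c₀))
        q≡ : q ≡ suc u
        q≡ = trans (sym #taken) (trans (shrink (not ∘ S)) (cong (λ b → indicator (not b) + u) S∌c₀))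
        o≡ : o ≡ suc u + r
        o≡ = +-cancelˡ-≡ l o (suc u + r) (begin
          l + o                       ≡⟨ cong (λ b → indicator b + (l + o)) S∌c₀ ⟨
          indicator (S c₀) + (l + o)  ≡⟨ #S-split ⟩
          p + q + r                   ≡⟨ cong₂ (λ v w → v + w + r) p≡ q≡ ⟩
          l + suc u + r               ≡⟨ +-assoc l (suc u) r ⟩
          l + (suc u + r)             ∎)

      #free-∖ : ∀ c → S c ≡ true → l ≡ indicator (later c) + card (free (suc i) (S ∖ c))
      #free-∖ c S∋c = begin
        card (free (suc i) S)
          ≡⟨ card-∖ (free (suc i) S) c ⟩
        indicator (S c ∧ later c) + card (free (suc i) S ∖ c)
          ≡⟨ cong₂ _+_ (cong (λ b → indicator (b ∧ later c)) S∋c)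
               (card-cong λ x → sym (∧-assoc (not (does (x Fin.≟ c))) (S x) (later x))) ⟩
        indicator (later c) + card (free (suc i) (S ∖ c))
          ∎

      #taken-∖ : ∀ c → S c ≡ true → card (taken (suc i) (S ∖ c)) ≡ indicator (later c) + u
      #taken-∖ c S∋c = begin
        card (taken (suc i) (S ∖ c))
          ≡⟨ card-∖ (taken (suc i) (S ∖ c)) c ⟩
        indicator (taken (suc i) (S ∖ c) c) + card (taken (suc i) (S ∖ c) ∖ c)
          ≡⟨ cong₂ _+_ (cong (λ b → indicator (not (not b ∧ S c) ∧ later c)) (dec-true (c Fin.≟ c) refl)) (card-cong pointwise) ⟩
        indicator (later c) + card (taken (suc i) S ∖ c)
          ≡⟨ cong (λ b → indicator (later c) + (indicator (not b ∧ later c) + card (taken (suc i) S ∖ c))) S∋c ⟨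
        indicator (later c) + (indicator (taken (suc i) S c) + card (taken (suc i) S ∖ c))
          ≡⟨ cong (indicator (later c) +_) (card-∖ (taken (suc i) S) c) ⟨
        indicator (later c) + u
          ∎
        where
        pointwise : ∀ x → (taken (suc i) (S ∖ c) ∖ c) x ≡ (taken (suc i) S ∖ c) x
        pointwise x with does (x Fin.≟ c)
        ... | true  = refl
        ... | false = refl

      #S-∖ : ∀ c → S c ≡ true → card (S ∖ c) ≡ l + u + r
      #S-∖ c S∋c = suc-injective (begin
        suc (card (S ∖ c))           ≡⟨ cong (λ b → indicator b + card (S ∖ c)) S∋c ⟨
        indicator (S c) + card (S ∖ c)  ≡⟨ card-∖ S c ⟨
        card S                       ≡⟨ #S ⟩
        p + q + r                    ≡⟨ cong₂ (λ v w → v + w + r) (trans (sym #free) (shrink S)) (trans (sym #taken) (shrink (not ∘ S))) ⟩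
        indicator (S c₀) + l + (indicator (not (S c₀)) + u) + r  ≡⟨ one (S c₀) ⟩
        suc (l + u + r)              ∎)
        where
        one : ∀ b → indicator b + l + (indicator (not b) + u) + r ≡ suc (l + u + r)
        one true  = refl
        one false = cong (_+ r) (+-suc l u)

      #rest : ∀ c → S c ≡ true →
        #functions (admissible? {n} (suc i) (S ∖ c)) ≡ (if later c then x else y)
      #rest c S∋c = helper (later c) (#free-∖ c S∋c) (#taken-∖ c S∋c)
        where
        i+n≡d′ : suc i + n ≡ d
        i+n≡d′ = trans (sym (+-suc i n)) i+n≡d
        helper : ∀ b → l ≡ indicator b + card (free (suc i) (S ∖ c)) →
          card (taken (suc i) (S ∖ c)) ≡ indicator b + u →
          #functions (admissible? {n} (suc i) (S ∖ c)) ≡ (if b then x else y)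
        -- The value `c` counts in `l`, so `l` is positive and `pred l` is exact.
        helper true  l≡ u≡ = #admissible n (suc i) (S ∖ c) (pred l) (suc u) r i+n≡d′
          (sym (cong pred l≡)) u≡ (trans (#S-∖ c S∋c) (cong (_+ r) (begin
            l + u           ≡⟨ cong (_+ u) l≡ ⟩
            suc l′ + u      ≡⟨ +-suc l′ u ⟨
            l′ + suc u      ≡⟨ cong (λ v → pred v + suc u) l≡ ⟨
            pred l + suc u  ∎)))
          where l′ = card (free (suc i) (S ∖ c))
        helper false l≡ u≡ = #admissible n (suc i) (S ∖ c) l u r i+n≡d′ (sym l≡) u≡ (#S-∖ c S∋c)

      first : ∀ c → #functions (λ f → admissible? {suc n} i S (c ∷ f)) ≡
        (if (S ∖ c₀) c then (if later c then x else y) else 0)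
      first c with c Fin.≟ c₀
      ... | yes c≡c₀ = #functions-none (λ f → admissible? {suc n} i S (c ∷ f)) λ where
        f ((_ , c≢i) , _) → c≢i (trans (cong toℕ c≡c₀) (Fin.toℕ-fromℕ< _))
      ... | no  c≢c₀ = helper (S c) refl
        where
        helper : ∀ b → S c ≡ b →
          #functions (λ f → admissible? {suc n} i S (c ∷ f)) ≡ (if b then (if later c then x else y) else 0)
        helper false S∌c = #functions-none (λ f → admissible? {suc n} i S (c ∷ f)) λ where
          f ((S∋c , _) , _) → contradiction (trans (sym S∌c) S∋c) λ ()
        helper true  S∋c = trans
          (#functions-cong (λ f → admissible? {suc n} i S (c ∷ f)) (admissible? (suc i) (S ∖ c)) λ f →
            mk⇔ proj₂ (λ adm → (S∋c , λ c≡i → c≢c₀ (Fin.toℕ-injective (trans c≡i (sym (Fin.toℕ-fromℕ< _))))) , adm))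
          (#rest c S∋c)

module _ {m : ℕ} where

  private
    available : ∀ {n} i (S : Fin m → Bool) (f : Vec (Fin m) n) → Admissible i S f → ∀ j → S (lookup f j) ≡ true
    available i S (c ∷ f) ((S∋c , _) , _)   zero    = S∋c
    available i S (c ∷ f) ((S∋c , _) , adm) (suc j) with lookup f j Fin.≟ c | available (suc i) (S ∖ c) f adm j
    ... | no _ | S∋fj = S∋fj

    fresh : ∀ {n} i (S : Fin m → Bool) c (f : Vec (Fin m) n) → Admissible i (S ∖ c) f → ∀ j → lookup f j ≢ c
    fresh i S c f adm j fj≡c with available i (S ∖ c) f adm j
    ... | avail rewrite dec-true (lookup f j Fin.≟ c) fj≡c = contradiction avail λ ()

    injective : ∀ {n} i (S : Fin m → Bool) (f : Vec (Fin m) n) → Admissible i S f → ∀ j k → lookup f j ≡ lookup f k → j ≡ k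
    injective i S (c ∷ f) adm       zero    zero    _  = refl
    injective i S (c ∷ f) (_ , adm) zero    (suc k) eq = contradiction (sym eq) (fresh (suc i) S c f adm k)
    injective i S (c ∷ f) (_ , adm) (suc j) zero    eq = contradiction eq (fresh (suc i) S c f adm j)
    injective i S (c ∷ f) (_ , adm) (suc j) (suc k) eq = cong suc (injective (suc i) (S ∖ c) f adm j k eq)

    moved : ∀ {n} i (S : Fin m → Bool) (f : Vec (Fin m) n) → Admissible i S f → ∀ j → toℕ (lookup f j) ≢ i + toℕ j
    moved i S (c ∷ f) ((_ , c≢i) , _) zero    = subst (toℕ c ≢_) (sym (+-identityʳ i)) c≢i
    moved i S (c ∷ f) (_ , adm)       (suc j) = subst (toℕ (lookup f j) ≢_) (sym (+-suc i (toℕ j))) (moved (suc i) (S ∖ c) f adm j)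

    admissible : ∀ {n} i (S : Fin m → Bool) (f : Vec (Fin m) n) → (∀ j → S (lookup f j) ≡ true) →
      (∀ j k → lookup f j ≡ lookup f k → j ≡ k) → (∀ j → toℕ (lookup f j) ≢ i + toℕ j) → Admissible i S f
    admissible i S []      avail inj move = tt
    admissible i S (c ∷ f) avail inj move =
      (avail zero , subst (toℕ c ≢_) (+-identityʳ i) (move zero)) ,
      admissible (suc i) (S ∖ c) f
        (λ j → cong₂ (λ b s → not b ∧ s) (dec-false (lookup f j Fin.≟ c) (λ eq → contradiction (inj (suc j) zero eq) λ ())) (avail (suc j)))
        (λ j k eq → Fin.suc-injective (inj (suc j) (suc k) eq))
        (λ j → subst (toℕ (lookup f j) ≢_) (+-suc i (toℕ j)) (move (suc j)))

  admissible⇔ : ∀ {n} i (S : Fin m → Bool) (f : Vec (Fin m) n) →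
    Admissible i S f ⇔
    ((∀ j → S (lookup f j) ≡ true) × (∀ j k → lookup f j ≡ lookup f k → j ≡ k) × (∀ j → toℕ (lookup f j) ≢ i + toℕ j))
  admissible⇔ i S f = mk⇔ (λ adm → available i S f adm , injective i S f adm , moved i S f adm)
                           (λ (avail , inj , move) → admissible i S f avail inj move)

card-full : ∀ m → card {m} (λ _ → true) ≡ m
card-full zero    = refl
card-full (suc m) = cong suc (card-full m)

card-< : ∀ {m d} → d ≤ m → card {m} (λ c → toℕ c <ᵇ d) ≡ d
card-< {m}     z≤n       = sum-replicate-zero m
card-< {suc m} (s≤s d≤m) = cong suc (card-< d≤m)

-- At the start all 2d values are available: all `d` points are restricted and the other `d` values
-- are forbidden to nobody.
a≡diagonal : ∀ d → a d ≡ diagonal d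
a≡diagonal d = begin
  a d
    ≡⟨ #functions-cong {d} {2 * d} injectiveWithoutFixedPoint? (admissible? 0 full) (λ f → mk⇔ (to f) (from′ f)) ⟩
  #functions (admissible? {2 * d} {d} 0 full)
    ≡⟨ #admissible d d≤2d d 0 full d 0 d refl (card-< d≤2d) (sum-replicate-zero (2 * d)) (trans (card-full (2 * d)) (lemma d)) ⟩
  diagonal d
    ∎
  where
  full : Fin (2 * d) → Bool
  full _ = true
  d≤2d : d ≤ 2 * d
  d≤2d = m≤m+n d _
  lemma : ∀ d → 2 * d ≡ d + 0 + d
  lemma = solve-∀
  to : ∀ f → InjectiveWithoutFixedPoint {d} f → Admissible 0 full f
  to f p = Equivalence.from (admissible⇔ 0 full f) ((λ _ → refl) , (λ j k → proj₁ p {j} {k}) , proj₂ p)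
  from′ : ∀ f → Admissible 0 full f → InjectiveWithoutFixedPoint {d} f
  from′ f adm with Equivalence.to (admissible⇔ 0 full f) adm
  ... | _ , inj , move = (λ {j} {k} → inj j k) , move

-- Colourings of complete multipartite graphs

-- Properness and weight are restated for a bare list of parts, so that parts can be removed by
-- recursion without any partition proofs. The agreement with `X` is definitional.
ProperFor : ∀ {k} (ps : List ℕ) → Vec (Fin k) (total ps) → Set
ProperFor ps κ = ∀ u v → partOf ps u ≢ partOf ps v → lookup κ u ≢ lookup κ v

occurrences : ∀ {k n} → Fin k → Vec (Fin k) n → ℕ
occurrences i κ = count (Fin._≟ i) κ

content : ∀ {k n} → Vec (Fin k) n → Vec ℕ k
content κ = tabulate λ i → occurrences i κ

Colouring : ∀ {k} (ps : List ℕ) → Vec ℕ k → Vec (Fin k) (total ps) → Set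
Colouring ps α κ = ProperFor ps κ × content κ ≡ α

colouring? : ∀ {k} ps (α : Vec ℕ k) → U.Decidable (Colouring ps α)
colouring? ps α κ =
  (Fin.all? λ u → Fin.all? λ v →
    ¬? (partOf ps u Fin.≟ partOf ps v) →-dec ¬? (lookup κ u Fin.≟ lookup κ v))
  ×-dec Vec.≡-dec ℕ._≟_ (content κ) α

colourings : ∀ {k} → List ℕ → Vec ℕ k → ℕ
colourings ps α = #functions (colouring? ps α)

X≡colourings : ∀ μ k (α : Vec ℕ k) → X (K μ) k α ≡ fromℕ (colourings (parts μ) α)
X≡colourings μ k α = refl

lookup-ext : ∀ {A : Set} {n} {xs ys : Vec A n} → (∀ i → lookup xs i ≡ lookup ys i) → xs ≡ ys
lookup-ext {xs = xs} {ys} eq =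
  trans (sym (Vec.tabulate∘lookup xs)) (trans (Vec.tabulate-cong eq) (Vec.tabulate∘lookup ys))

occurrences-++ : ∀ {k m n} i (κ : Vec (Fin k) m) (κ′ : Vec (Fin k) n) →
  occurrences i (κ ++ κ′) ≡ occurrences i κ + occurrences i κ′
occurrences-++ i []      κ′ = refl
occurrences-++ i (c ∷ κ) κ′ with does (c Fin.≟ i)
... | true  = cong suc (occurrences-++ i κ κ′)
... | false = occurrences-++ i κ κ′

occurs : ∀ {k n} (κ : Vec (Fin k) n) u → 0 < occurrences (lookup κ u) κ
occurs (c ∷ κ) zero rewrite dec-true (c Fin.≟ c) refl = z<s
occurs (c ∷ κ) (suc u) with does (c Fin.≟ lookup κ u)
... | true  = z<s
... | false = occurs κ u

occurrence : ∀ {k n} i (κ : Vec (Fin k) n) → 0 < occurrences i κ → ∃[ u ] lookup κ u ≡ i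
occurrence i (c ∷ κ) pos with c Fin.≟ i
... | yes c≡i = zero , c≡i
... | no  _   = let u , eq = occurrence i κ pos in suc u , eq

-- The first part contains no edge and each of its vertices is adjacent to every vertex outside, so
-- beyond properness of the rest only disjointness of the colour sets is required.
properFor-++ : ∀ {k} p ps (κ : Vec (Fin k) p) (κ′ : Vec (Fin k) (total ps)) →
  ProperFor (p ∷ ps) (κ ++ κ′) ⇔
  (ProperFor ps κ′ × (∀ i → 0 < occurrences i κ → occurrences i κ′ ≡ 0))
properFor-++ p ps κ κ′ = mk⇔ (λ proper → rest proper , disjoint proper) (λ (proper , disj) → combined proper disj)
  where
  rest : ProperFor (p ∷ ps) (κ ++ κ′) → ProperFor ps κ′
  rest proper u v u≁v eq = proper (p ↑ʳ u) (p ↑ʳ v)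
    (λ pu≡pv → u≁v (Fin.suc-injective (subst₂ _≡_ (part u) (part v) pu≡pv)))
    (trans (Vec.lookup-++ʳ κ κ′ u) (trans eq (sym (Vec.lookup-++ʳ κ κ′ v))))
    where
    part : ∀ u → partOf (p ∷ ps) (p ↑ʳ u) ≡ suc (partOf ps u)
    part u rewrite Fin.splitAt-↑ʳ p (total ps) u = refl
  disjoint : ProperFor (p ∷ ps) (κ ++ κ′) → ∀ i → 0 < occurrences i κ → occurrences i κ′ ≡ 0
  disjoint proper i pos with occurrences i κ′ in eq
  ... | zero  = refl
  ... | suc _ with occurrence i κ pos | occurrence i κ′ (subst (0 <_) (sym eq) z<s)
  ...   | u , u≡i | v , v≡i = contradiction
    (trans (Vec.lookup-++ˡ κ κ′ u) (trans u≡i (trans (sym v≡i) (sym (Vec.lookup-++ʳ κ κ′ v)))))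
    (proper (u ↑ˡ total ps) (p ↑ʳ v) differ)
    where
    differ : partOf (p ∷ ps) (u ↑ˡ total ps) ≢ partOf (p ∷ ps) (p ↑ʳ v)
    differ rewrite Fin.splitAt-↑ˡ p u (total ps) | Fin.splitAt-↑ʳ p (total ps) v = λ ()
  combined : ProperFor ps κ′ → (∀ i → 0 < occurrences i κ → occurrences i κ′ ≡ 0) → ProperFor (p ∷ ps) (κ ++ κ′)
  combined proper disj u v
    rewrite Vec.lookup-splitAt p κ κ′ u | Vec.lookup-splitAt p κ κ′ v
    with splitAt p u | splitAt p v
  ... | inj₁ u′ | inj₁ v′ = λ u≁v → contradiction refl u≁v
  ... | inj₁ u′ | inj₂ v′ = λ _ → apart u′ v′
    where
    apart : ∀ u′ v′ → lookup κ u′ ≢ lookup κ′ v′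
    apart u′ v′ eq = <⇒≢ (occurs κ′ v′) (sym (disj _ (subst (λ c → 0 < occurrences c κ) eq (occurs κ u′))))
  ... | inj₂ u′ | inj₁ v′ = λ _ eq → <⇒≢ (occurs κ′ u′) (sym (disj _ (subst (λ c → 0 < occurrences c κ) (sym eq) (occurs κ v′))))
  ... | inj₂ u′ | inj₂ v′ = λ u≁v → proper u′ v′ (u≁v ∘ cong suc)

colouring-++ : ∀ {k} p ps α (κ : Vec (Fin k) p) (κ′ : Vec (Fin k) (total ps)) →
  Colouring (p ∷ ps) α (κ ++ κ′) ⇔
  (ProperFor ps κ′ × (∀ i → occurrences i κ + lookup (content κ′) i ≡ lookup α i) ×
   (∀ i → 0 < occurrences i κ → lookup (content κ′) i ≡ 0))
colouring-++ p ps α κ κ′ = mk⇔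
  (λ (proper , content≡) → let proper′ , disj = Equivalence.to (properFor-++ p ps κ κ′) proper in
    proper′ ,
    (λ i → trans (sym (content-++ i)) (cong (λ β → lookup β i) content≡)) ,
    (λ i pos → trans (content-lookup i) (disj i pos)))
  (λ (proper′ , sums , disj) →
    Equivalence.from (properFor-++ p ps κ κ′) (proper′ , λ i pos → trans (sym (content-lookup i)) (disj i pos)) ,
    lookup-ext (λ i → trans (content-++ i) (sums i)))
  where
  content-lookup : ∀ i → lookup (content κ′) i ≡ occurrences i κ′
  content-lookup i = Vec.lookup∘tabulate (λ i → occurrences i κ′) i
  content-++ : ∀ i → lookup (content (κ ++ κ′)) i ≡ occurrences i κ + lookup (content κ′) i
  content-++ i = trans (Vec.lookup∘tabulate (λ i → occurrences i (κ ++ κ′)) i)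
    (trans (occurrences-++ i κ κ′) (cong (occurrences i κ +_) (sym (content-lookup i))))

-- The colour classes of one part, as pairs of a colour and its multiplicity

module _ {k : ℕ} where

  Shape : Set
  Shape = List (Fin k × ℕ)

  multiplicity : Fin k → Shape → ℕ
  multiplicity i []             = 0
  multiplicity i ((c , j) ∷ cs) = (if does (c Fin.≟ i) then j else 0) + multiplicity i cs

  Distinct : Shape → Set
  Distinct []             = ⊤
  Distinct ((c , j) ∷ cs) = 0 < j × multiplicity c cs ≡ 0 × Distinct cs

  -- A colour occurs in one part only, so its class there must exhaust its exponent. Resetting that
  -- exponent to 0 bars the colour from every later class.
  Fits : Shape → Vec ℕ k → Set
  Fits []             α = ⊤
  Fits ((c , j) ∷ cs) α = lookup α c ≡ j × Fits cs (α [ c ]≔ 0)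

  fits? : ∀ cs α → Dec (Fits cs α)
  fits? []             α = yes tt
  fits? ((c , j) ∷ cs) α = lookup α c ℕ.≟ j ×-dec fits? cs (α [ c ]≔ 0)

  strip : Shape → Vec ℕ k → Vec ℕ k
  strip []             α = α
  strip ((c , _) ∷ cs) α = strip cs (α [ c ]≔ 0)

  peel : Shape → (Vec ℕ k → ℕ) → Vec ℕ k → ℕ
  peel []             G α = G α
  peel ((c , j) ∷ cs) G α = if does (lookup α c ℕ.≟ j) then peel cs G (α [ c ]≔ 0) else 0

  peel-fits : ∀ cs G α → Fits cs α → peel cs G α ≡ G (strip cs α)
  peel-fits []             G α _            = refl
  peel-fits ((c , j) ∷ cs) G α (eq , fits) rewrite dec-true (lookup α c ℕ.≟ j) eq = peel-fits cs G _ fits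

  peel-¬fits : ∀ cs G α → ¬ Fits cs α → peel cs G α ≡ 0
  peel-¬fits []             G α ¬fits = contradiction tt ¬fits
  peel-¬fits ((c , j) ∷ cs) G α ¬fits with lookup α c ℕ.≟ j
  ... | yes eq rewrite dec-true (lookup α c ℕ.≟ j) eq = peel-¬fits cs G _ (λ fits → ¬fits (eq , fits))
  ... | no neq rewrite dec-false (lookup α c ℕ.≟ j) neq = refl

  strip-zero : ∀ cs (α : Vec ℕ k) i → lookup α i ≡ 0 → lookup (strip cs α) i ≡ 0
  strip-zero []             α i eq = eq
  strip-zero ((c , _) ∷ cs) α i eq = strip-zero cs (α [ c ]≔ 0) i zeroed
    where
    zeroed : lookup (α [ c ]≔ 0) i ≡ 0
    zeroed with i Fin.≟ c
    ... | yes refl = Vec.lookup∘update c α 0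
    ... | no  i≢c  = trans (Vec.lookup∘update′ i≢c α 0) eq

  fits-strip : ∀ cs α → Fits cs α → ∀ i →
    multiplicity i cs + lookup (strip cs α) i ≡ lookup α i ×
    (0 < multiplicity i cs → lookup (strip cs α) i ≡ 0)
  fits-strip []             α _           i = refl , λ ()
  fits-strip ((c , j) ∷ cs) α (eq , fits) i with c Fin.≟ i | fits-strip cs (α [ c ]≔ 0) fits i
  ... | yes refl | eq′ , _ =
    trans (+-assoc j (multiplicity c cs) _) (trans (cong (j +_) (trans eq′ (Vec.lookup∘update c α 0))) (trans (+-identityʳ j) (sym eq))) ,
    λ _ → strip-zero cs (α [ c ]≔ 0) c (Vec.lookup∘update c α 0)
  ... | no c≢i   | eq′ , z = trans eq′ (Vec.lookup∘update′ (c≢i ∘ sym) α 0) , z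

  -- Converse of `fits-strip`: the content `ω` of the remaining parts is forced. Positivity of `j`
  -- makes `ω` vanish at `c`, and then the exponent of `c` can only be `j`.
  strip-unique : ∀ cs α ω → Distinct cs →
    (∀ i → multiplicity i cs + lookup ω i ≡ lookup α i) →
    (∀ i → 0 < multiplicity i cs → lookup ω i ≡ 0) →
    Fits cs α × strip cs α ≡ ω
  strip-unique []             α ω _                sums zeros = tt , sym (lookup-ext sums)
  strip-unique ((c , j) ∷ cs) α ω (j>0 , c∉cs , d) sums zeros =
    let fits , stripped = strip-unique cs (α [ c ]≔ 0) ω d sums′ zeros′ in (αc≡j , fits) , stripped
    where
    at-c : multiplicity c ((c , j) ∷ cs) ≡ j
    at-c rewrite dec-true (c Fin.≟ c) refl | c∉cs = +-identityʳ j
    ωc≡0 : lookup ω c ≡ 0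
    ωc≡0 = zeros c (subst (0 <_) (sym at-c) j>0)
    αc≡j : lookup α c ≡ j
    αc≡j = trans (sym (sums c)) (trans (cong₂ _+_ at-c ωc≡0) (+-identityʳ j))
    sums′ : ∀ i → multiplicity i cs + lookup ω i ≡ lookup (α [ c ]≔ 0) i
    sums′ i with c Fin.≟ i | sums i
    ... | yes refl | _  = trans (cong₂ _+_ c∉cs ωc≡0) (sym (Vec.lookup∘update c α 0))
    ... | no c≢i   | eq = trans eq (sym (Vec.lookup∘update′ (c≢i ∘ sym) α 0))
    zeros′ : ∀ i → 0 < multiplicity i cs → lookup ω i ≡ 0
    zeros′ i pos = zeros i (<-≤-trans pos (m≤n+m _ _))

  -- The number of extensions of a colouring of the first part depends only on its colour classes;
  -- this is what reduces colourings to sums of `peel`.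
  colourings-prefix : ∀ p ps (κ : Vec (Fin k) p) cs α → Distinct cs →
    (∀ i → occurrences i κ ≡ multiplicity i cs) →
    #functions (λ κ′ → colouring? (p ∷ ps) α (κ ++ κ′)) ≡ peel cs (colourings ps) α
  colourings-prefix p ps κ cs α distinct shape with fits? cs α
  ... | yes fits = trans
    (#functions-cong (λ κ′ → colouring? (p ∷ ps) α (κ ++ κ′)) (colouring? ps (strip cs α)) λ κ′ → mk⇔ (to κ′) (from′ κ′))
    (sym (peel-fits cs (colourings ps) α fits))
    where
    to : ∀ κ′ → Colouring (p ∷ ps) α (κ ++ κ′) → Colouring ps (strip cs α) κ′
    to κ′ good with Equivalence.to (colouring-++ p ps α κ κ′) good
    ... | proper , sums , zeros = proper , sym (proj₂ (strip-unique cs α (content κ′) distinct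
      (λ i → trans (cong (_+ _) (sym (shape i))) (sums i)) (λ i pos → zeros i (subst (0 <_) (sym (shape i)) pos))))
    from′ : ∀ κ′ → Colouring ps (strip cs α) κ′ → Colouring (p ∷ ps) α (κ ++ κ′)
    from′ κ′ (proper , content≡) = Equivalence.from (colouring-++ p ps α κ κ′) (proper ,
      (λ i → trans (cong₂ _+_ (shape i) (cong (λ β → lookup β i) content≡)) (proj₁ (fits-strip cs α fits i))) ,
      (λ i pos → trans (cong (λ β → lookup β i) content≡) (proj₂ (fits-strip cs α fits i) (subst (0 <_) (shape i) pos))))
  ... | no ¬fits = trans
    (#functions-none (λ κ′ → colouring? (p ∷ ps) α (κ ++ κ′)) λ κ′ good → ¬fits (fits κ′ (Equivalence.to (colouring-++ p ps α κ κ′) good)))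
    (sym (peel-¬fits cs (colourings ps) α ¬fits))
    where
    fits : ∀ κ′ → ProperFor ps κ′ × (∀ i → occurrences i κ + lookup (content κ′) i ≡ lookup α i) ×
      (∀ i → 0 < occurrences i κ → lookup (content κ′) i ≡ 0) → Fits cs α
    fits κ′ (proper , sums , zeros) = proj₁ (strip-unique cs α (content κ′) distinct
      (λ i → trans (cong (_+ _) (sym (shape i))) (sums i)) (λ i pos → zeros i (subst (0 <_) (sym (shape i)) pos)))

-- Recursions that remove a part of two or three vertices

sum-single : ∀ {n} (c : Fin n) (f : Fin n → ℕ) → sum (λ x → if does (x Fin.≟ c) then f x else 0) ≡ f c
sum-single {n} c f = begin
  sum (λ x → if does (x Fin.≟ c) then f x else 0)
    ≡⟨ sum-extract c _ ⟩
  (if does (c Fin.≟ c) then f c else 0) +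
    sum (λ x → if does (x Fin.≟ c) then 0 else (if does (x Fin.≟ c) then f x else 0))
    ≡⟨ cong₂ _+_ (cong (λ b → if b then f c else 0) (dec-true (c Fin.≟ c) refl))
         (trans (sum-cong-≗ vanish) (sum-replicate-zero n)) ⟩
  f c + 0
    ≡⟨ +-identityʳ (f c) ⟩
  f c
    ∎
  where
  vanish : ∀ x → (if does (x Fin.≟ c) then 0 else (if does (x Fin.≟ c) then f x else 0)) ≡ 0
  vanish x with does (x Fin.≟ c)
  ... | true  = refl
  ... | false = refl

sum-if : ∀ {n} b (f : Fin n → ℕ) → sum (λ x → if b then f x else 0) ≡ (if b then sum f else 0)
sum-if {n} true  f = refl
sum-if {n} false f = sum-replicate-zero n

module _ {k : ℕ} where

  extract : ℕ → (Vec ℕ k → ℕ) → Vec ℕ k → ℕ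
  extract j G α = sum λ c → peel ((c , j) ∷ []) G α

  -- Once `c` has been reset to 0 it cannot carry a positive class. Hence sums over distinct colours
  -- may run over all tuples of colours, the repeated ones contributing nothing.
  peel-repeated : ∀ (c : Fin k) i j cs G α → peel ((c , i) ∷ (c , suc j) ∷ cs) G α ≡ 0
  peel-repeated c i j cs G α = peel-¬fits ((c , i) ∷ (c , suc j) ∷ cs) G α λ (_ , eq , _) →
    contradiction (trans (sym (Vec.lookup∘update c α 0)) eq) λ ()

  peel-repeated′ : ∀ (c d : Fin k) h i j G α → peel ((c , h) ∷ (d , i) ∷ (c , suc j) ∷ []) G α ≡ 0
  peel-repeated′ c d h i j G α = peel-¬fits ((c , h) ∷ (d , i) ∷ (c , suc j) ∷ []) G α λ (_ , _ , eq , _) →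
    contradiction (trans (sym (strip-zero ((d , i) ∷ []) (α [ c ]≔ 0) c (Vec.lookup∘update c α 0))) eq) λ ()

  peel-repeated″ : ∀ (b c : Fin k) h i j G α → peel ((b , h) ∷ (c , i) ∷ (c , suc j) ∷ []) G α ≡ 0
  peel-repeated″ b c h i j G α = peel-¬fits ((b , h) ∷ (c , i) ∷ (c , suc j) ∷ []) G α λ (_ , _ , eq , _) →
    contradiction (trans (sym (Vec.lookup∘update c (α [ b ]≔ 0) 0)) eq) λ ()

  extract-extract : ∀ i j G α →
    sum (λ c → sum λ d → peel ((c , i) ∷ (d , j) ∷ []) G α) ≡ extract i (extract j G) α
  extract-extract i j G α = sum-cong-≗ λ c →
    sum-if (does (lookup α c ℕ.≟ i)) (λ d → peel ((d , j) ∷ []) G (α [ c ]≔ 0))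

  extract-extract-extract : ∀ h i j G α →
    sum (λ b → sum λ c → sum λ d → peel ((b , h) ∷ (c , i) ∷ (d , j) ∷ []) G α) ≡
    extract h (extract i (extract j G)) α
  extract-extract-extract h i j G α = sum-cong-≗ λ b → begin
    sum (λ c → sum λ d → peel ((b , h) ∷ (c , i) ∷ (d , j) ∷ []) G α)
      ≡⟨ sum-cong-≗ (λ c → sum-if (does (lookup α b ℕ.≟ h)) (λ d → peel ((c , i) ∷ (d , j) ∷ []) G (α [ b ]≔ 0))) ⟩
    sum (λ c → if does (lookup α b ℕ.≟ h) then sum (λ d → peel ((c , i) ∷ (d , j) ∷ []) G (α [ b ]≔ 0)) else 0)
      ≡⟨ sum-if (does (lookup α b ℕ.≟ h)) (λ c → sum λ d → peel ((c , i) ∷ (d , j) ∷ []) G (α [ b ]≔ 0)) ⟩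
    (if does (lookup α b ℕ.≟ h) then sum (λ c → sum λ d → peel ((c , i) ∷ (d , j) ∷ []) G (α [ b ]≔ 0)) else 0)
      ≡⟨ cong (λ x → if does (lookup α b ℕ.≟ h) then x else 0) (extract-extract i j G (α [ b ]≔ 0)) ⟩
    peel ((b , h) ∷ []) (extract i (extract j G)) α
      ∎

  occurrences-distinct : ∀ {n} (κ : Vec (Fin k) n) i →
    occurrences i κ ≡ multiplicity i (List.map (_, 1) (Vec.toList κ))
  occurrences-distinct []      i = refl
  occurrences-distinct (c ∷ κ) i with does (c Fin.≟ i)
  ... | true  = cong suc (occurrences-distinct κ i)
  ... | false = occurrences-distinct κ i

  module _ (ps : List ℕ) (α : Vec ℕ k) where

    private
      G = colourings {k} ps

      single : ∀ (c : Fin k) j → Distinct ((c , suc j) ∷ [])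
      single c j = z<s , refl , tt

      pair : ∀ {c d : Fin k} i j → d ≢ c → Distinct ((c , suc i) ∷ (d , suc j) ∷ [])
      pair {c} {d} i j d≢c = z<s , cong (λ b → (if b then suc j else 0) + 0) (dec-false (d Fin.≟ c) d≢c) , single d j

      triple : ∀ {b c d : Fin k} → c ≢ b → d ≢ b → d ≢ c → Distinct ((b , 1) ∷ (c , 1) ∷ (d , 1) ∷ [])
      triple {b} {c} {d} c≢b d≢b d≢c = z<s ,
        cong₂ (λ x y → (if x then 1 else 0) + ((if y then 1 else 0) + 0)) (dec-false (c Fin.≟ b) c≢b) (dec-false (d Fin.≟ b) d≢b) ,
        pair 0 0 d≢c

    -- The two vertices form one class or two singleton classes. They are labelled, so the ordered
    -- pair of colours is counted without division.
    colourings-2 : colourings (2 ∷ ps) α ≡ extract 2 G α + extract 1 (extract 1 G) α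
    colourings-2 = begin
      colourings (2 ∷ ps) α
        ≡⟨ #functions-suc (colouring? (2 ∷ ps) α) ⟩
      sum (λ c → #functions (λ κ → colouring? (2 ∷ ps) α (c ∷ κ)))
        ≡⟨ sum-cong-≗ (λ c → #functions-suc (λ κ → colouring? (2 ∷ ps) α (c ∷ κ))) ⟩
      sum (λ c → sum λ d → #functions (λ κ → colouring? (2 ∷ ps) α (c ∷ d ∷ κ)))
        ≡⟨ sum-cong-≗ (λ c → sum-cong-≗ (term c)) ⟩
      sum (λ c → sum λ d → (if does (d Fin.≟ c) then peel ((c , 2) ∷ []) G α else 0) + peel ((c , 1) ∷ (d , 1) ∷ []) G α)
        ≡⟨ sum-cong-≗ (λ c → trans
             (∑-distrib-+ (λ d → if does (d Fin.≟ c) then peel ((c , 2) ∷ []) G α else 0) (λ d → peel ((c , 1) ∷ (d , 1) ∷ []) G α))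
             (cong (_+ sum (λ d → peel ((c , 1) ∷ (d , 1) ∷ []) G α)) (sum-single c (λ _ → peel ((c , 2) ∷ []) G α)))) ⟩
      sum (λ c → peel ((c , 2) ∷ []) G α + sum (λ d → peel ((c , 1) ∷ (d , 1) ∷ []) G α))
        ≡⟨ ∑-distrib-+ (λ c → peel ((c , 2) ∷ []) G α) (λ c → sum λ d → peel ((c , 1) ∷ (d , 1) ∷ []) G α) ⟩
      extract 2 G α + sum (λ c → sum (λ d → peel ((c , 1) ∷ (d , 1) ∷ []) G α))
        ≡⟨ cong (extract 2 G α +_) (extract-extract 1 1 G α) ⟩
      extract 2 G α + extract 1 (extract 1 G) α
        ∎
      where
      term : ∀ c d → #functions (λ κ → colouring? (2 ∷ ps) α (c ∷ d ∷ κ)) ≡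
        (if does (d Fin.≟ c) then peel ((c , 2) ∷ []) G α else 0) + peel ((c , 1) ∷ (d , 1) ∷ []) G α
      term c d = pick (d Fin.≟ c)
        where
        shape : ∀ i → occurrences i (c ∷ c ∷ []) ≡ multiplicity i ((c , 2) ∷ [])
        shape i with does (c Fin.≟ i)
        ... | true  = refl
        ... | false = refl
        pick : (d≟c : Dec (d ≡ c)) → #functions (λ κ → colouring? (2 ∷ ps) α (c ∷ d ∷ κ)) ≡
          (if does d≟c then peel ((c , 2) ∷ []) G α else 0) + peel ((c , 1) ∷ (d , 1) ∷ []) G α
        pick (yes refl) = trans (colourings-prefix 2 ps (c ∷ c ∷ []) ((c , 2) ∷ []) α (single c 1) shape)
          (sym (trans (cong (peel ((c , 2) ∷ []) G α +_) (peel-repeated c 1 0 [] G α)) (+-identityʳ _)))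
        pick (no d≢c)   = colourings-prefix 2 ps (c ∷ d ∷ []) ((c , 1) ∷ (d , 1) ∷ []) α (pair 0 0 d≢c) (occurrences-distinct (c ∷ d ∷ []))

    -- The summands are the five set partitions of three vertices. The type 2 + 1 occurs three
    -- times; it appears as `extract 1 (extract 2 G)` when the first vertex is the singleton.
    colourings-3 : colourings (3 ∷ ps) α ≡
      extract 3 G α + extract 2 (extract 1 G) α + extract 2 (extract 1 G) α + extract 1 (extract 2 G) α +
      extract 1 (extract 1 (extract 1 G)) α
    colourings-3 = begin
      colourings (3 ∷ ps) α
        ≡⟨ #functions-suc (colouring? (3 ∷ ps) α) ⟩
      sum (λ b → #functions (λ κ → colouring? (3 ∷ ps) α (b ∷ κ)))
        ≡⟨ sum-cong-≗ (λ b → trans (#functions-suc (λ κ → colouring? (3 ∷ ps) α (b ∷ κ)))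
             (sum-cong-≗ λ c → #functions-suc (λ κ → colouring? (3 ∷ ps) α (b ∷ c ∷ κ)))) ⟩
      ∑³ (λ b c d → #functions (λ κ → colouring? (3 ∷ ps) α (b ∷ c ∷ d ∷ κ)))
        ≡⟨ ∑³-cong term ⟩
      ∑³ (λ b c d → bbb b c d + bbd b c d + bcb b c d + bcc b c d + bcd b c d)
        ≡⟨ ∑³-+ (λ b c d → bbb b c d + bbd b c d + bcb b c d + bcc b c d) bcd ⟩
      ∑³ (λ b c d → bbb b c d + bbd b c d + bcb b c d + bcc b c d) + ∑³ bcd
        ≡⟨ cong (_+ ∑³ bcd) (∑³-+ (λ b c d → bbb b c d + bbd b c d + bcb b c d) bcc) ⟩
      ∑³ (λ b c d → bbb b c d + bbd b c d + bcb b c d) + ∑³ bcc + ∑³ bcd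
        ≡⟨ cong (λ x → x + ∑³ bcc + ∑³ bcd) (∑³-+ (λ b c d → bbb b c d + bbd b c d) bcb) ⟩
      ∑³ (λ b c d → bbb b c d + bbd b c d) + ∑³ bcb + ∑³ bcc + ∑³ bcd
        ≡⟨ cong (λ x → x + ∑³ bcb + ∑³ bcc + ∑³ bcd) (∑³-+ bbb bbd) ⟩
      ∑³ bbb + ∑³ bbd + ∑³ bcb + ∑³ bcc + ∑³ bcd
        ≡⟨ cong₂ _+_ (cong₂ _+_ (cong₂ _+_ (cong₂ _+_ ∑bbb ∑bbd) ∑bcb) ∑bcc) (extract-extract-extract 1 1 1 G α) ⟩
      extract 3 G α + extract 2 (extract 1 G) α + extract 2 (extract 1 G) α + extract 1 (extract 2 G) α +
      extract 1 (extract 1 (extract 1 G)) α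
        ∎
      where
      ∑³ : (Fin k → Fin k → Fin k → ℕ) → ℕ
      ∑³ f = sum λ b → sum λ c → sum λ d → f b c d
      ∑³-cong : ∀ {f g} → (∀ b c d → f b c d ≡ g b c d) → ∑³ f ≡ ∑³ g
      ∑³-cong eq = sum-cong-≗ λ b → sum-cong-≗ λ c → sum-cong-≗ λ d → eq b c d
      ∑³-+ : ∀ f g → ∑³ (λ b c d → f b c d + g b c d) ≡ ∑³ f + ∑³ g
      ∑³-+ f g = trans
        (sum-cong-≗ λ b → trans (sum-cong-≗ λ c → ∑-distrib-+ (f b c) (g b c)) (∑-distrib-+ (λ c → sum (f b c)) (λ c → sum (g b c))))
        (∑-distrib-+ (λ b → sum λ c → sum (f b c)) (λ b → sum λ c → sum (g b c)))

      -- The names spell the colours of the three vertices, equal letters for equal colours. Each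
      -- term is extended by 0, or by a vanishing `peel`, to all triples.
      bbb bbd bcb bcc bcd : Fin k → Fin k → Fin k → ℕ
      bbb b c d = if does (c Fin.≟ b) then (if does (d Fin.≟ b) then peel ((b , 3) ∷ []) G α else 0) else 0
      bbd b c d = if does (c Fin.≟ b) then peel ((b , 2) ∷ (d , 1) ∷ []) G α else 0
      bcb b c d = if does (d Fin.≟ b) then peel ((b , 2) ∷ (c , 1) ∷ []) G α else 0
      bcc b c d = if does (d Fin.≟ c) then peel ((b , 1) ∷ (c , 2) ∷ []) G α else 0
      bcd b c d = peel ((b , 1) ∷ (c , 1) ∷ (d , 1) ∷ []) G α

      ∑bbb : ∑³ bbb ≡ extract 3 G α
      ∑bbb = sum-cong-≗ λ b → trans
        (sum-cong-≗ λ c → trans (sum-if (does (c Fin.≟ b)) (λ d → if does (d Fin.≟ b) then peel ((b , 3) ∷ []) G α else 0))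
          (cong (λ x → if does (c Fin.≟ b) then x else 0) (sum-single b (λ _ → peel ((b , 3) ∷ []) G α))))
        (sum-single b (λ _ → peel ((b , 3) ∷ []) G α))
      ∑bbd : ∑³ bbd ≡ extract 2 (extract 1 G) α
      ∑bbd = trans
        (sum-cong-≗ λ b → trans
          (sum-cong-≗ λ c → sum-if (does (c Fin.≟ b)) (λ d → peel ((b , 2) ∷ (d , 1) ∷ []) G α))
          (sum-single b (λ _ → sum λ d → peel ((b , 2) ∷ (d , 1) ∷ []) G α)))
        (extract-extract 2 1 G α)
      ∑bcb : ∑³ bcb ≡ extract 2 (extract 1 G) α
      ∑bcb = trans
        (sum-cong-≗ λ b → sum-cong-≗ λ c → sum-single b (λ _ → peel ((b , 2) ∷ (c , 1) ∷ []) G α))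
        (extract-extract 2 1 G α)
      ∑bcc : ∑³ bcc ≡ extract 1 (extract 2 G) α
      ∑bcc = trans
        (sum-cong-≗ λ b → sum-cong-≗ λ c → sum-single c (λ _ → peel ((b , 1) ∷ (c , 2) ∷ []) G α))
        (extract-extract 1 2 G α)

      shape³ : ∀ b i → occurrences i (b ∷ b ∷ b ∷ []) ≡ multiplicity i ((b , 3) ∷ [])
      shape³ b i with does (b Fin.≟ i)
      ... | true  = refl
      ... | false = refl
      shape-bbd : ∀ b d i → occurrences i (b ∷ b ∷ d ∷ []) ≡ multiplicity i ((b , 2) ∷ (d , 1) ∷ [])
      shape-bbd b d i with does (b Fin.≟ i) | does (d Fin.≟ i)
      ... | true  | true  = refl
      ... | true  | false = refl
      ... | false | true  = refl
      ... | false | false = refl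
      shape-bcb : ∀ b c i → occurrences i (b ∷ c ∷ b ∷ []) ≡ multiplicity i ((b , 2) ∷ (c , 1) ∷ [])
      shape-bcb b c i with does (b Fin.≟ i) | does (c Fin.≟ i)
      ... | true  | true  = refl
      ... | true  | false = refl
      ... | false | true  = refl
      ... | false | false = refl
      shape-bcc : ∀ b c i → occurrences i (b ∷ c ∷ c ∷ []) ≡ multiplicity i ((b , 1) ∷ (c , 2) ∷ [])
      shape-bcc b c i with does (b Fin.≟ i) | does (c Fin.≟ i)
      ... | true  | true  = refl
      ... | true  | false = refl
      ... | false | true  = refl
      ... | false | false = refl

      term : ∀ b c d → #functions (λ κ → colouring? (3 ∷ ps) α (b ∷ c ∷ d ∷ κ)) ≡
        bbb b c d + bbd b c d + bcb b c d + bcc b c d + bcd b c d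
      term b c d = pick (c Fin.≟ b) (d Fin.≟ b) (d Fin.≟ c)
        where
        v+0s : ∀ v {w x y z} → w ≡ 0 → x ≡ 0 → y ≡ 0 → z ≡ 0 → v ≡ v + w + x + y + z
        v+0s v refl refl refl refl = lemma v
          where
          lemma : ∀ v → v ≡ v + 0 + 0 + 0 + 0
          lemma = solve-∀
        pick : (c≟b : Dec (c ≡ b)) (d≟b : Dec (d ≡ b)) (d≟c : Dec (d ≡ c)) →
          #functions (λ κ → colouring? (3 ∷ ps) α (b ∷ c ∷ d ∷ κ)) ≡
          (if does c≟b then (if does d≟b then peel ((b , 3) ∷ []) G α else 0) else 0) +
          (if does c≟b then peel ((b , 2) ∷ (d , 1) ∷ []) G α else 0) +
          (if does d≟b then peel ((b , 2) ∷ (c , 1) ∷ []) G α else 0) +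
          (if does d≟c then peel ((b , 1) ∷ (c , 2) ∷ []) G α else 0) +
          bcd b c d
        pick (yes refl) (yes refl) (no c≢c)   = contradiction refl c≢c
        pick (yes refl) (no d≢b)   (yes d≡b)  = contradiction d≡b d≢b
        pick (no c≢b)   (yes refl) (yes b≡c)  = contradiction (sym b≡c) c≢b
        pick (yes refl) (yes refl) (yes _)    = trans
          (colourings-prefix 3 ps (b ∷ b ∷ b ∷ []) ((b , 3) ∷ []) α (single b 2) (shape³ b))
          (v+0s (peel ((b , 3) ∷ []) G α) (peel-repeated b 2 0 [] G α) (peel-repeated b 2 0 [] G α) (peel-repeated b 1 1 [] G α)
            (peel-repeated b 1 0 ((b , 1) ∷ []) G α))
        pick (yes refl) (no d≢b)   (no _)     = trans
          (colourings-prefix 3 ps (b ∷ b ∷ d ∷ []) ((b , 2) ∷ (d , 1) ∷ []) α (pair 1 0 d≢b) (shape-bbd b d))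
          (sym (trans (cong (λ x → B + 0 + 0 + x) (peel-repeated b 1 0 ((d , 1) ∷ []) G α)) (lemma B)))
          where
          B = peel ((b , 2) ∷ (d , 1) ∷ []) G α
          lemma : ∀ v → v + 0 + 0 + 0 ≡ v
          lemma = solve-∀
        pick (no c≢b)   (yes refl) (no _)     = trans
          (colourings-prefix 3 ps (b ∷ c ∷ b ∷ []) ((b , 2) ∷ (c , 1) ∷ []) α (pair 1 0 c≢b) (shape-bcb b c))
          (sym (trans (cong (λ x → B + 0 + x) (peel-repeated′ b c 1 1 0 G α)) (lemma B)))
          where
          B = peel ((b , 2) ∷ (c , 1) ∷ []) G α
          lemma : ∀ v → v + 0 + 0 ≡ v
          lemma = solve-∀
        pick (no c≢b)   (no _)     (yes refl) = trans
          (colourings-prefix 3 ps (b ∷ c ∷ c ∷ []) ((b , 1) ∷ (c , 2) ∷ []) α (pair 0 1 c≢b) (shape-bcc b c))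
          (sym (trans (cong (peel ((b , 1) ∷ (c , 2) ∷ []) G α +_) (peel-repeated″ b c 1 1 0 G α)) (+-identityʳ _)))
        pick (no c≢b)   (no d≢b)   (no d≢c)   =
          colourings-prefix 3 ps (b ∷ c ∷ d ∷ []) ((b , 1) ∷ (c , 1) ∷ (d , 1) ∷ []) α (triple c≢b d≢b d≢c)
            (occurrences-distinct (b ∷ c ∷ d ∷ []))

-- Coefficients as functions of the numbers of exponents

module _ {k : ℕ} where

  occ : ℕ → Vec ℕ k → ℕ
  occ j α = count (ℕ._≟ j) α

  large : Vec ℕ k → ℕ
  large α = count (4 ℕ.≤?_) α

count-remove : ∀ {k} {P : ℕ → Set} (P? : U.Decidable P) → ¬ P 0 → ∀ (α : Vec ℕ k) c →
  count P? α ≡ (if does (P? (lookup α c)) then 1 else 0) + count P? (α [ c ]≔ 0)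
count-remove P? ¬P0 (x ∷ α) zero rewrite dec-false (P? 0) ¬P0 with does (P? x)
... | true  = refl
... | false = refl
count-remove P? ¬P0 (x ∷ α) (suc c) with does (P? x)
... | true  = trans (cong suc (count-remove P? ¬P0 α c)) (sym (+-suc _ _))
... | false = count-remove P? ¬P0 α c

sum-occ : ∀ {k} (α : Vec ℕ k) j v → sum (λ c → if does (lookup α c ℕ.≟ j) then v else 0) ≡ occ j α * v
sum-occ []      j v = refl
sum-occ (x ∷ α) j v with x ≡ᵇ j
... | true  = cong (v +_) (sum-occ α j v)
... | false = sum-occ α j v

-- A function of the numbers of exponents equal to 1, 2 and 3 and of the
-- number of exponents that are at least 4.

Statistic : Set
Statistic = ℕ → ℕ → ℕ → ℕ → ℕ

module _ {k : ℕ} where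

  record _IsStatistic_ (G : Vec ℕ k → ℕ) (φ : Statistic) : Set where
    constructor statistic
    field value : ∀ α → G α ≡ φ (occ 1 α) (occ 2 α) (occ 3 α) (large α)

  open _IsStatistic_ public

  extract-occ : ∀ j (G : Vec ℕ k → ℕ) α v → (∀ c → lookup α c ≡ j → G (α [ c ]≔ 0) ≡ v) →
    extract j G α ≡ occ j α * v
  extract-occ j G α v const = trans (sum-cong-≗ λ c → pick c (lookup α c ℕ.≟ j)) (sum-occ α j v)
    where
    pick : ∀ c (d : Dec (lookup α c ≡ j)) → (if does d then G (α [ c ]≔ 0) else 0) ≡ (if does d then v else 0)
    pick c (yes eq) = const c eq
    pick c (no _)   = refl

  private
    same : ∀ {P : ℕ → Set} (P? : U.Decidable P) (α : Vec ℕ k) c {j} → lookup α c ≡ j → ¬ P 0 → ¬ P j →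
      count P? (α [ c ]≔ 0) ≡ count P? α
    same P? α c refl ¬P0 ¬Pj = sym (trans (count-remove P? ¬P0 α c)
      (cong (λ b → (if b then 1 else 0) + count P? (α [ c ]≔ 0)) (dec-false (P? _) ¬Pj)))

    fewer : ∀ {P : ℕ → Set} (P? : U.Decidable P) (α : Vec ℕ k) c {j} → lookup α c ≡ j → ¬ P 0 → P j →
      count P? (α [ c ]≔ 0) ≡ pred (count P? α)
    fewer P? α c refl ¬P0 Pj = sym (cong pred (trans (count-remove P? ¬P0 α c)
      (cong (λ b → (if b then 1 else 0) + count P? (α [ c ]≔ 0)) (dec-true (P? _) Pj))))

    cong₄ : ∀ (φ : Statistic) {a a′ b b′ c c′ d d′} → a ≡ a′ → b ≡ b′ → c ≡ c′ → d ≡ d′ → φ a b c d ≡ φ a′ b′ c′ d′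
    cong₄ φ refl refl refl refl = refl

  -- Each of the `n₁` colours of exponent 1 contributes equally. For `n₁ = 0` the factor vanishes,
  -- so the value of `φ` at `pred 0` does not matter; the same holds for the exponents 2 and 3.
  extract₁ : ∀ {G φ} → G IsStatistic φ →
    extract 1 G IsStatistic λ n₁ n₂ n₃ n₄ → n₁ * φ (pred n₁) n₂ n₃ n₄
  extract₁ {G} {φ} (statistic stat) = statistic λ α → extract-occ 1 G α _ λ c eq → trans (stat (α [ c ]≔ 0))
    (cong₄ φ (fewer (ℕ._≟ 1) α c eq (λ ()) refl) (same (ℕ._≟ 2) α c eq (λ ()) (λ ())) (same (ℕ._≟ 3) α c eq (λ ()) (λ ()))
      (same (4 ℕ.≤?_) α c eq (λ ()) (λ { (s≤s ()) })))

  extract₂ : ∀ {G φ} → G IsStatistic φ →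
    extract 2 G IsStatistic λ n₁ n₂ n₃ n₄ → n₂ * φ n₁ (pred n₂) n₃ n₄
  extract₂ {G} {φ} (statistic stat) = statistic λ α → extract-occ 2 G α _ λ c eq → trans (stat (α [ c ]≔ 0))
    (cong₄ φ (same (ℕ._≟ 1) α c eq (λ ()) (λ ())) (fewer (ℕ._≟ 2) α c eq (λ ()) refl) (same (ℕ._≟ 3) α c eq (λ ()) (λ ()))
      (same (4 ℕ.≤?_) α c eq (λ ()) (λ { (s≤s (s≤s ())) })))

  extract₃ : ∀ {G φ} → G IsStatistic φ →
    extract 3 G IsStatistic λ n₁ n₂ n₃ n₄ → n₃ * φ n₁ n₂ (pred n₃) n₄
  extract₃ {G} {φ} (statistic stat) = statistic λ α → extract-occ 3 G α _ λ c eq → trans (stat (α [ c ]≔ 0))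
    (cong₄ φ (same (ℕ._≟ 1) α c eq (λ ()) (λ ())) (same (ℕ._≟ 2) α c eq (λ ()) (λ ())) (fewer (ℕ._≟ 3) α c eq (λ ()) refl)
      (same (4 ℕ.≤?_) α c eq (λ ()) (λ { (s≤s (s≤s (s≤s ()))) })))

-- The coefficients of the chromatic symmetric function for β parts of size 2, by the recursion of
-- `colourings-2`.
twos : ℕ → Statistic
twos zero    n₁ n₂ n₃ n₄ = if does (n₁ + n₂ + n₃ + n₄ ℕ.≟ 0) then 1 else 0
twos (suc β) n₁ n₂ n₃ n₄ = n₂ * twos β n₁ (pred n₂) n₃ n₄ + n₁ * (pred n₁ * twos β (pred (pred n₁)) n₂ n₃ n₄)

-- The five summands of `colourings-3` in the same order, over β parts of size 2.
three-twos : ℕ → Statistic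
three-twos β n₁ n₂ n₃ n₄ =
  n₃ * twos β n₁ n₂ (pred n₃) n₄ +
  n₂ * (n₁ * twos β (pred n₁) (pred n₂) n₃ n₄) +
  n₂ * (n₁ * twos β (pred n₁) (pred n₂) n₃ n₄) +
  n₁ * (n₂ * twos β (pred n₁) (pred n₂) n₃ n₄) +
  n₁ * (pred n₁ * (pred (pred n₁) * twos β (pred (pred (pred n₁))) n₂ n₃ n₄))

zero-statistic : ∀ {k} (α : Vec ℕ k) → content {k} [] ≡ α ⇔ occ 1 α + occ 2 α + occ 3 α + large α ≡ 0
zero-statistic {k} α = mk⇔ (λ { refl → to k }) (from α)
  where
  to : ∀ k → let α = content {k} [] in occ 1 α + occ 2 α + occ 3 α + large α ≡ 0
  to zero    = refl
  to (suc k) = to k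
  from : ∀ {k} (α : Vec ℕ k) → occ 1 α + occ 2 α + occ 3 α + large α ≡ 0 → content {k} [] ≡ α
  from []      _  = refl
  from (0 ∷ α) eq = cong (0 ∷_) (from α eq)
  from (2 ∷ α) eq rewrite +-suc (occ 1 α) (occ 2 α) = contradiction eq λ ()
  from (3 ∷ α) eq rewrite +-suc (occ 1 α + occ 2 α) (occ 3 α) = contradiction eq λ ()
  from (suc (suc (suc (suc _))) ∷ α) eq rewrite +-suc (occ 1 α + occ 2 α + occ 3 α) (large α) = contradiction eq λ ()

colourings-twos : ∀ {k} β → colourings {k} (replicate β 2) IsStatistic twos β
colourings-twos {k} zero = statistic λ α →
  trans (base α (Vec.≡-dec ℕ._≟_ (content {k} []) α))
        (cong (λ b → if b then 1 else 0)
          (does-⇔ (zero-statistic α) (Vec.≡-dec ℕ._≟_ (content {k} []) α) (occ 1 α + occ 2 α + occ 3 α + large α ℕ.≟ 0)))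
  where
  base : ∀ α (d : Dec (content {k} [] ≡ α)) → colourings [] α ≡ (if does d then 1 else 0)
  base α (yes eq) = cong List.length (List.filter-all (colouring? [] α) (((λ ()) , eq) ∷ []))
  base α (no neq) = #functions-none (colouring? [] α) λ { [] (_ , eq) → neq eq }
colourings-twos (suc β) = statistic λ α → trans (colourings-2 (replicate β 2) α)
  (cong₂ _+_ (value (extract₂ G) α) (value (extract₁ (extract₁ G)) α))
  where
  G = colourings-twos β

colourings-three-twos : ∀ {k} β → colourings {k} (3 ∷ replicate β 2) IsStatistic three-twos β
colourings-three-twos β = statistic λ α → trans (colourings-3 (replicate β 2) α)
  (cong₂ _+_ (cong₂ _+_ (cong₂ _+_ (cong₂ _+_
    (value (extract₃ G) α) (value (extract₂ (extract₁ G)) α)) (value (extract₂ (extract₁ G)) α))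
    (value (extract₁ (extract₂ G)) α)) (value (extract₁ (extract₁ (extract₁ G))) α))
  where
  G = colourings-twos β

-- Closed forms of the chromatic coefficients

-- Parts of size 2 never consume an exponent above 2, while the base case requires all exponents to
-- be gone.
twos-large : ∀ β n₁ n₂ n₃ n₄ → 0 < n₃ + n₄ → twos β n₁ n₂ n₃ n₄ ≡ 0
twos-large zero    n₁ n₂ n₃ n₄ pos =
  cong (λ b → if b then 1 else 0) (dec-false (n₁ + n₂ + n₃ + n₄ ℕ.≟ 0) λ eq →
    <⇒≢ pos (sym (m+n≡0⇒n≡0 (n₁ + n₂) (trans (sym (+-assoc (n₁ + n₂) n₃ n₄)) eq))))
twos-large (suc β) n₁ n₂ n₃ n₄ pos
  rewrite twos-large β n₁ (pred n₂) n₃ n₄ pos | twos-large β (pred (pred n₁)) n₂ n₃ n₄ pos | *-zeroʳ n₂ | *-zeroʳ (pred n₁) = *-zeroʳ n₁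

twos-degree : ∀ β n₁ n₂ n₃ n₄ → n₁ + 2 * n₂ ≢ 2 * β → twos β n₁ n₂ n₃ n₄ ≡ 0
twos-degree zero n₁ n₂ n₃ n₄ deg =
  cong (λ b → if b then 1 else 0) (dec-false (n₁ + n₂ + n₃ + n₄ ℕ.≟ 0) λ eq →
    let n₁+n₂≡0 = m+n≡0⇒m≡0 (n₁ + n₂) (m+n≡0⇒m≡0 (n₁ + n₂ + n₃) eq) in
    deg (cong₂ (λ x y → x + 2 * y) (m+n≡0⇒m≡0 n₁ n₁+n₂≡0) (m+n≡0⇒n≡0 n₁ n₁+n₂≡0)))
twos-degree (suc β) n₁ n₂ n₃ n₄ deg = cong₂ _+_ (one n₂ deg) (two n₁ deg)
  where
  one : ∀ n₂ → n₁ + 2 * n₂ ≢ 2 * suc β → n₂ * twos β n₁ (pred n₂) n₃ n₄ ≡ 0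
  one zero    deg = refl
  one (suc m) deg = trans (cong (suc m *_) (twos-degree β n₁ m n₃ n₄ λ eq → deg (begin
    n₁ + 2 * suc m     ≡⟨ lemma n₁ m ⟩
    2 + (n₁ + 2 * m)   ≡⟨ cong (2 +_) eq ⟩
    2 + 2 * β          ≡⟨ *-suc 2 β ⟨
    2 * suc β          ∎))) (*-zeroʳ (suc m))
    where
    lemma : ∀ n m → n + 2 * suc m ≡ 2 + (n + 2 * m)
    lemma = solve-∀
  two : ∀ n₁ → n₁ + 2 * n₂ ≢ 2 * suc β → n₁ * (pred n₁ * twos β (pred (pred n₁)) n₂ n₃ n₄) ≡ 0
  two zero          deg = refl
  two (suc zero)    deg = refl
  two (suc (suc n)) deg = trans (cong (λ x → suc (suc n) * (suc n * x)) (twos-degree β n n₂ n₃ n₄ λ eq →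
    deg (trans (cong (2 +_) eq) (sym (*-suc 2 β)))))
    (trans (cong (suc (suc n) *_) (*-zeroʳ (suc n))) (*-zeroʳ (suc (suc n))))

g-suc : ∀ s β x → x ≡ β * g s → 2 * suc s * (suc (2 * s) * x) ≡ suc s * (β * g (suc s))
g-suc s β x refl = lemma s β (g s)
  where
  lemma : ∀ s β x → 2 * suc s * (suc (2 * s) * (β * x)) ≡ suc s * (β * (2 * (2 * s + 1) * x))
  lemma = solve-∀

-- Directly: the `n₂` colours of exponent 2 choose their parts in β! / s! ways, and the 2s colours
-- of exponent 1 are matched with the 2s remaining vertices. The two companion lemmas keep the
-- leading factor, which covers the cases where `pred` would break the degree condition.
twos-value : ∀ β s n₂ → β ≡ s + n₂ → twos β (2 * s) n₂ 0 0 ≡ β ! * g s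
*-twos-pred : ∀ β s n₂ → suc β ≡ s + n₂ → n₂ * twos β (2 * s) (pred n₂) 0 0 ≡ n₂ * (β ! * g s)
*-twos-pred-pred : ∀ β s n₂ → suc β ≡ s + n₂ →
  2 * s * (pred (2 * s) * twos β (pred (pred (2 * s))) n₂ 0 0) ≡ s * (β ! * g s)

twos-value zero    zero    zero    refl = refl
twos-value (suc β) s       n₂      eq   = begin
  n₂ * twos β (2 * s) (pred n₂) 0 0 + 2 * s * (pred (2 * s) * twos β (pred (pred (2 * s))) n₂ 0 0)
    ≡⟨ cong₂ _+_ (*-twos-pred β s n₂ eq) (*-twos-pred-pred β s n₂ eq) ⟩
  n₂ * (β ! * g s) + s * (β ! * g s)
    ≡⟨ *-distribʳ-+ (β ! * g s) n₂ s ⟨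
  (n₂ + s) * (β ! * g s)
    ≡⟨ cong (_* (β ! * g s)) (trans (+-comm n₂ s) (sym eq)) ⟩
  suc β * (β ! * g s)
    ≡⟨ *-assoc (suc β) (β !) (g s) ⟨
  suc β ! * g s
    ∎

*-twos-pred β s zero    eq = refl
*-twos-pred β s (suc m) eq = cong (suc m *_) (twos-value β s m (suc-injective (trans eq (+-suc s m))))

*-twos-pred-pred β zero    n₂ eq = refl
*-twos-pred-pred β (suc s) n₂ eq rewrite +-suc s (s + 0) =
  trans (cong (λ x → x * (suc (2 * s) * twos β (2 * s) n₂ 0 0)) (sym (*-suc 2 s)))
    (g-suc s (β !) _ (twos-value β s n₂ (suc-injective eq)))

-- The colour of exponent 3 has to fill the part of size 3, so only the parts of size 2 are counted.
three-twos-even : ∀ β s n₂ → β ≡ s + n₂ → three-twos β (2 * s) n₂ 1 0 ≡ β ! * g s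
three-twos-even β s n₂ eq
  rewrite twos-large β (pred (2 * s)) (pred n₂) 1 0 z<s | twos-large β (pred (pred (pred (2 * s)))) n₂ 1 0 z<s
        | twos-value β s n₂ eq
  = lemma (β ! * g s) n₂ (2 * s) (pred (2 * s)) (pred (pred (2 * s)))
  where
  lemma : ∀ v n₂ x y z → 1 * v + n₂ * (x * 0) + n₂ * (x * 0) + x * (n₂ * 0) + x * (y * (z * 0)) ≡ v
  lemma = solve-∀

-- The part of size 3 takes one colour of exponent 2 and one of exponent 1, in three arrangements,
-- or three colours of exponent 1. These contribute in the ratio 3 n₂ : t, and 3 n₂ + t = β + 1 + 2
-- n₂.
three-twos-odd : ∀ β t n₂ → suc β ≡ t + n₂ →
  three-twos β (suc (2 * t)) n₂ 0 0 ≡ β ! * ((2 * t + 1) * g t * (suc β + 2 * n₂))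
three-twos-odd β t n₂ eq = begin
  0 + n₂ * (n₁ * x) + n₂ * (n₁ * x) + n₁ * (n₂ * x) + n₁ * y
    ≡⟨ regroup n₁ n₂ x y ⟩
  3 * n₁ * (n₂ * x) + n₁ * y
    ≡⟨ cong₂ (λ v w → 3 * n₁ * v + n₁ * w) (*-twos-pred β t n₂ eq) (*-twos-pred-pred β t n₂ eq) ⟩
  3 * n₁ * (n₂ * (β ! * g t)) + n₁ * (t * (β ! * g t))
    ≡⟨ collect t n₂ (β !) (g t) ⟩
  β ! * ((2 * t + 1) * g t * (t + n₂ + 2 * n₂))
    ≡⟨ cong (λ v → β ! * ((2 * t + 1) * g t * (v + 2 * n₂))) eq ⟨
  β ! * ((2 * t + 1) * g t * (suc β + 2 * n₂))
    ∎
  where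
  n₁ = suc (2 * t)
  x = twos β (2 * t) (pred n₂) 0 0
  y = 2 * t * (pred (2 * t) * twos β (pred (pred (2 * t))) n₂ 0 0)
  regroup : ∀ n₁ n₂ x y → 0 + n₂ * (n₁ * x) + n₂ * (n₁ * x) + n₁ * (n₂ * x) + n₁ * y ≡ 3 * n₁ * (n₂ * x) + n₁ * y
  regroup = solve-∀
  collect : ∀ t n₂ f g → 3 * suc (2 * t) * (n₂ * (f * g)) + suc (2 * t) * (t * (f * g)) ≡
    f * ((2 * t + 1) * g * (t + n₂ + 2 * n₂))
  collect = solve-∀

-- No part has more than three vertices, and only one has three.
three-twos-large : ∀ β n₁ n₂ n₃ n₄ → 0 < pred n₃ + n₄ → three-twos β n₁ n₂ n₃ n₄ ≡ 0
three-twos-large β n₁ n₂ n₃ n₄ pos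
  rewrite twos-large β n₁ n₂ (pred n₃) n₄ pos
        | twos-large β (pred n₁) (pred n₂) n₃ n₄ (<-≤-trans pos (+-monoˡ-≤ n₄ pred[n]≤n))
        | twos-large β (pred (pred (pred n₁))) n₂ n₃ n₄ (<-≤-trans pos (+-monoˡ-≤ n₄ pred[n]≤n))
  = lemma n₁ n₂ n₃ (pred n₁) (pred (pred n₁))
  where
  lemma : ∀ n₁ n₂ n₃ y z → n₃ * 0 + n₂ * (n₁ * 0) + n₂ * (n₁ * 0) + n₁ * (n₂ * 0) + n₁ * (y * (z * 0)) ≡ 0
  lemma = solve-∀

three-twos-degree₁ : ∀ β n₁ n₂ → n₁ + 2 * n₂ ≢ 2 * β → three-twos β n₁ n₂ 1 0 ≡ 0
three-twos-degree₁ β n₁ n₂ deg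
  rewrite twos-degree β n₁ n₂ 0 0 deg
        | twos-large β (pred n₁) (pred n₂) 1 0 z<s | twos-large β (pred (pred (pred n₁))) n₂ 1 0 z<s
  = lemma n₁ n₂ (pred n₁) (pred (pred n₁))
  where
  lemma : ∀ n₁ n₂ y z → 0 + n₂ * (n₁ * 0) + n₂ * (n₁ * 0) + n₁ * (n₂ * 0) + n₁ * (y * (z * 0)) ≡ 0
  lemma = solve-∀

three-twos-degree₀ : ∀ β n₁ n₂ → n₁ + 2 * n₂ ≢ 2 * β + 3 → three-twos β n₁ n₂ 0 0 ≡ 0
three-twos-degree₀ β n₁ n₂ deg = begin
  0 + n₂ * (n₁ * x) + n₂ * (n₁ * x) + n₁ * (n₂ * x) + n₁ * (pred n₁ * (pred (pred n₁) * y))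
    ≡⟨ regroup n₁ n₂ x (n₁ * (pred n₁ * (pred (pred n₁) * y))) ⟩
  3 * (n₁ * (n₂ * x)) + n₁ * (pred n₁ * (pred (pred n₁) * y))
    ≡⟨ cong₂ (λ v w → 3 * v + w) (one n₁ n₂ deg) (two n₁ deg) ⟩
  0
    ∎
  where
  x = twos β (pred n₁) (pred n₂) 0 0
  y = twos β (pred (pred (pred n₁))) n₂ 0 0
  regroup : ∀ n₁ n₂ x y → 0 + n₂ * (n₁ * x) + n₂ * (n₁ * x) + n₁ * (n₂ * x) + y ≡ 3 * (n₁ * (n₂ * x)) + y
  regroup = solve-∀
  one : ∀ n₁ n₂ → n₁ + 2 * n₂ ≢ 2 * β + 3 → n₁ * (n₂ * twos β (pred n₁) (pred n₂) 0 0) ≡ 0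
  one zero    n₂      deg = refl
  one (suc n) zero    deg = *-zeroʳ n
  one (suc n) (suc m) deg = trans (cong (λ v → suc n * (suc m * v)) (twos-degree β n m 0 0 λ eq → deg (begin
    suc n + 2 * suc m   ≡⟨ lemma n m ⟩
    n + 2 * m + 3       ≡⟨ cong (_+ 3) eq ⟩
    2 * β + 3           ∎))) (trans (cong (suc n *_) (*-zeroʳ (suc m))) (*-zeroʳ (suc n)))
    where
    lemma : ∀ n m → suc n + 2 * suc m ≡ n + 2 * m + 3
    lemma = solve-∀
  two : ∀ n₁ → n₁ + 2 * n₂ ≢ 2 * β + 3 → n₁ * (pred n₁ * (pred (pred n₁) * twos β (pred (pred (pred n₁))) n₂ 0 0)) ≡ 0
  two zero                deg = refl
  two (suc zero)          deg = refl
  two (suc (suc zero))    deg = refl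
  two (suc (suc (suc n))) deg = trans (cong (λ v → (3 + n) * ((2 + n) * ((1 + n) * v))) (twos-degree β n n₂ 0 0 λ eq → deg (begin
    3 + n + 2 * n₂      ≡⟨ lemma n n₂ ⟩
    n + 2 * n₂ + 3      ≡⟨ cong (_+ 3) eq ⟩
    2 * β + 3           ∎))) (zeros n)
    where
    lemma : ∀ n m → 3 + n + 2 * m ≡ n + 2 * m + 3
    lemma = solve-∀
    zeros : ∀ n → (3 + n) * ((2 + n) * ((1 + n) * 0)) ≡ 0
    zeros = solve-∀

-- Products of elementary symmetric functions

-- Multiplication of a generating function by its variable; the 0 stands for the coefficient at
-- index -1.
shift : (ℕ → ℕ) → ℕ → ℕ
shift f zero    = 0
shift f (suc n) = f n

shift-cong : ∀ {f g : ℕ → ℕ} → (∀ n → f n ≡ g n) → ∀ n → shift f n ≡ shift g n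
shift-cong eq zero    = refl
shift-cong eq (suc n) = eq n

shift-0 : ∀ n → shift (λ _ → 0) n ≡ 0
shift-0 zero    = refl
shift-0 (suc n) = refl

shift-+ : ∀ (f g : ℕ → ℕ) n → shift (λ m → f m + g m) n ≡ shift f n + shift g n
shift-+ f g zero    = refl
shift-+ f g (suc n) = refl

shift₁ shift₂ : (ℕ → ℕ → ℕ) → ℕ → ℕ → ℕ
shift₁ F p q = shift (λ p′ → F p′ q) p
shift₂ F p q = shift (F p) q

-- mulₑ G α p is the coefficient of x^α in e_p G.

mulₑ : ∀ {k} → (Vec ℕ k → ℕ) → Vec ℕ k → ℕ → ℕ
mulₑ G []          zero    = G []
mulₑ G []          (suc p) = 0
mulₑ G (zero ∷ α)  p       = mulₑ (G ∘ (zero ∷_)) α p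
mulₑ G (suc a ∷ α) p       = mulₑ (G ∘ (suc a ∷_)) α p + shift (mulₑ (G ∘ (a ∷_)) α) p

mulₑ-cong : ∀ {k} {G H : Vec ℕ k → ℕ} → (∀ α → G α ≡ H α) → ∀ α p → mulₑ G α p ≡ mulₑ H α p
mulₑ-cong eq []          zero    = eq []
mulₑ-cong eq []          (suc p) = refl
mulₑ-cong eq (zero ∷ α)  p       = mulₑ-cong (eq ∘ (zero ∷_)) α p
mulₑ-cong eq (suc a ∷ α) p       = cong₂ _+_ (mulₑ-cong (eq ∘ (suc a ∷_)) α p) (shift-cong (mulₑ-cong (eq ∘ (a ∷_)) α) p)

mulₑ-+ : ∀ {k} (G H : Vec ℕ k → ℕ) α p → mulₑ (λ β → G β + H β) α p ≡ mulₑ G α p + mulₑ H α p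
mulₑ-+ G H []          zero    = refl
mulₑ-+ G H []          (suc p) = refl
mulₑ-+ G H (zero ∷ α)  p       = mulₑ-+ (G ∘ (zero ∷_)) (H ∘ (zero ∷_)) α p
mulₑ-+ G H (suc a ∷ α) p       = begin
  mulₑ (λ β → G (suc a ∷ β) + H (suc a ∷ β)) α p + shift (mulₑ (λ β → G (a ∷ β) + H (a ∷ β)) α) p
    ≡⟨ cong₂ _+_ (mulₑ-+ (G ∘ (suc a ∷_)) (H ∘ (suc a ∷_)) α p)
         (trans (shift-cong (mulₑ-+ (G ∘ (a ∷_)) (H ∘ (a ∷_)) α) p) (shift-+ (mulₑ (G ∘ (a ∷_)) α) (mulₑ (H ∘ (a ∷_)) α) p)) ⟩
  w + x + (y + z)
    ≡⟨ swap w x y z ⟩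
  w + y + (x + z)
    ∎
  where
  w = mulₑ (G ∘ (suc a ∷_)) α p
  x = mulₑ (H ∘ (suc a ∷_)) α p
  y = shift (mulₑ (G ∘ (a ∷_)) α) p
  z = shift (mulₑ (H ∘ (a ∷_)) α) p
  swap : ∀ w x y z → w + x + (y + z) ≡ w + y + (x + z)
  swap = solve-∀

mulₑ-0 : ∀ {k} (α : Vec ℕ k) p → mulₑ (λ _ → 0) α p ≡ 0
mulₑ-0 []          zero    = refl
mulₑ-0 []          (suc p) = refl
mulₑ-0 (zero ∷ α)  p       = mulₑ-0 α p
mulₑ-0 (suc a ∷ α) p       = cong₂ _+_ (mulₑ-0 α p) (trans (shift-cong (mulₑ-0 α) p) (shift-0 p))

mulₑ-zero : ∀ {k} (G : Vec ℕ k → ℕ) α → mulₑ G α 0 ≡ G α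
mulₑ-zero G []          = refl
mulₑ-zero G (zero ∷ α)  = mulₑ-zero (G ∘ (zero ∷_)) α
mulₑ-zero G (suc a ∷ α) = trans (+-identityʳ _) (mulₑ-zero (G ∘ (suc a ∷_)) α)

mulₑ² : ∀ {k} → (Vec ℕ k → ℕ) → Vec ℕ k → ℕ → ℕ → ℕ
mulₑ² G α p q = mulₑ (λ β → mulₑ G β q) α p

mulₑ²-cong : ∀ {k} {G H : Vec ℕ k → ℕ} → (∀ α → G α ≡ H α) → ∀ α p q → mulₑ² G α p q ≡ mulₑ² H α p q
mulₑ²-cong eq α p q = mulₑ-cong (λ β → mulₑ-cong eq β q) α p

mulₑ²-0 : ∀ {k} (α : Vec ℕ k) p q → mulₑ² (λ _ → 0) α p q ≡ 0
mulₑ²-0 α p q = trans (mulₑ-cong (λ β → mulₑ-0 β q) α p) (mulₑ-0 α p)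

shifted₁ : ∀ {k} (α : Vec ℕ k) p q → shift₁ (mulₑ² (λ _ → 0) α) p q ≡ 0
shifted₁ α p q = trans (shift-cong (λ p′ → mulₑ²-0 α p′ q) p) (shift-0 p)

shifted₂ : ∀ {k} (α : Vec ℕ k) p q → shift₂ (mulₑ² (λ _ → 0) α) p q ≡ 0
shifted₂ α p q = trans (shift-cong (λ q′ → mulₑ²-0 α p q′) q) (shift-0 q)

shifted₁₂ : ∀ {k} (α : Vec ℕ k) p q → shift₁ (shift₂ (mulₑ² (λ _ → 0) α)) p q ≡ 0
shifted₁₂ α p q = trans (shift-cong (λ p′ → shifted₂ α p′ q) p) (shift-0 p)

mulₑ-shift : ∀ {k} (G : Vec ℕ k → ℕ) α p q → mulₑ (λ β → shift (mulₑ G β) q) α p ≡ shift₂ (mulₑ² G α) p q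
mulₑ-shift G α p zero    = mulₑ-0 α p
mulₑ-shift G α p (suc q) = refl

mulₑ²-head : ∀ {k} (G : Vec ℕ (suc k) → ℕ) a α p q →
  mulₑ (λ β → mulₑ G (suc a ∷ β) q) α p ≡
  mulₑ² (G ∘ (suc a ∷_)) α p q + shift₂ (mulₑ² (G ∘ (a ∷_)) α) p q
mulₑ²-head G a α p q = trans (mulₑ-+ (λ β → mulₑ (G ∘ (suc a ∷_)) β q) (λ β → shift (mulₑ (G ∘ (a ∷_)) β) q) α p)
  (cong (mulₑ² (G ∘ (suc a ∷_)) α p q +_) (mulₑ-shift (G ∘ (a ∷_)) α p q))

mulₑ²-1∷ : ∀ {k} (G : Vec ℕ (suc k) → ℕ) α p q →
  mulₑ² G (1 ∷ α) p q ≡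
  mulₑ² (G ∘ (1 ∷_)) α p q + shift₂ (mulₑ² (G ∘ (0 ∷_)) α) p q + shift₁ (mulₑ² (G ∘ (0 ∷_)) α) p q
mulₑ²-1∷ G α p q = cong (_+ shift₁ (mulₑ² (G ∘ (0 ∷_)) α) p q) (mulₑ²-head G 0 α p q)

mulₑ²-2+∷ : ∀ {k} (G : Vec ℕ (suc k) → ℕ) a α p q →
  mulₑ² G (suc (suc a) ∷ α) p q ≡
  mulₑ² (G ∘ (suc (suc a) ∷_)) α p q + shift₂ (mulₑ² (G ∘ (suc a ∷_)) α) p q +
  (shift₁ (mulₑ² (G ∘ (suc a ∷_)) α) p q + shift₁ (shift₂ (mulₑ² (G ∘ (a ∷_)) α)) p q)
mulₑ²-2+∷ G a α p q = cong₂ _+_ (mulₑ²-head G (suc a) α p q)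
  (trans (shift-cong (λ p′ → mulₑ²-head G a α p′ q) p) (shift-+ (λ p′ → mulₑ² (G ∘ (suc a ∷_)) α p′ q) _ p))

constant-term : ∀ {k} → Vec ℕ k → ℕ
constant-term []          = 1
constant-term (zero  ∷ α) = constant-term α
constant-term (suc _ ∷ α) = 0

-- The coefficients of e₁. Starting from them, `mulₑ²` gives the coefficients of e_p e_q e₁.
linear-term : ∀ {k} → Vec ℕ k → ℕ
linear-term α = mulₑ constant-term α 1

-- The coefficient of x^p y^q in (x + y)^n₁ (x y)^n₂

binomial : ℕ → ℕ → ℕ → ℕ → ℕ
binomial zero     zero     zero    zero    = 1
binomial zero     zero     zero    (suc q) = 0
binomial zero     zero     (suc p) q       = 0
binomial (suc n₁) zero     p       q       = shift₁ (binomial n₁ 0) p q + shift₂ (binomial n₁ 0) p q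
binomial n₁       (suc n₂) p       q       = shift₁ (shift₂ (binomial n₁ n₂)) p q

binomial-suc₂ : ∀ n₁ n₂ p q → binomial n₁ (suc n₂) p q ≡ shift₁ (shift₂ (binomial n₁ n₂)) p q
binomial-suc₂ zero     n₂ p q = refl
binomial-suc₂ (suc n₁) n₂ p q = refl

-- The definition removes every factor x y before any factor x + y; here a factor x + y is removed
-- first, so the two kinds commute.
binomial-suc₁ : ∀ n₁ n₂ p q →
  binomial (suc n₁) n₂ p q ≡ shift₁ (binomial n₁ n₂) p q + shift₂ (binomial n₁ n₂) p q
binomial-suc₁ n₁ zero     p       q       = refl
binomial-suc₁ n₁ (suc n₂) zero    zero    = refl
binomial-suc₁ n₁ (suc n₂) zero    (suc q) = sym (binomial-suc₂ n₁ n₂ 0 q)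
binomial-suc₁ n₁ (suc n₂) (suc p) zero    = sym (trans (+-identityʳ _) (trans (binomial-suc₂ n₁ n₂ p 0) (shift-0 p)))
binomial-suc₁ n₁ (suc n₂) (suc p) (suc q) =
  trans (binomial-suc₁ n₁ n₂ p q) (sym (cong₂ _+_ (binomial-suc₂ n₁ n₂ p (suc q)) (binomial-suc₂ n₁ n₂ (suc p) q)))

binomial-value₀ : ∀ n p q → p + q ≡ n → binomial n 0 p q ≡ n C p
binomial-value₀ zero    zero    zero    eq = refl
binomial-value₀ (suc n) zero    (suc q) eq =
  trans (binomial-value₀ n 0 q (suc-injective eq)) (trans (nC0≡1 n) (sym (nC0≡1 (suc n))))
binomial-value₀ (suc n) (suc p) zero    eq with refl ← trans (sym (+-identityʳ p)) (suc-injective eq) =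
  trans (+-identityʳ _) (trans (binomial-value₀ n p 0 (+-identityʳ p)) (trans (nCn≡1 p) (sym (nCn≡1 (suc p)))))
binomial-value₀ (suc n) (suc p) (suc q) eq = trans
  (cong₂ _+_ (binomial-value₀ n p (suc q) (suc-injective eq))
             (binomial-value₀ n (suc p) q (trans (sym (+-suc p q)) (suc-injective eq))))
  (sym (pascal n p))

-- By the degree condition the monomial is determined by its power of x. Removing (x y)^n₂ leaves
-- C(n₁, p).
binomial-value : ∀ n₁ n₂ p q → p + n₂ + q ≡ n₁ + 2 * n₂ → binomial n₁ n₂ (p + n₂) q ≡ n₁ C p
binomial-value n₁ zero    p q       eq rewrite +-identityʳ p | +-identityʳ n₁ = binomial-value₀ n₁ p q eq
-- A factor x y excludes `q = 0`; on the right, the degree condition then forces `p` above `n₁`.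
binomial-value n₁ (suc m) p zero    eq rewrite binomial-suc₂ n₁ m (p + suc m) 0 =
  trans (shift-0 (p + suc m)) (sym (k>n⇒nCk≡0 (subst (n₁ <_) (sym p≡) (m<m+n n₁ z<s))))
  where
  p≡ : p ≡ n₁ + suc m
  p≡ = +-cancelʳ-≡ (suc m) p (n₁ + suc m) (begin
    p + suc m                 ≡⟨ +-identityʳ _ ⟨
    p + suc m + 0             ≡⟨ eq ⟩
    n₁ + 2 * suc m            ≡⟨ lemma n₁ (suc m) ⟩
    n₁ + suc m + suc m        ∎)
    where
    lemma : ∀ n m → n + 2 * m ≡ n + m + m
    lemma = solve-∀
binomial-value n₁ (suc m) p (suc q) eq rewrite binomial-suc₂ n₁ m (p + suc m) (suc q) | +-suc p m =
  binomial-value n₁ m p q (suc-injective (suc-injective (begin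
    suc (suc (p + m + q))     ≡⟨ cong suc (+-suc (p + m) q) ⟨
    suc (p + m + suc q)       ≡⟨ eq ⟩
    n₁ + 2 * suc m            ≡⟨ lemma n₁ m ⟩
    2 + (n₁ + 2 * m)          ∎)))
  where
  lemma : ∀ n m → n + 2 * suc m ≡ 2 + (n + 2 * m)
  lemma = solve-∀

binomial-degree : ∀ n₁ n₂ p q → p + q ≢ n₁ + 2 * n₂ → binomial n₁ n₂ p q ≡ 0
binomial-degree zero     zero    zero    zero    deg = contradiction refl deg
binomial-degree zero     zero    zero    (suc q) deg = refl
binomial-degree zero     zero    (suc p) q       deg = refl
binomial-degree (suc n)  zero    p       q       deg = cong₂ _+_ (one p deg) (two q deg)
  where
  one : ∀ p → p + q ≢ suc n + 0 → shift₁ (binomial n 0) p q ≡ 0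
  one zero    deg = refl
  one (suc p) deg = binomial-degree n 0 p q (deg ∘ cong suc)
  two : ∀ q → p + q ≢ suc n + 0 → shift₂ (binomial n 0) p q ≡ 0
  two zero    deg = refl
  two (suc q) deg = binomial-degree n 0 p q (deg ∘ trans (+-suc p q) ∘ cong suc)
binomial-degree n₁       (suc m) p       q       deg rewrite binomial-suc₂ n₁ m p q = lower p q deg
  where
  lemma : ∀ n m → 2 + (n + 2 * m) ≡ n + 2 * suc m
  lemma = solve-∀
  lower : ∀ p q → p + q ≢ n₁ + 2 * suc m → shift₁ (shift₂ (binomial n₁ m)) p q ≡ 0
  lower zero    q       deg = refl
  lower (suc p) zero    deg = refl
  lower (suc p) (suc q) deg = binomial-degree n₁ m p q λ eq →
    deg (trans (cong suc (+-suc p q)) (trans (cong (2 +_) eq) (lemma n₁ m)))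

-- The last argument before p and q is the number of exponents that are at
-- least 3, which do not occur in a product of two elementary functions.

e²-statistic : ℕ → ℕ → ℕ → ℕ → ℕ → ℕ
e²-statistic n₁ n₂ zero    p q = binomial n₁ n₂ p q
e²-statistic n₁ n₂ (suc _) p q = 0

e²-suc₁ : ∀ n₁ n₂ m p q →
  e²-statistic (suc n₁) n₂ m p q ≡ shift₁ (e²-statistic n₁ n₂ m) p q + shift₂ (e²-statistic n₁ n₂ m) p q
e²-suc₁ n₁ n₂ zero    p q = binomial-suc₁ n₁ n₂ p q
e²-suc₁ n₁ n₂ (suc m) p q = sym (cong₂ _+_ (shift-0 p) (shift-0 q))

e²-suc₂ : ∀ n₁ n₂ m p q → e²-statistic n₁ (suc n₂) m p q ≡ shift₁ (shift₂ (e²-statistic n₁ n₂ m)) p q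
e²-suc₂ n₁ n₂ zero    p q = binomial-suc₂ n₁ n₂ p q
e²-suc₂ n₁ n₂ (suc m) p q = sym (trans (shift-cong (λ _ → shift-0 q) p) (shift-0 p))

-- In the generating function over (p, q) an exponent 1 contributes x + y, an exponent 2 contributes
-- x y, and a larger one 0, since each of the two factors supplies at most 1.
e²-value : ∀ {k} (α : Vec ℕ k) p q →
  mulₑ² constant-term α p q ≡ e²-statistic (occ 1 α) (occ 2 α) (occ 3 α + large α) p q
e²-value []      zero    zero    = refl
e²-value []      zero    (suc q) = refl
e²-value []      (suc p) q       = refl
e²-value (0 ∷ α) p q = e²-value α p q
e²-value (1 ∷ α) p q = begin
  mulₑ² constant-term (1 ∷ α) p q
    ≡⟨ mulₑ²-1∷ constant-term α p q ⟩
  mulₑ² (λ _ → 0) α p q + shift₂ (mulₑ² constant-term α) p q + shift₁ (mulₑ² constant-term α) p q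
    ≡⟨ cong₂ _+_ (cong₂ _+_ (mulₑ²-0 α p q) (shift-cong (λ q′ → e²-value α p q′) q)) (shift-cong (λ p′ → e²-value α p′ q) p) ⟩
  shift₂ S p q + shift₁ S p q
    ≡⟨ +-comm (shift₂ S p q) (shift₁ S p q) ⟩
  shift₁ S p q + shift₂ S p q
    ≡⟨ e²-suc₁ (occ 1 α) (occ 2 α) (occ 3 α + large α) p q ⟨
  e²-statistic (suc (occ 1 α)) (occ 2 α) (occ 3 α + large α) p q
    ∎
  where
  S = e²-statistic (occ 1 α) (occ 2 α) (occ 3 α + large α)
e²-value (2 ∷ α) p q = begin
  mulₑ² constant-term (2 ∷ α) p q
    ≡⟨ mulₑ²-2+∷ constant-term 0 α p q ⟩
  mulₑ² (λ _ → 0) α p q + shift₂ (mulₑ² (λ _ → 0) α) p q + (shift₁ (mulₑ² (λ _ → 0) α) p q + shift₁ (shift₂ (mulₑ² constant-term α)) p q)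
    ≡⟨ cong₂ _+_ (cong₂ _+_ (mulₑ²-0 α p q) (shifted₂ α p q)) (cong₂ _+_ (shifted₁ α p q) (shift-cong (λ p′ → shift-cong (λ q′ → e²-value α p′ q′) q) p)) ⟩
  shift₁ (shift₂ S) p q
    ≡⟨ e²-suc₂ (occ 1 α) (occ 2 α) (occ 3 α + large α) p q ⟨
  e²-statistic (occ 1 α) (suc (occ 2 α)) (occ 3 α + large α) p q
    ∎
  where
  S = e²-statistic (occ 1 α) (occ 2 α) (occ 3 α + large α)
e²-value (suc (suc (suc a)) ∷ α) p q = trans
  (trans (mulₑ²-2+∷ constant-term (suc a) α p q)
    (cong₂ _+_ (cong₂ _+_ (mulₑ²-0 α p q) (shifted₂ α p q)) (cong₂ _+_ (shifted₁ α p q) (shifted₁₂ α p q))))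
  (sym (vanishes a))
  where
  vanishes : ∀ a → let β = suc (suc (suc a)) ∷ α in e²-statistic (occ 1 β) (occ 2 β) (occ 3 β + large β) p q ≡ 0
  vanishes zero    = refl
  vanishes (suc a) rewrite +-suc (occ 3 α) (large α) = refl

linear-term-1∷ : ∀ {k} (α : Vec ℕ k) → linear-term (1 ∷ α) ≡ constant-term α
linear-term-1∷ α = cong₂ _+_ (mulₑ-0 α 1) (mulₑ-zero constant-term α)

linear-term-2+∷ : ∀ {k} a (α : Vec ℕ k) → linear-term (suc (suc a) ∷ α) ≡ 0
linear-term-2+∷ a α = cong₂ _+_ (mulₑ-0 α 1) (mulₑ-0 α 0)

-- The factor e₁ lowers one exponent by one.

e³-statistic : ℕ → ℕ → ℕ → ℕ → ℕ → ℕ → ℕ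
e³-statistic n₁ n₂ n₃ n₄ p q =
  n₁ * e²-statistic (pred n₁) n₂ (n₃ + n₄) p q +
  n₂ * e²-statistic (suc n₁) (pred n₂) (n₃ + n₄) p q +
  n₃ * e²-statistic n₁ (suc n₂) (pred n₃ + n₄) p q

shift-combination : ∀ x y z (f g h : ℕ → ℕ) n →
  shift (λ m → x * f m + y * g m + z * h m) n ≡ x * shift f n + y * shift g n + z * shift h n
shift-combination x y z f g h zero    = sym (cong₂ _+_ (cong₂ _+_ (*-zeroʳ x) (*-zeroʳ y)) (*-zeroʳ z))
shift-combination x y z f g h (suc n) = refl

*-e²-pred₁ : ∀ n₁ n₂ m p q →
  n₁ * shift₁ (e²-statistic (pred n₁) n₂ m) p q + n₁ * shift₂ (e²-statistic (pred n₁) n₂ m) p q ≡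
  n₁ * e²-statistic n₁ n₂ m p q
*-e²-pred₁ zero    n₂ m p q = refl
*-e²-pred₁ (suc n) n₂ m p q =
  trans (sym (*-distribˡ-+ (suc n) (shift₁ (e²-statistic n n₂ m) p q) (shift₂ (e²-statistic n n₂ m) p q))) (cong (suc n *_) (sym (e²-suc₁ n n₂ m p q)))

-- A Leibniz rule: e₁ lowers either the new exponent or one of the old ones, and in the latter case
-- the new exponent contributes x + y. For a new exponent 2 the two cases contribute x + y and x y.
e³-suc₁ : ∀ n₁ n₂ n₃ n₄ p q → let S = e³-statistic n₁ n₂ n₃ n₄ in
  e³-statistic (suc n₁) n₂ n₃ n₄ p q ≡
  e²-statistic n₁ n₂ (n₃ + n₄) p q + shift₂ S p q + shift₁ S p q
e³-suc₁ n₁ n₂ n₃ n₄ p q = begin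
  suc n₁ * e²-statistic n₁ n₂ m p q + n₂ * e²-statistic (suc (suc n₁)) (pred n₂) m p q + n₃ * e²-statistic (suc n₁) (suc n₂) m′ p q
    ≡⟨ cong₂ _+_ (cong₂ _+_ (cong (u +_) (sym (*-e²-pred₁ n₁ n₂ m p q))) (cong (n₂ *_) (e²-suc₁ (suc n₁) (pred n₂) m p q)))
         (cong (n₃ *_) (e²-suc₁ n₁ (suc n₂) m′ p q)) ⟩
  u + (n₁ * shift₁ F₁ p q + n₁ * shift₂ F₁ p q) + n₂ * (shift₁ F₂ p q + shift₂ F₂ p q) + n₃ * (shift₁ F₃ p q + shift₂ F₃ p q)
    ≡⟨ regroup u n₁ n₂ n₃ (shift₁ F₁ p q) (shift₂ F₁ p q) (shift₁ F₂ p q) (shift₂ F₂ p q) (shift₁ F₃ p q) (shift₂ F₃ p q) ⟩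
  u + (n₁ * shift₂ F₁ p q + n₂ * shift₂ F₂ p q + n₃ * shift₂ F₃ p q) + (n₁ * shift₁ F₁ p q + n₂ * shift₁ F₂ p q + n₃ * shift₁ F₃ p q)
    ≡⟨ cong₂ (λ v w → u + v + w)
         (shift-combination n₁ n₂ n₃ (F₁ p) (F₂ p) (F₃ p) q)
         (shift-combination n₁ n₂ n₃ (λ p′ → F₁ p′ q) (λ p′ → F₂ p′ q) (λ p′ → F₃ p′ q) p) ⟨
  u + shift₂ (e³-statistic n₁ n₂ n₃ n₄) p q + shift₁ (e³-statistic n₁ n₂ n₃ n₄) p q
    ∎
  where
  m = n₃ + n₄
  m′ = pred n₃ + n₄
  u = e²-statistic n₁ n₂ m p q
  F₁ = e²-statistic (pred n₁) n₂ m
  F₂ = e²-statistic (suc n₁) (pred n₂) m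
  F₃ = e²-statistic n₁ (suc n₂) m′
  regroup : ∀ u x y z a₁ a₂ b₁ b₂ c₁ c₂ →
    u + (x * a₁ + x * a₂) + y * (b₁ + b₂) + z * (c₁ + c₂) ≡
    u + (x * a₂ + y * b₂ + z * c₂) + (x * a₁ + y * b₁ + z * c₁)
  regroup = solve-∀

*-e²-pred₂ : ∀ n₁ n₂ m p q →
  n₂ * shift₁ (shift₂ (e²-statistic n₁ (pred n₂) m)) p q ≡ n₂ * e²-statistic n₁ n₂ m p q
*-e²-pred₂ n₁ zero    m p q = refl
*-e²-pred₂ n₁ (suc n) m p q = cong (suc n *_) (sym (e²-suc₂ n₁ n m p q))

e³-suc₂ : ∀ n₁ n₂ n₃ n₄ p q → let S = e³-statistic n₁ n₂ n₃ n₄; T = e²-statistic n₁ n₂ (n₃ + n₄) in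
  e³-statistic n₁ (suc n₂) n₃ n₄ p q ≡ shift₂ T p q + (shift₁ T p q + shift₁ (shift₂ S) p q)
e³-suc₂ n₁ n₂ n₃ n₄ p q = begin
  n₁ * e²-statistic (pred n₁) (suc n₂) m p q + suc n₂ * e²-statistic (suc n₁) n₂ m p q + n₃ * e²-statistic n₁ (suc (suc n₂)) m′ p q
    ≡⟨ cong₂ _+_ (cong₂ _+_ (cong (n₁ *_) (e²-suc₂ (pred n₁) n₂ m p q))
         (cong₂ _+_ (e²-suc₁ n₁ n₂ m p q) (sym (*-e²-pred₂ (suc n₁) n₂ m p q))))
         (cong (n₃ *_) (e²-suc₂ n₁ (suc n₂) m′ p q)) ⟩
  n₁ * shift₁ (shift₂ F₁) p q + (shift₁ T p q + shift₂ T p q + n₂ * shift₁ (shift₂ F₂) p q) + n₃ * shift₁ (shift₂ F₃) p q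
    ≡⟨ regroup (n₁ * shift₁ (shift₂ F₁) p q) (shift₁ T p q) (shift₂ T p q) (n₂ * shift₁ (shift₂ F₂) p q) (n₃ * shift₁ (shift₂ F₃) p q) ⟩
  shift₂ T p q + (shift₁ T p q + (n₁ * shift₁ (shift₂ F₁) p q + n₂ * shift₁ (shift₂ F₂) p q + n₃ * shift₁ (shift₂ F₃) p q))
    ≡⟨ cong (λ v → shift₂ T p q + (shift₁ T p q + v)) (trans
         (shift-cong (λ p′ → shift-combination n₁ n₂ n₃ (F₁ p′) (F₂ p′) (F₃ p′) q) p)
         (shift-combination n₁ n₂ n₃ (λ p′ → shift₂ F₁ p′ q) (λ p′ → shift₂ F₂ p′ q) (λ p′ → shift₂ F₃ p′ q) p)) ⟨
  shift₂ T p q + (shift₁ T p q + shift₁ (shift₂ (e³-statistic n₁ n₂ n₃ n₄)) p q)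
    ∎
  where
  m = n₃ + n₄
  m′ = pred n₃ + n₄
  T = e²-statistic n₁ n₂ m
  F₁ = e²-statistic (pred n₁) n₂ m
  F₂ = e²-statistic (suc n₁) (pred n₂) m
  F₃ = e²-statistic n₁ (suc n₂) m′
  regroup : ∀ a b c d e → a + (b + c + d) + e ≡ c + (b + (a + d + e))
  regroup = solve-∀

-- An exponent 3 must itself be the one that e₁ lowers; the remaining 2 contributes x y.
e³-suc₃ : ∀ n₁ n₂ n₃ n₄ p q →
  e³-statistic n₁ n₂ (suc n₃) n₄ p q ≡ shift₁ (shift₂ (e²-statistic n₁ n₂ (n₃ + n₄))) p q
e³-suc₃ n₁ n₂ zero     n₄ p q rewrite *-zeroʳ n₁ | *-zeroʳ n₂ = trans (+-identityʳ _) (e²-suc₂ n₁ n₂ n₄ p q)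
e³-suc₃ n₁ n₂ (suc n₃) n₄ p q rewrite *-zeroʳ n₁ | *-zeroʳ n₂ | *-zeroʳ n₃ =
  sym (trans (shift-cong (λ _ → shift-0 q) p) (shift-0 p))

e³-suc₄ : ∀ n₁ n₂ n₃ n₄ p q → e³-statistic n₁ n₂ n₃ (suc n₄) p q ≡ 0
e³-suc₄ n₁ n₂ n₃ n₄ p q rewrite +-suc n₃ n₄ | +-suc (pred n₃) n₄ | *-zeroʳ n₁ | *-zeroʳ n₂ = *-zeroʳ n₃

e³-value : ∀ {k} (α : Vec ℕ k) p q →
  mulₑ² linear-term α p q ≡ e³-statistic (occ 1 α) (occ 2 α) (occ 3 α) (large α) p q
e³-value []      zero    zero    = refl
e³-value []      zero    (suc q) = refl
e³-value []      (suc p) q       = refl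
e³-value (0 ∷ α) p q = e³-value α p q
e³-value (1 ∷ α) p q = begin
  mulₑ² linear-term (1 ∷ α) p q
    ≡⟨ mulₑ²-1∷ linear-term α p q ⟩
  mulₑ² (linear-term ∘ (1 ∷_)) α p q + shift₂ (mulₑ² linear-term α) p q + shift₁ (mulₑ² linear-term α) p q
    ≡⟨ cong₂ _+_ (cong₂ _+_ (trans (mulₑ²-cong linear-term-1∷ α p q) (e²-value α p q))
         (shift-cong (λ q′ → e³-value α p q′) q)) (shift-cong (λ p′ → e³-value α p′ q) p) ⟩
  e²-statistic (occ 1 α) (occ 2 α) (occ 3 α + large α) p q + shift₂ S p q + shift₁ S p q
    ≡⟨ e³-suc₁ (occ 1 α) (occ 2 α) (occ 3 α) (large α) p q ⟨
  e³-statistic (suc (occ 1 α)) (occ 2 α) (occ 3 α) (large α) p q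
    ∎
  where
  S = e³-statistic (occ 1 α) (occ 2 α) (occ 3 α) (large α)
e³-value (2 ∷ α) p q = begin
  mulₑ² linear-term (2 ∷ α) p q
    ≡⟨ mulₑ²-2+∷ linear-term 0 α p q ⟩
  mulₑ² (linear-term ∘ (2 ∷_)) α p q + shift₂ (mulₑ² (linear-term ∘ (1 ∷_)) α) p q +
  (shift₁ (mulₑ² (linear-term ∘ (1 ∷_)) α) p q + shift₁ (shift₂ (mulₑ² linear-term α)) p q)
    ≡⟨ cong₂ _+_ (cong₂ _+_ (trans (mulₑ²-cong (linear-term-2+∷ 0) α p q) (mulₑ²-0 α p q)) (shift-cong (λ q′ → quadratic p q′) q))
         (cong₂ _+_ (shift-cong (λ p′ → quadratic p′ q) p) (shift-cong (λ p′ → shift-cong (λ q′ → e³-value α p′ q′) q) p)) ⟩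
  shift₂ T p q + (shift₁ T p q + shift₁ (shift₂ S) p q)
    ≡⟨ e³-suc₂ (occ 1 α) (occ 2 α) (occ 3 α) (large α) p q ⟨
  e³-statistic (occ 1 α) (suc (occ 2 α)) (occ 3 α) (large α) p q
    ∎
  where
  S = e³-statistic (occ 1 α) (occ 2 α) (occ 3 α) (large α)
  T = e²-statistic (occ 1 α) (occ 2 α) (occ 3 α + large α)
  quadratic : ∀ p q → mulₑ² (linear-term ∘ (1 ∷_)) α p q ≡ T p q
  quadratic p q = trans (mulₑ²-cong linear-term-1∷ α p q) (e²-value α p q)
e³-value (suc (suc (suc a)) ∷ α) p q = begin
  mulₑ² linear-term (suc (suc (suc a)) ∷ α) p q
    ≡⟨ mulₑ²-2+∷ linear-term (suc a) α p q ⟩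
  mulₑ² (linear-term ∘ (suc (suc (suc a)) ∷_)) α p q + shift₂ (mulₑ² (linear-term ∘ (suc (suc a) ∷_)) α) p q +
  (shift₁ (mulₑ² (linear-term ∘ (suc (suc a) ∷_)) α) p q + shift₁ (shift₂ (mulₑ² (linear-term ∘ (suc a ∷_)) α)) p q)
    ≡⟨ cong₂ _+_ (cong₂ _+_ (none (suc a) p q) (trans (shift-cong (λ q′ → none a p q′) q) (shift-0 q)))
         (cong (_+ shift₁ (shift₂ (mulₑ² (linear-term ∘ (suc a ∷_)) α)) p q) (trans (shift-cong (λ p′ → none a p′ q) p) (shift-0 p))) ⟩
  shift₁ (shift₂ (mulₑ² (linear-term ∘ (suc a ∷_)) α)) p q
    ≡⟨ by-size a ⟩
  e³-statistic (occ 1 β) (occ 2 β) (occ 3 β) (large β) p q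
    ∎
  where
  β = suc (suc (suc a)) ∷ α
  none : ∀ a p q → mulₑ² (linear-term ∘ (suc (suc a) ∷_)) α p q ≡ 0
  none a p q = trans (mulₑ²-cong (linear-term-2+∷ a) α p q) (mulₑ²-0 α p q)
  by-size : ∀ a → let β = suc (suc (suc a)) ∷ α in
    shift₁ (shift₂ (mulₑ² (linear-term ∘ (suc a ∷_)) α)) p q ≡
    e³-statistic (occ 1 β) (occ 2 β) (occ 3 β) (large β) p q
  by-size zero    = trans
    (shift-cong (λ p′ → shift-cong (λ q′ → trans (mulₑ²-cong linear-term-1∷ α p′ q′) (e²-value α p′ q′)) q) p)
    (sym (e³-suc₃ (occ 1 α) (occ 2 α) (occ 3 α) (large α) p q))
  by-size (suc a) = trans
    (trans (shift-cong (λ p′ → trans (shift-cong (λ q′ → none a p′ q′) q) (shift-0 q)) p) (shift-0 p))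
    (sym (e³-suc₄ (occ 1 α) (occ 2 α) (occ 3 α) (large α) p q))

-- Closed forms of the elementary side and comparison

-- Since e₀ = 1, the terms e_(2β+3) and e_(2β+2,1) of the theorem continue the
-- two sums: they are e_(2β+3,0) and e_(2β+2,0,1).

expansion² : ℕ → (ℕ → ℕ → ℕ) → ℕ
expansion² β E = ∑< (2 + β) λ d → (2 * d + 1) * diagonal d * E (β + 2 + d) (β + 1 ∸ d)

expansion³ : ℕ → (ℕ → ℕ → ℕ) → ℕ
expansion³ β E = ∑< (2 + β) λ d → differences d * E (β + 1 + d) (β + 1 ∸ d)

∑<-coefficients : ∀ β (c : ℕ → ℕ) {f h : ℕ → ℕ} → (∀ d → d ≤ β + 1 → f d ≡ h d) →
  ∑< (2 + β) (λ d → c d * f d) ≡ ∑< (2 + β) (λ d → c d * h d)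
∑<-coefficients β c eq = ∑<-cong (2 + β) λ d d<β+2 →
  cong (c d *_) (eq d (subst (d ≤_) (+-comm 1 β) (s≤s⁻¹ d<β+2)))

∑<-coefficients-0 : ∀ β (c : ℕ → ℕ) {f : ℕ → ℕ} → (∀ d → d ≤ β + 1 → f d ≡ 0) →
  ∑< (2 + β) (λ d → c d * f d) ≡ 0
∑<-coefficients-0 β c eq = trans (∑<-coefficients β c eq)
  (trans (∑<-cong (2 + β) λ d _ → *-zeroʳ (c d)) (∑<-zero (2 + β)))

degree² : ∀ β d → d ≤ β + 1 → β + 2 + d + (β + 1 ∸ d) ≡ 2 * β + 3
degree² β d d≤ = trans (+-assoc (β + 2) d _) (trans (cong (β + 2 +_) (m+[n∸m]≡n d≤)) (lemma β))
  where
  lemma : ∀ β → β + 2 + (β + 1) ≡ 2 * β + 3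
  lemma = solve-∀

degree³ : ∀ β d → d ≤ β + 1 → β + 1 + d + (β + 1 ∸ d) ≡ 2 * β + 2
degree³ β d d≤ = trans (+-assoc (β + 1) d _) (trans (cong (β + 1 +_) (m+[n∸m]≡n d≤)) (lemma β))
  where
  lemma : ∀ β → β + 1 + (β + 1) ≡ 2 * β + 2
  lemma = solve-∀

binomial-at : ∀ n₁ n₂ p P q → P ≡ p + n₂ → P + q ≡ n₁ + 2 * n₂ → binomial n₁ n₂ P q ≡ n₁ C p
binomial-at n₁ n₂ p P q refl deg = binomial-value n₁ n₂ p q deg

-- The products e_p e_q give β (2t + 1) g t. With e₁, lowering an exponent 1 leaves 2t exponents 1
-- and lowering an exponent 2 leaves 2t + 2 of them, which gives n₁ g t + n₂ g (t + 1). The total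
-- factors because g (t + 1) = 2 (2t + 1) g t.
expansion-odd : ∀ β t n₂ → β + 1 ≡ t + n₂ → let n₁ = suc (2 * t) in
  β * expansion² β (e²-statistic n₁ n₂ 0) + expansion³ β (e³-statistic n₁ n₂ 0 0) ≡
  (2 * t + 1) * g t * (suc β + 2 * n₂)
expansion-odd β t n₂ eq = begin
  β * expansion² β (e²-statistic n₁ n₂ 0) + expansion³ β (e³-statistic n₁ n₂ 0 0)
    ≡⟨ cong₂ (λ v w → β * v + w) (∑<-coefficients β (λ d → (2 * d + 1) * diagonal d) odd-coefficient)
         (∑<-coefficients β differences even-coefficient) ⟩
  β * ∑< (2 + β) (λ d → (2 * d + 1) * diagonal d * odd t d) +
  ∑< (2 + β) (λ d → differences d * (n₁ * even t d + n₂ * even (suc t) d))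
    ≡⟨ cong₂ (λ v w → β * v + w) (odd-sum t (suc β) t≤1+β) even-part ⟩
  β * ((2 * t + 1) * g t) + (n₁ * g t + n₂ * g (suc t))
    ≡⟨ collect β t n₂ (g t) ⟩
  (2 * t + 1) * g t * (suc β + 2 * n₂)
    ∎
  where
  n₁ = suc (2 * t)
  t≤1+β : t ≤ suc β
  t≤1+β = subst (t ≤_) (trans (sym eq) (+-comm β 1)) (m≤m+n t n₂)
  total-degree² : ∀ d → d ≤ β + 1 → β + 2 + d + (β + 1 ∸ d) ≡ n₁ + 2 * n₂
  total-degree² d d≤ = begin
    β + 2 + d + (β + 1 ∸ d)   ≡⟨ degree² β d d≤ ⟩
    2 * β + 3                 ≡⟨ lemma₁ β ⟩
    1 + 2 * (β + 1)           ≡⟨ cong (λ v → 1 + 2 * v) eq ⟩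
    1 + 2 * (t + n₂)          ≡⟨ cong suc (*-distribˡ-+ 2 t n₂) ⟩
    n₁ + 2 * n₂               ∎
    where
    lemma₁ : ∀ β → 2 * β + 3 ≡ 1 + 2 * (β + 1)
    lemma₁ = solve-∀
  total-degree³ : ∀ d → d ≤ β + 1 → β + 1 + d + (β + 1 ∸ d) ≡ 2 * t + 2 * n₂
  total-degree³ d d≤ = begin
    β + 1 + d + (β + 1 ∸ d)   ≡⟨ degree³ β d d≤ ⟩
    2 * β + 2                 ≡⟨ *-distribˡ-+ 2 β 1 ⟨
    2 * (β + 1)               ≡⟨ cong (2 *_) eq ⟩
    2 * (t + n₂)              ≡⟨ *-distribˡ-+ 2 t n₂ ⟩
    2 * t + 2 * n₂            ∎
  odd-coefficient : ∀ d → d ≤ β + 1 → binomial n₁ n₂ (β + 2 + d) (β + 1 ∸ d) ≡ odd t d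
  odd-coefficient d d≤ = binomial-at n₁ n₂ (suc (t + d)) _ _ position (total-degree² d d≤)
    where
    lemma₁ : ∀ β d → β + 2 + d ≡ β + 1 + suc d
    lemma₁ = solve-∀
    lemma₂ : ∀ t n d → t + n + suc d ≡ suc (t + d) + n
    lemma₂ = solve-∀
    position : β + 2 + d ≡ suc (t + d) + n₂
    position = trans (lemma₁ β d) (trans (cong (_+ suc d) eq) (lemma₂ t n₂ d))
  position : ∀ d → β + 1 + d ≡ t + d + n₂
  position d = trans (cong (_+ d) eq) (lemma t n₂ d)
    where
    lemma : ∀ t n d → t + n + d ≡ t + d + n
    lemma = solve-∀
  pred-coefficient : ∀ n₂ d → β + 1 + d ≡ t + d + n₂ → β + 1 + d + (β + 1 ∸ d) ≡ 2 * t + 2 * n₂ →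
    n₂ * binomial (suc n₁) (pred n₂) (β + 1 + d) (β + 1 ∸ d) ≡ n₂ * even (suc t) d
  pred-coefficient zero    d pos deg = refl
  pred-coefficient (suc m) d pos deg = cong (suc m *_) (trans
    (binomial-at (suc n₁) m (suc t + d) _ _ (trans pos (+-suc (t + d) m)) (trans deg (lemma t m)))
    (cong (_C (suc t + d)) (sym (*-suc 2 t))))
    where
    lemma : ∀ t m → 2 * t + 2 * suc m ≡ suc (suc (2 * t)) + 2 * m
    lemma = solve-∀
  even-coefficient : ∀ d → d ≤ β + 1 →
    e³-statistic n₁ n₂ 0 0 (β + 1 + d) (β + 1 ∸ d) ≡ n₁ * even t d + n₂ * even (suc t) d
  even-coefficient d d≤ = trans (+-identityʳ _) (cong₂ _+_
    (cong (n₁ *_) (binomial-at (2 * t) n₂ (t + d) _ _ (position d) (total-degree³ d d≤)))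
    (pred-coefficient n₂ d (position d) (total-degree³ d d≤)))
  -- The range of summation reaches column t + 1 only if `n₂` is positive; otherwise the factor `n₂`
  -- disposes of the sum.
  n₂-part : ∀ n₂ → β + 1 ≡ t + n₂ → n₂ * ∑< (2 + β) (λ d → differences d * even (suc t) d) ≡ n₂ * g (suc t)
  n₂-part zero    eq = refl
  n₂-part (suc m) eq = cong (suc m *_) (differences-sum (suc t) (suc β)
    (subst (suc t ≤_) (trans (sym (trans eq (+-suc t m))) (+-comm β 1)) (s≤s (m≤m+n t m))))
  even-part : ∑< (2 + β) (λ d → differences d * (n₁ * even t d + n₂ * even (suc t) d)) ≡ n₁ * g t + n₂ * g (suc t)
  even-part = begin
    ∑< (2 + β) (λ d → differences d * (n₁ * even t d + n₂ * even (suc t) d))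
      ≡⟨ ∑<-cong (2 + β) (λ d _ → lemma (differences d) n₁ (even t d) n₂ (even (suc t) d)) ⟩
    ∑< (2 + β) (λ d → n₁ * (differences d * even t d) + n₂ * (differences d * even (suc t) d))
      ≡⟨ ∑<-distrib-+ (2 + β) (λ d → n₁ * (differences d * even t d)) (λ d → n₂ * (differences d * even (suc t) d)) ⟩
    ∑< (2 + β) (λ d → n₁ * (differences d * even t d)) + ∑< (2 + β) (λ d → n₂ * (differences d * even (suc t) d))
      ≡⟨ cong₂ _+_ (*-distribˡ-∑< (2 + β) n₁ (λ d → differences d * even t d))
           (*-distribˡ-∑< (2 + β) n₂ (λ d → differences d * even (suc t) d)) ⟨
    n₁ * ∑< (2 + β) (λ d → differences d * even t d) + n₂ * ∑< (2 + β) (λ d → differences d * even (suc t) d)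
      ≡⟨ cong₂ (λ v w → n₁ * v + w) (differences-sum t (suc β) t≤1+β) (n₂-part n₂ eq) ⟩
    n₁ * g t + n₂ * g (suc t)
      ∎
    where
    lemma : ∀ b n x m y → b * (n * x + m * y) ≡ n * (b * x) + m * (b * y)
    lemma = solve-∀
  collect : ∀ β t n g → β * ((2 * t + 1) * g) + (suc (2 * t) * g + n * (2 * (2 * t + 1) * g)) ≡
    (2 * t + 1) * g * (suc β + 2 * n)
  collect = solve-∀

-- No product of two elementary functions reaches the exponent 3. With e₁ that exponent is lowered
-- to 2, which leaves 2s exponents 1 and `suc n₂` exponents 2.
expansion-even : ∀ β s n₂ → β ≡ s + n₂ →
  β * expansion² β (e²-statistic (2 * s) n₂ 1) + expansion³ β (e³-statistic (2 * s) n₂ 1 0) ≡ g s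
expansion-even β s n₂ eq = begin
  β * expansion² β (e²-statistic (2 * s) n₂ 1) + expansion³ β (e³-statistic (2 * s) n₂ 1 0)
    ≡⟨ cong₂ (λ v w → β * v + w) (∑<-coefficients-0 β (λ d → (2 * d + 1) * diagonal d) λ _ _ → refl)
         (∑<-coefficients β differences even-coefficient) ⟩
  β * 0 + ∑< (2 + β) (λ d → differences d * even s d)
    ≡⟨ cong (_+ ∑< (2 + β) (λ d → differences d * even s d)) (*-zeroʳ β) ⟩
  ∑< (2 + β) (λ d → differences d * even s d)
    ≡⟨ differences-sum s (suc β) (m≤n⇒m≤1+n (subst (s ≤_) (sym eq) (m≤m+n s n₂))) ⟩
  g s
    ∎
  where
  even-coefficient : ∀ d → d ≤ β + 1 → e³-statistic (2 * s) n₂ 1 0 (β + 1 + d) (β + 1 ∸ d) ≡ even s d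
  even-coefficient d d≤ rewrite *-zeroʳ (2 * s) | *-zeroʳ n₂ = trans (+-identityʳ _)
    (binomial-at (2 * s) (suc n₂) (s + d) _ _ position degree)
    where
    lemma₁ : ∀ s n d → s + n + 1 + d ≡ s + d + suc n
    lemma₁ = solve-∀
    lemma₂ : ∀ s n → 2 * (s + n) + 2 ≡ 2 * s + 2 * suc n
    lemma₂ = solve-∀
    position : β + 1 + d ≡ s + d + suc n₂
    position = trans (cong (λ v → v + 1 + d) eq) (lemma₁ s n₂ d)
    degree : β + 1 + d + (β + 1 ∸ d) ≡ 2 * s + 2 * suc n₂
    degree = trans (degree³ β d d≤) (trans (cong (λ v → 2 * v + 2) eq) (lemma₂ s n₂))

expansion-0 : ∀ β n₁ n₂ n₃ n₄ →
  (∀ d → d ≤ β + 1 → e²-statistic n₁ n₂ (n₃ + n₄) (β + 2 + d) (β + 1 ∸ d) ≡ 0) →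
  (∀ d → d ≤ β + 1 → e³-statistic n₁ n₂ n₃ n₄ (β + 1 + d) (β + 1 ∸ d) ≡ 0) →
  β * expansion² β (e²-statistic n₁ n₂ (n₃ + n₄)) + expansion³ β (e³-statistic n₁ n₂ n₃ n₄) ≡ 0
expansion-0 β n₁ n₂ n₃ n₄ zero² zero³ = trans
  (cong₂ (λ v w → β * v + w) (∑<-coefficients-0 β (λ d → (2 * d + 1) * diagonal d) zero²) (∑<-coefficients-0 β differences zero³))
  (trans (+-identityʳ _) (*-zeroʳ β))

expansion-degree₀ : ∀ β n₁ n₂ → n₁ + 2 * n₂ ≢ 2 * β + 3 →
  β * expansion² β (e²-statistic n₁ n₂ 0) + expansion³ β (e³-statistic n₁ n₂ 0 0) ≡ 0
expansion-degree₀ β n₁ n₂ deg = expansion-0 β n₁ n₂ 0 0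
  (λ d d≤ → binomial-degree n₁ n₂ _ _ λ eq → deg (trans (sym eq) (degree² β d d≤)))
  (λ d d≤ → trans (+-identityʳ _) (cong₂ _+_
    (one n₁ (β + 1 + d) (β + 1 ∸ d) (degree³ β d d≤) deg) (two n₂ (β + 1 + d) (β + 1 ∸ d) (degree³ β d d≤) deg)))
  where
  raise : ∀ {x} → x ≡ 2 * β + 2 → suc x ≡ 2 * β + 3
  raise eq = trans (cong suc eq) (sym (+-suc (2 * β) 2))
  one : ∀ n₁ p q → p + q ≡ 2 * β + 2 → n₁ + 2 * n₂ ≢ 2 * β + 3 → n₁ * binomial (pred n₁) n₂ p q ≡ 0
  one zero    p q eq deg = refl
  one (suc n) p q eq deg = trans (cong (suc n *_) (binomial-degree n n₂ p q λ eq′ → deg (raise (trans (sym eq′) eq)))) (*-zeroʳ (suc n))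
  two : ∀ n₂ p q → p + q ≡ 2 * β + 2 → n₁ + 2 * n₂ ≢ 2 * β + 3 → n₂ * binomial (suc n₁) (pred n₂) p q ≡ 0
  two zero    p q eq deg = refl
  two (suc m) p q eq deg = trans (cong (suc m *_) (binomial-degree (suc n₁) m p q λ eq′ →
    deg (trans (lemma n₁ m) (raise (trans (sym eq′) eq))))) (*-zeroʳ (suc m))
    where
    lemma : ∀ n m → n + 2 * suc m ≡ suc (suc n + 2 * m)
    lemma = solve-∀

expansion-degree₁ : ∀ β n₁ n₂ → n₁ + 2 * n₂ ≢ 2 * β →
  β * expansion² β (e²-statistic n₁ n₂ 1) + expansion³ β (e³-statistic n₁ n₂ 1 0) ≡ 0
expansion-degree₁ β n₁ n₂ deg = expansion-0 β n₁ n₂ 1 0 (λ _ _ → refl) zero³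
  where
  zero³ : ∀ d → d ≤ β + 1 → e³-statistic n₁ n₂ 1 0 (β + 1 + d) (β + 1 ∸ d) ≡ 0
  zero³ d d≤ rewrite *-zeroʳ n₁ | *-zeroʳ n₂ = trans (+-identityʳ _) (binomial-degree n₁ (suc n₂) _ _ λ eq →
    deg (+-cancelʳ-≡ 2 _ _ (trans (lemma n₁ n₂) (trans (sym eq) (degree³ β d d≤)))))
    where
    lemma : ∀ n m → n + 2 * m + 2 ≡ n + 2 * suc m
    lemma = solve-∀

expansion-large : ∀ β n₁ n₂ n₃ n₄ → 0 < pred n₃ + n₄ →
  β * expansion² β (e²-statistic n₁ n₂ (n₃ + n₄)) + expansion³ β (e³-statistic n₁ n₂ n₃ n₄) ≡ 0
expansion-large β n₁ n₂ n₃ n₄ pos = expansion-0 β n₁ n₂ n₃ n₄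
  (λ d _ → none n₁ n₂ (n₃ + n₄) _ _ (<-≤-trans pos (+-monoˡ-≤ n₄ pred[n]≤n)))
  (λ d _ → none³ (β + 1 + d) (β + 1 ∸ d))
  where
  none : ∀ n₁ n₂ m p q → 0 < m → e²-statistic n₁ n₂ m p q ≡ 0
  none n₁ n₂ (suc m) p q _ = refl
  none³ : ∀ p q → e³-statistic n₁ n₂ n₃ n₄ p q ≡ 0
  none³ p q
    rewrite none (pred n₁) n₂ (n₃ + n₄) p q (<-≤-trans pos (+-monoˡ-≤ n₄ pred[n]≤n))
          | none (suc n₁) (pred n₂) (n₃ + n₄) p q (<-≤-trans pos (+-monoˡ-≤ n₄ pred[n]≤n))
          | none n₁ (suc n₂) (pred n₃ + n₄) p q pos
          | *-zeroʳ n₁ | *-zeroʳ n₂ = *-zeroʳ n₃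

half-odd : ∀ β n₁ n₂ → n₁ + 2 * n₂ ≡ 2 * β + 3 → ∃[ t ] n₁ ≡ suc (2 * t) × β + 1 ≡ t + n₂
half-odd β n₁ n₂ eq = β + 1 ∸ n₂ , +-cancelʳ-≡ (2 * n₂) n₁ _ (begin
  n₁ + 2 * n₂                          ≡⟨ eq ⟩
  2 * β + 3                            ≡⟨ lemma β ⟩
  suc (2 * (β + 1))                    ≡⟨ cong (λ v → suc (2 * v)) (m∸n+n≡m n₂≤) ⟨
  suc (2 * (β + 1 ∸ n₂ + n₂))          ≡⟨ cong suc (*-distribˡ-+ 2 (β + 1 ∸ n₂) n₂) ⟩
  suc (2 * (β + 1 ∸ n₂)) + 2 * n₂      ∎) , sym (m∸n+n≡m n₂≤)
  where
  lemma : ∀ β → 2 * β + 3 ≡ suc (2 * (β + 1))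
  lemma = solve-∀
  n₂≤ : n₂ ≤ β + 1
  n₂≤ = ≮⇒≥ λ n₂> → <⇒≱ (subst (_< 2 * suc (β + 1)) (sym (lemma β)) (subst (suc (2 * (β + 1)) <_) (sym (*-suc 2 (β + 1))) ≤-refl))
    (≤-trans (*-monoʳ-≤ 2 n₂>) (subst (2 * n₂ ≤_) eq (m≤n+m (2 * n₂) n₁)))

half-even : ∀ β n₁ n₂ → n₁ + 2 * n₂ ≡ 2 * β → ∃[ s ] n₁ ≡ 2 * s × β ≡ s + n₂
half-even β n₁ n₂ eq = β ∸ n₂ , +-cancelʳ-≡ (2 * n₂) n₁ _ (begin
  n₁ + 2 * n₂                   ≡⟨ eq ⟩
  2 * β                         ≡⟨ cong (2 *_) (m∸n+n≡m n₂≤) ⟨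
  2 * (β ∸ n₂ + n₂)             ≡⟨ *-distribˡ-+ 2 (β ∸ n₂) n₂ ⟩
  2 * (β ∸ n₂) + 2 * n₂         ∎) , sym (m∸n+n≡m n₂≤)
  where
  n₂≤ : n₂ ≤ β
  n₂≤ = *-cancelˡ-≤ 2 (subst (2 * n₂ ≤_) eq (m≤n+m (2 * n₂) n₁))

-- The split on `n₃` and `n₄` precedes the test of the degree, since an exponent 3 turns the
-- condition n₁ + 2 n₂ = 2β + 3 into n₁ + 2 n₂ = 2β. Outside the two surviving cases each side
-- vanishes by itself.
three-twos-expansion : ∀ β n₁ n₂ n₃ n₄ →
  three-twos β n₁ n₂ n₃ n₄ ≡
  β ! * (β * expansion² β (e²-statistic n₁ n₂ (n₃ + n₄)) + expansion³ β (e³-statistic n₁ n₂ n₃ n₄))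
three-twos-expansion β n₁ n₂ zero zero with n₁ + 2 * n₂ ≟ 2 * β + 3
... | no deg = trans (three-twos-degree₀ β n₁ n₂ deg)
  (sym (trans (cong (β ! *_) (expansion-degree₀ β n₁ n₂ deg)) (*-zeroʳ (β !))))
... | yes deg with t , refl , eq ← half-odd β n₁ n₂ deg =
  trans (three-twos-odd β t n₂ (trans (+-comm 1 β) eq)) (cong (β ! *_) (sym (expansion-odd β t n₂ eq)))
three-twos-expansion β n₁ n₂ (suc zero) zero with n₁ + 2 * n₂ ≟ 2 * β
... | no deg = trans (three-twos-degree₁ β n₁ n₂ deg)
  (sym (trans (cong (β ! *_) (expansion-degree₁ β n₁ n₂ deg)) (*-zeroʳ (β !))))
... | yes deg with s , refl , eq ← half-even β n₁ n₂ deg =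
  trans (three-twos-even β s n₂ eq) (cong (β ! *_) (sym (expansion-even β s n₂ eq)))
three-twos-expansion β n₁ n₂ (suc (suc n₃)) zero    =
  trans (three-twos-large β n₁ n₂ (2 + n₃) 0 z<s)
    (sym (trans (cong (β ! *_) (expansion-large β n₁ n₂ (2 + n₃) 0 z<s)) (*-zeroʳ (β !))))
three-twos-expansion β n₁ n₂ n₃ (suc n₄)    =
  trans (three-twos-large β n₁ n₂ n₃ (suc n₄) (pos n₃ n₄))
    (sym (trans (cong (β ! *_) (expansion-large β n₁ n₂ n₃ (suc n₄) (pos n₃ n₄))) (*-zeroʳ (β !))))
  where
  pos : ∀ n₃ n₄ → 0 < pred n₃ + suc n₄
  pos n₃ n₄ = subst (0 <_) (sym (+-suc (pred n₃) n₄)) z<s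

-- Passage from natural numbers to series over ℚ

fromℕ-+ : ∀ m n → fromℕ (m + n) ≡ fromℕ m ℚ.+ fromℕ n
fromℕ-+ m n = ℚ.toℚᵘ-injective (ℚᵘ.≃-trans (ℚ.toℚᵘ-fromℚᵘ (ℚᵘ.mkℚᵘ (ℤ.+ (m + n)) 0)) (ℚᵘ.≃-trans
  (ℚᵘ.*≡* (cong (ℤ._* ℤ.+ 1) (trans (ℤ.pos-+ m n) (sym (cong₂ ℤ._+_ (ℤ.*-identityʳ (ℤ.+ m)) (ℤ.*-identityʳ (ℤ.+ n)))))))
  (ℚᵘ.≃-sym (ℚᵘ.≃-trans (ℚ.toℚᵘ-homo-+ (fromℕ m) (fromℕ n))
    (ℚᵘ.+-cong (ℚ.toℚᵘ-fromℚᵘ (ℚᵘ.mkℚᵘ (ℤ.+ m) 0)) (ℚ.toℚᵘ-fromℚᵘ (ℚᵘ.mkℚᵘ (ℤ.+ n) 0)))))))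

fromℕ-* : ∀ m n → fromℕ (m * n) ≡ fromℕ m ℚ.* fromℕ n
fromℕ-* m n = ℚ.toℚᵘ-injective (ℚᵘ.≃-trans (ℚ.toℚᵘ-fromℚᵘ (ℚᵘ.mkℚᵘ (ℤ.+ (m * n)) 0)) (ℚᵘ.≃-trans
  (ℚᵘ.*≡* (cong (ℤ._* ℤ.+ 1) (ℤ.pos-* m n)))
  (ℚᵘ.≃-sym (ℚᵘ.≃-trans (ℚ.toℚᵘ-homo-* (fromℕ m) (fromℕ n))
    (ℚᵘ.*-cong (ℚ.toℚᵘ-fromℚᵘ (ℚᵘ.mkℚᵘ (ℤ.+ m) 0)) (ℚ.toℚᵘ-fromℚᵘ (ℚᵘ.mkℚᵘ (ℤ.+ n) 0)))))))

fromℕ-nonNegative : ∀ n → 0ℚ ℚ.≤ fromℕ n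
fromℕ-nonNegative n = ℚ.nonNegative⁻¹ (fromℕ n) {{ℚ.normalize-nonNeg n 1}}

sumℚ : List ℚ → ℚ
sumℚ = foldr ℚ._+_ 0ℚ

sumℚ-++ : ∀ xs ys → sumℚ (xs List.++ ys) ≡ sumℚ xs ℚ.+ sumℚ ys
sumℚ-++ []       ys = sym (ℚ.+-identityˡ (sumℚ ys))
sumℚ-++ (x ∷ xs) ys = trans (cong (x ℚ.+_) (sumℚ-++ xs ys)) (sym (ℚ.+-assoc x (sumℚ xs) (sumℚ ys)))

sumℚ-cartesianProductWith : ∀ {A B C : Set} (h : C → ℚ) (f : A → B → C) xs ys →
  sumℚ (List.map h (cartesianProductWith f xs ys)) ≡
  sumℚ (List.map (λ x → sumℚ (List.map (h ∘ f x) ys)) xs)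
sumℚ-cartesianProductWith h f []       ys = refl
sumℚ-cartesianProductWith h f (x ∷ xs) ys = begin
  sumℚ (List.map h (List.map (f x) ys List.++ cartesianProductWith f xs ys))
    ≡⟨ cong sumℚ (List.map-++ h (List.map (f x) ys) _) ⟩
  sumℚ (List.map h (List.map (f x) ys) List.++ List.map h (cartesianProductWith f xs ys))
    ≡⟨ sumℚ-++ (List.map h (List.map (f x) ys)) _ ⟩
  sumℚ (List.map h (List.map (f x) ys)) ℚ.+ sumℚ (List.map h (cartesianProductWith f xs ys))
    ≡⟨ cong₂ ℚ._+_ (cong sumℚ (sym (List.map-∘ ys))) (sumℚ-cartesianProductWith h f xs ys) ⟩
  sumℚ (List.map (h ∘ f x) ys) ℚ.+ sumℚ (List.map (λ x → sumℚ (List.map (h ∘ f x) ys)) xs)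
    ∎

sumℚ-zero : ∀ {A : Set} (f : A → ℚ) → (∀ x → f x ≡ 0ℚ) → ∀ xs → sumℚ (List.map f xs) ≡ 0ℚ
sumℚ-zero f f≡0 []       = refl
sumℚ-zero f f≡0 (x ∷ xs) = trans (cong₂ ℚ._+_ (f≡0 x) (sumℚ-zero f f≡0 xs)) (ℚ.+-identityˡ 0ℚ)

-- The product of series at a fixed number of variables, so that the factors can be specialised at
-- the first exponent and treated recursively.
convolve : ∀ {k} → (Vec ℕ k → ℚ) → (Vec ℕ k → ℚ) → Vec ℕ k → ℚ
convolve F G α = sumℚ (List.map (λ q → F (proj₁ q) ℚ.* G (proj₂ q)) (splittings α))

⊗≡convolve : ∀ F G k α → (F ⊗ G) k α ≡ convolve (F k) (G k) α
⊗≡convolve F G k α = cong sumℚ (List.map-cong (λ { (β , γ) → refl }) (splittings α))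

convolve-zeroˡ : ∀ {k} {F G : Vec ℕ k → ℚ} → (∀ β → F β ≡ 0ℚ) → ∀ α → convolve F G α ≡ 0ℚ
convolve-zeroˡ {G = G} F≡0 α = sumℚ-zero _ (λ q → trans (cong (ℚ._* G (proj₂ q)) (F≡0 (proj₁ q))) (ℚ.*-zeroˡ (G (proj₂ q)))) (splittings α)

convolve-∷ : ∀ {k} (F G : Vec ℕ (suc k) → ℚ) n α →
  convolve F G (n ∷ α) ≡ sumℚ (List.map (λ i → convolve (F ∘ (i ∷_)) (G ∘ ((n ∸ i) ∷_)) α) (upTo (suc n)))
convolve-∷ F G n α = trans (sumℚ-cartesianProductWith _ _ (upTo (suc n)) (splittings α))
  (cong sumℚ (List.map-cong (λ i → cong sumℚ (List.map-cong (λ { (β , γ) → refl }) (splittings α))) (upTo (suc n))))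

-- Of all divisions of an exponent listed by `splittings`, e_p admits only those that give it 0 or
-- 1; these are the two terms of `mulₑ`.
convolve-eₙ : ∀ {k} p (F : Vec ℕ k → ℚ) (G : Vec ℕ k → ℕ) → (∀ β → F β ≡ fromℕ (G β)) →
  ∀ α → convolve (eₙ p k) F α ≡ fromℕ (mulₑ G α p)
convolve-eₙ zero    F G F≡G []      = trans (ℚ.+-identityʳ _) (trans (ℚ.*-identityˡ (F [])) (F≡G []))
convolve-eₙ (suc p) F G F≡G []      = trans (ℚ.+-identityʳ _) (ℚ.*-zeroˡ (F []))
convolve-eₙ p       F G F≡G (0 ∷ α) = trans (convolve-∷ (eₙ p _) F 0 α)
  (trans (ℚ.+-identityʳ _) (convolve-eₙ p (F ∘ (0 ∷_)) (G ∘ (0 ∷_)) (F≡G ∘ (0 ∷_)) α))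
convolve-eₙ {suc k} p F G F≡G (suc a ∷ α) = begin
  convolve (eₙ p (suc k)) F (suc a ∷ α)
    ≡⟨ convolve-∷ (eₙ p (suc k)) F (suc a) α ⟩
  convolve (eₙ p k) (F ∘ (suc a ∷_)) α ℚ.+ (convolve (eₙ p (suc k) ∘ (1 ∷_)) (F ∘ (a ∷_)) α ℚ.+ rest)
    ≡⟨ cong₂ ℚ._+_ (convolve-eₙ p (F ∘ (suc a ∷_)) (G ∘ (suc a ∷_)) (F≡G ∘ (suc a ∷_)) α)
         (cong₂ ℚ._+_ (lower p) rest≡0) ⟩
  fromℕ (mulₑ (G ∘ (suc a ∷_)) α p) ℚ.+ (fromℕ (shift (mulₑ (G ∘ (a ∷_)) α) p) ℚ.+ 0ℚ)
    ≡⟨ cong (fromℕ (mulₑ (G ∘ (suc a ∷_)) α p) ℚ.+_) (ℚ.+-identityʳ _) ⟩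
  fromℕ (mulₑ (G ∘ (suc a ∷_)) α p) ℚ.+ fromℕ (shift (mulₑ (G ∘ (a ∷_)) α) p)
    ≡⟨ fromℕ-+ (mulₑ (G ∘ (suc a ∷_)) α p) (shift (mulₑ (G ∘ (a ∷_)) α) p) ⟨
  fromℕ (mulₑ G (suc a ∷ α) p)
    ∎
  where
  higher : ℕ → ℚ
  higher i = convolve (eₙ p (suc k) ∘ (i ∷_)) (F ∘ ((suc a ∸ i) ∷_)) α
  rest = sumℚ (List.map higher (applyUpTo (λ i → suc (suc i)) a))
  -- These divisions would give e_p an exponent of at least 2.
  rest≡0 : rest ≡ 0ℚ
  rest≡0 = trans (cong (sumℚ ∘ List.map higher) (sym (List.map-upTo (λ i → suc (suc i)) a)))
    (trans (cong sumℚ (sym (List.map-∘ (upTo a))))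
      (sumℚ-zero (λ i → higher (suc (suc i))) (λ i → convolve-zeroˡ {G = F ∘ ((suc a ∸ suc (suc i)) ∷_)} (λ β → refl) α) (upTo a)))
  -- Taking 1 from the first exponent uses up one unit of the degree `p`, which is impossible for
  -- `p = 0`.
  lower : ∀ p → convolve (eₙ p (suc k) ∘ (1 ∷_)) (F ∘ (a ∷_)) α ≡ fromℕ (shift (mulₑ (G ∘ (a ∷_)) α) p)
  lower zero    = convolve-zeroˡ (λ β → cong (λ b → if b then 1ℚ else 0ℚ) (∧-zeroʳ (does (VecAll.all? (_≤? 1) β)))) α
  lower (suc p) = convolve-eₙ p (F ∘ (a ∷_)) (G ∘ (a ∷_)) (F≡G ∘ (a ∷_)) α

e-coefficient : ∀ {k} → List ℕ → Vec ℕ k → ℕ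
e-coefficient []      α = constant-term α
e-coefficient (p ∷ μ) α = mulₑ (e-coefficient μ) α p

𝟙≡constant-term : ∀ k (α : Vec ℕ k) → 𝟙 k α ≡ fromℕ (constant-term α)
𝟙≡constant-term zero    []          = refl
𝟙≡constant-term (suc k) (zero  ∷ α) = 𝟙≡constant-term k α
𝟙≡constant-term (suc k) (suc _ ∷ α) = refl

e≡e-coefficient : ∀ μ k (α : Vec ℕ k) → e μ k α ≡ fromℕ (e-coefficient μ α)
e≡e-coefficient []      k α = 𝟙≡constant-term k α
e≡e-coefficient (p ∷ μ) k α = trans (⊗≡convolve (eₙ p) (e μ) k α)
  (convolve-eₙ p (e μ k) (e-coefficient μ) (e≡e-coefficient μ k) α)

sumOver-applyUpTo : ∀ (F : ℕ → Series) k (α : Vec ℕ k) (f : ℕ → ℕ) → (∀ d → F d k α ≡ fromℕ (f d)) →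
  ∀ h n → sumOver (applyUpTo h n) F k α ≡ fromℕ (∑< n (f ∘ h))
sumOver-applyUpTo F k α f eq h zero    = refl
sumOver-applyUpTo F k α f eq h (suc n) = begin
  F (h 0) k α ℚ.+ sumOver (applyUpTo (h ∘ suc) n) F k α
    ≡⟨ cong₂ ℚ._+_ (eq (h 0)) (sumOver-applyUpTo F k α f eq (h ∘ suc) n) ⟩
  fromℕ (f (h 0)) ℚ.+ fromℕ (∑< n (f ∘ h ∘ suc))
    ≡⟨ fromℕ-+ (f (h 0)) (∑< n (f ∘ h ∘ suc)) ⟨
  fromℕ (f (h 0) + ∑< n (f ∘ h ∘ suc))
    ≡⟨ cong fromℕ (∑<-suc n (f ∘ h)) ⟨
  fromℕ (∑< (suc n) (f ∘ h))
    ∎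

colourings-expansion : ∀ {k} β (α : Vec ℕ k) →
  colourings (3 ∷ replicate β 2) α ≡
  β ! * (β * expansion² β (mulₑ² constant-term α) + expansion³ β (mulₑ² linear-term α))
colourings-expansion β α = begin
  colourings (3 ∷ replicate β 2) α
    ≡⟨ value (colourings-three-twos β) α ⟩
  three-twos β n₁ n₂ n₃ n₄
    ≡⟨ three-twos-expansion β n₁ n₂ n₃ n₄ ⟩
  β ! * (β * expansion² β (e²-statistic n₁ n₂ (n₃ + n₄)) + expansion³ β (e³-statistic n₁ n₂ n₃ n₄))
    ≡⟨ cong₂ (λ v w → β ! * (β * v + w))
         (∑<-coefficients β (λ d → (2 * d + 1) * diagonal d) λ d _ → e²-value α (β + 2 + d) (β + 1 ∸ d))
         (∑<-coefficients β differences λ d _ → e³-value α (β + 1 + d) (β + 1 ∸ d)) ⟨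
  β ! * (β * expansion² β (mulₑ² constant-term α) + expansion³ β (mulₑ² linear-term α))
    ∎
  where
  n₁ = occ 1 α
  n₂ = occ 2 α
  n₃ = occ 3 α
  n₄ = large α

-- Identification with the terms of the theorem

coefficient² coefficient³ : ℕ → ℕ
coefficient² d = (2 * d + 1) * a d
coefficient³ d = (4 * d ∸ 3) * a (d ∸ 1) + a (d ∸ 2)

coefficient₁ coefficient₂ : ℕ → ℕ
coefficient₁ β = β * (2 * β + 3) * a (β + 1)
coefficient₂ β = a (β + 1) + (2 * β ^ 2 + β ∸ 1) * a β

expansionℕ : ∀ {k} → ℕ → Vec ℕ k → ℕ
expansionℕ β α =
  coefficient₁ β * e-coefficient (2 * β + 3 ∷ []) α +
  β * ∑< (suc (β ∸ 1)) (λ d → coefficient² d * e-coefficient (β + 2 + d ∷ β + 1 ∸ d ∷ []) α) +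
  coefficient₂ β * e-coefficient (2 * β + 2 ∷ 1 ∷ []) α +
  e-coefficient (β + 1 ∷ β + 1 ∷ 1 ∷ []) α +
  ∑< (β ∸ 1) (λ i → coefficient³ (2 + i) * e-coefficient (β + (2 + i) + 1 ∷ β + 1 ∸ (2 + i) ∷ 1 ∷ []) α)

coefficient³-differences : ∀ i → coefficient³ (2 + i) ≡ differences (2 + i)
coefficient³-differences i = cong₂ _+_ (cong₂ _*_ index (a≡diagonal (suc i))) (a≡diagonal i)
  where
  lemma : ∀ i → 4 * (2 + i) ≡ 4 * i + 5 + 3
  lemma = solve-∀
  index : 4 * (2 + i) ∸ 3 ≡ 4 * i + 5
  index = trans (cong (_∸ 3) (lemma i)) (m+n∸n≡m (4 * i + 5) 3)

-- The coefficient of e_(2β+2, 1) collects d = β of the first sum and d = β + 1 of the second. Since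
-- 2β² + β = β (2β + 1) and β ≥ 1, the truncated subtraction of 1 is exact, and it accounts for the
-- -a_β in the difference.
coefficient₂-differences : ∀ b → let β = suc b in
  coefficient₂ β ≡ β * ((2 * β + 1) * diagonal β) + differences (suc β)
coefficient₂-differences b = begin
  a (β + 1) + (2 * β ^ 2 + β ∸ 1) * a β
    ≡⟨ cong₂ (λ v w → v + (2 * β ^ 2 + β ∸ 1) * w) (trans (cong a (+-comm β 1)) (a≡diagonal (suc β))) (a≡diagonal β) ⟩
  diagonal (suc β) + c * diagonal β
    ≡⟨ cong (_+ c * diagonal β) (differences-diagonal β) ⟨
  differences (suc β) + diagonal β + c * diagonal β
    ≡⟨ regroup (differences (suc β)) (diagonal β) c ⟩
  (c + 1) * diagonal β + differences (suc β)
    ≡⟨ cong (λ v → v * diagonal β + differences (suc β)) c+1 ⟩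
  β * (2 * β + 1) * diagonal β + differences (suc β)
    ≡⟨ cong (_+ differences (suc β)) (*-assoc β (2 * β + 1) (diagonal β)) ⟩
  β * ((2 * β + 1) * diagonal β) + differences (suc β)
    ∎
  where
  β = suc b
  c = 2 * β ^ 2 + β ∸ 1
  regroup : ∀ x y c → x + y + c * y ≡ (c + 1) * y + x
  regroup = solve-∀
  square : ∀ β → 2 * (β * (β * 1)) + β ≡ β * (2 * β + 1)
  square = solve-∀
  c+1 : c + 1 ≡ β * (2 * β + 1)
  c+1 = trans (m∸n+n≡m (m≤n⇒m≤o+n (2 * β ^ 2) (s≤s z≤n))) (square β)

-- The terms d = β and d = β + 1 leave the first sum, and d = 0, 1 and β + 1 leave the second. Its
-- term d = 0 has coefficient 1 and gives e_(β+1, β+1, 1); its term d = 1 has coefficient 0.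
expansionℕ-sums : ∀ {k} b (α : Vec ℕ k) → let β = suc b in
  β * expansion² β (mulₑ² constant-term α) + expansion³ β (mulₑ² linear-term α) ≡ expansionℕ β α
expansionℕ-sums b α = begin
  β * expansion² β E² + expansion³ β E³
    ≡⟨ cong₂ (λ v w → β * (S + v + w) + expansion³ β E³) last² top² ⟩
  β * (S + p * y + q * z) + expansion³ β E³
    ≡⟨ cong (λ v → β * (S + p * y + q * z) + (v + differences (suc β) * E³ (β + 1 + suc β) (β + 1 ∸ suc β)))
         (trans (∑<-suc β (λ d → differences d * E³ (β + 1 + d) (β + 1 ∸ d)))
           (cong (1 * E³ (β + 1 + 0) (β + 1) +_) (∑<-suc b (λ d → differences (suc d) * E³ (β + 1 + suc d) (β + 1 ∸ suc d))))) ⟩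
  β * (S + p * y + q * z) + (1 * E³ (β + 1 + 0) (β + 1) + T + differences (suc β) * E³ (β + 1 + suc β) (β + 1 ∸ suc β))
    ≡⟨ cong₂ (λ v w → β * (S + p * y + q * z) + (1 * v + T + differences (suc β) * w))
         (cong (λ v → E³ v (β + 1)) (+-identityʳ (β + 1))) top³ ⟩
  β * (S + p * y + q * z) + (1 * x + T + differences (suc β) * y)
    ≡⟨ regroup β S p y q z x T (differences (suc β)) ⟩
  β * q * z + β * S + (β * p + differences (suc β)) * y + x + T
    ≡⟨ cong₂ _+_ (cong (_+ x) (cong₂ _+_ (cong₂ _+_ (cong (_* z) c₁) (cong (β *_) sum²)) (cong (_* y) (sym (coefficient₂-differences b))))) sum³ ⟩
  expansionℕ β α
    ∎
  where
  β = suc b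
  E² = mulₑ² constant-term α
  E³ = mulₑ² linear-term α
  S = ∑< β (λ d → (2 * d + 1) * diagonal d * E² (β + 2 + d) (β + 1 ∸ d))
  T = ∑< b (λ i → differences (2 + i) * E³ (β + 1 + (2 + i)) (β + 1 ∸ (2 + i)))
  p = (2 * β + 1) * diagonal β
  q = (2 * suc β + 1) * diagonal (suc β)
  x = e-coefficient (β + 1 ∷ β + 1 ∷ 1 ∷ []) α
  y = e-coefficient (2 * β + 2 ∷ 1 ∷ []) α
  z = e-coefficient (2 * β + 3 ∷ []) α
  index : ∀ β → β + 2 + β ≡ 2 * β + 2
  index = solve-∀
  index′ : ∀ β → β + 2 + suc β ≡ 2 * β + 3
  index′ = solve-∀
  index″ : ∀ β → β + 1 + suc β ≡ 2 * β + 2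
  index″ = solve-∀
  β+1∸β : β + 1 ∸ β ≡ 1
  β+1∸β = m+n∸m≡n β 1
  β+1∸[1+β] : β + 1 ∸ suc β ≡ 0
  β+1∸[1+β] = trans (cong (_∸ suc β) (+-comm β 1)) (n∸n≡0 (suc β))
  last² : p * E² (β + 2 + β) (β + 1 ∸ β) ≡ p * y
  last² = cong (p *_) (cong₂ E² (index β) β+1∸β)
  top² : q * E² (β + 2 + suc β) (β + 1 ∸ suc β) ≡ q * z
  top² = cong (q *_) (trans (cong₂ E² (index′ β) β+1∸[1+β]) (mulₑ-cong (mulₑ-zero constant-term) α (2 * β + 3)))
  top³ : E³ (β + 1 + suc β) (β + 1 ∸ suc β) ≡ y
  top³ = trans (cong₂ E³ (index″ β) β+1∸[1+β]) (mulₑ-cong (mulₑ-zero linear-term) α (2 * β + 2))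
  regroup : ∀ β S p y q z x T d →
    β * (S + p * y + q * z) + (1 * x + T + d * y) ≡ β * q * z + β * S + (β * p + d) * y + x + T
  regroup = solve-∀
  c₁ : β * q ≡ coefficient₁ β
  c₁ = begin
    β * ((2 * suc β + 1) * diagonal (suc β))   ≡⟨ *-assoc β (2 * suc β + 1) (diagonal (suc β)) ⟨
    β * (2 * suc β + 1) * diagonal (suc β)     ≡⟨ cong (λ v → β * v * diagonal (suc β)) (lemma β) ⟩
    β * (2 * β + 3) * diagonal (suc β)         ≡⟨ cong (β * (2 * β + 3) *_) (trans (cong a (+-comm β 1)) (a≡diagonal (suc β))) ⟨
    coefficient₁ β                             ∎
    where
    lemma : ∀ β → 2 * suc β + 1 ≡ 2 * β + 3
    lemma = solve-∀
  sum² : S ≡ ∑< β (λ d → coefficient² d * e-coefficient (β + 2 + d ∷ β + 1 ∸ d ∷ []) α)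
  sum² = ∑<-cong β λ d _ → cong (λ v → (2 * d + 1) * v * E² (β + 2 + d) (β + 1 ∸ d)) (sym (a≡diagonal d))
  sum³ : T ≡ ∑< b (λ i → coefficient³ (2 + i) * e-coefficient (β + (2 + i) + 1 ∷ β + 1 ∸ (2 + i) ∷ 1 ∷ []) α)
  sum³ = ∑<-cong b λ i _ → cong₂ _*_ (sym (coefficient³-differences i)) (cong (λ v → E³ v (β + 1 ∸ (2 + i))) (lemma β i))
    where
    lemma : ∀ β i → β + 1 + (2 + i) ≡ β + (2 + i) + 1
    lemma = solve-∀

+-value : ∀ {x y} m n → x ≡ fromℕ m → y ≡ fromℕ n → x ℚ.+ y ≡ fromℕ (m + n)
+-value m n x≡m y≡n = trans (cong₂ ℚ._+_ x≡m y≡n) (sym (fromℕ-+ m n))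

*-value : ∀ c {x} n → x ≡ fromℕ n → fromℕ c ℚ.* x ≡ fromℕ (c * n)
*-value c n x≡n = trans (cong (fromℕ c ℚ.*_) x≡n) (sym (fromℕ-* c n))

·e-value : ∀ x μ {k} (α : Vec ℕ k) → (fromℕ x · e μ) k α ≡ fromℕ (x * e-coefficient μ α)
·e-value x μ {k} α = *-value x (e-coefficient μ α) (e≡e-coefficient μ k α)

X-value : ∀ b k (α : Vec ℕ k) → let β = suc b in X (K ⟨3,2^ β ⟩) k α ≡ fromℕ (β ! * expansionℕ β α)
X-value b k α = trans (X≡colourings ⟨3,2^ suc b ⟩ k α)
  (cong fromℕ (trans (colourings-expansion (suc b) α) (cong (suc b ! *_) (expansionℕ-sums b α))))

expansion : ℕ → Series
expansion β =
  fromℕ (β !) ·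
    ( fromℕ (β * (2 * β + 3) * a (β + 1)) · e (2 * β + 3 ∷ [])
    ⊕ fromℕ β · ∑[ 0 ⋯ β ∸ 1 ] (λ d →
        fromℕ ((2 * d + 1) * a d) · e (β + 2 + d ∷ β + 1 ∸ d ∷ []))
    ⊕ fromℕ (a (β + 1) + (2 * β ^ 2 + β ∸ 1) * a β) · e (2 * β + 2 ∷ 1 ∷ [])
    ⊕ e (β + 1 ∷ β + 1 ∷ 1 ∷ [])
    ⊕ ∑[ 2 ⋯ β ] (λ d →
        fromℕ ((4 * d ∸ 3) * a (d ∸ 1) + a (d ∸ 2))
          · e (β + d + 1 ∷ β + 1 ∸ d ∷ 1 ∷ [])))

expansion-value : ∀ b k (α : Vec ℕ k) → let β = suc b in expansion β k α ≡ fromℕ (β ! * expansionℕ β α)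
expansion-value b k α = *-value (β !) (n₁ + n₂ + n₃ + n₄ + n₅)
  (+-value (n₁ + n₂ + n₃ + n₄) n₅ (+-value (n₁ + n₂ + n₃) n₄ (+-value (n₁ + n₂) n₃ (+-value n₁ n₂
    (·e-value (coefficient₁ β) (2 * β + 3 ∷ []) α)
    (*-value β (∑< β f²) (sumOver-applyUpTo F² k α f² (λ d → ·e-value (coefficient² d) (β + 2 + d ∷ β + 1 ∸ d ∷ []) α) (0 +_) β)))
    (·e-value (coefficient₂ β) (2 * β + 2 ∷ 1 ∷ []) α))
    (e≡e-coefficient (β + 1 ∷ β + 1 ∷ 1 ∷ []) k α))
    (sumOver-applyUpTo F³ k α f³ (λ d → ·e-value (coefficient³ d) (β + d + 1 ∷ β + 1 ∸ d ∷ 1 ∷ []) α) (2 +_) b))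
  where
  β = suc b
  F² F³ : ℕ → Series
  F² d = fromℕ (coefficient² d) · e (β + 2 + d ∷ β + 1 ∸ d ∷ [])
  F³ d = fromℕ (coefficient³ d) · e (β + d + 1 ∷ β + 1 ∸ d ∷ 1 ∷ [])
  f² f³ : ℕ → ℕ
  f² d = coefficient² d * e-coefficient (β + 2 + d ∷ β + 1 ∸ d ∷ []) α
  f³ d = coefficient³ d * e-coefficient (β + d + 1 ∷ β + 1 ∸ d ∷ 1 ∷ []) α
  n₁ = coefficient₁ β * e-coefficient (2 * β + 3 ∷ []) α
  n₂ = β * ∑< β f²
  n₃ = coefficient₂ β * e-coefficient (2 * β + 2 ∷ 1 ∷ []) α
  n₄ = e-coefficient (β + 1 ∷ β + 1 ∷ 1 ∷ []) α
  n₅ = ∑< b (f³ ∘ (2 +_))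

-- Formal sums of elementary symmetric functions with natural coefficients

_≟ₚ_ : DecidableEquality Partition
partition λs _ _ ≟ₚ partition μs _ _ = map′ (λ { refl → refl }) (cong parts) (List.≡-dec _≟_ λs μs)

Terms : Set
Terms = List (ℕ × Partition)

coefficient : Terms → Partition → ℕ
coefficient []             μ = 0
coefficient ((x , ν) ∷ ts) μ = (if does (ν ≟ₚ μ) then x else 0) + coefficient ts μ

evaluate : (Partition → ℕ) → Terms → ℕ
evaluate w ts = total (List.map (λ (x , μ) → x * w μ) ts)

coefficient-∉ : ∀ ts μ → μ ∉ List.map proj₂ ts → coefficient ts μ ≡ 0
coefficient-∉ []             μ μ∉ = refl
coefficient-∉ ((x , ν) ∷ ts) μ μ∉ = cong₂ _+_
  (cong (λ b → if b then x else 0) (dec-false (ν ≟ₚ μ) λ ν≡μ → μ∉ (here (sym ν≡μ))))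
  (coefficient-∉ ts μ (μ∉ ∘ there))

sum-zero : ∀ {A : Set} (f : A → ℕ) {xs} → All (λ x → f x ≡ 0) xs → total (List.map f xs) ≡ 0
sum-zero f []         = refl
sum-zero f (eq ∷ eqs) = cong₂ _+_ eq (sum-zero f eqs)

sum-+ : ∀ {A : Set} (f h : A → ℕ) xs →
  total (List.map (λ x → f x + h x) xs) ≡ total (List.map f xs) + total (List.map h xs)
sum-+ f h []       = refl
sum-+ f h (x ∷ xs) = trans (cong (f x + h x +_) (sum-+ f h xs)) (swap (f x) (h x) _ _)
  where
  swap : ∀ p q r s → p + q + (r + s) ≡ p + r + (q + s)
  swap = solve-∀

sum-single-∈ : ∀ (w : Partition → ℕ) x {ν S} → Unique S → ν ∈ S →
  total (List.map (λ μ → (if does (ν ≟ₚ μ) then x else 0) * w μ) S) ≡ x * w ν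
sum-single-∈ w x {ν} (ν∉S ∷ _) (here refl) = trans (cong₂ _+_
  (cong (λ b → (if b then x else 0) * w ν) (dec-true (ν ≟ₚ ν) refl))
  (sum-zero _ (All.map (λ {μ} ν≢μ → cong (λ b → (if b then x else 0) * w μ) (dec-false (ν ≟ₚ μ) ν≢μ)) ν∉S)))
  (+-identityʳ _)
sum-single-∈ w x {ν} {μ ∷ S} (μ∉S ∷ unique) (there ν∈S) = cong₂ _+_
  (cong (λ b → (if b then x else 0) * w μ) (dec-false (ν ≟ₚ μ) λ ν≡μ → All.lookup μ∉S ν∈S (sym ν≡μ)))
  (sum-single-∈ w x unique ν∈S)

-- Collecting terms by partition: every term is counted at the only place where its partition occurs
-- in `S`.
evaluate-coefficients : ∀ w ts {S} → Unique S → All (_∈ S) (List.map proj₂ ts) →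
  total (List.map (λ μ → coefficient ts μ * w μ) S) ≡ evaluate w ts
evaluate-coefficients w []             {S} unique _       = sum-zero (λ μ → coefficient [] μ * w μ) (All.universal (λ _ → refl) S)
evaluate-coefficients w ((x , ν) ∷ ts) {S} unique (ν∈S ∷ ts⊆S) = begin
  total (List.map (λ μ → ((if does (ν ≟ₚ μ) then x else 0) + coefficient ts μ) * w μ) S)
    ≡⟨ cong total (List.map-cong (λ μ → *-distribʳ-+ (w μ) (if does (ν ≟ₚ μ) then x else 0) (coefficient ts μ)) S) ⟩
  total (List.map (λ μ → (if does (ν ≟ₚ μ) then x else 0) * w μ + coefficient ts μ * w μ) S)
    ≡⟨ sum-+ (λ μ → (if does (ν ≟ₚ μ) then x else 0) * w μ) (λ μ → coefficient ts μ * w μ) S ⟩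
  total (List.map (λ μ → (if does (ν ≟ₚ μ) then x else 0) * w μ) S) + total (List.map (λ μ → coefficient ts μ * w μ) S)
    ≡⟨ cong₂ _+_ (sum-single-∈ w x unique ν∈S) (evaluate-coefficients w ts unique ts⊆S) ⟩
  x * w ν + evaluate w ts
    ∎

sumOver-e : ∀ (c : Partition → ℕ) S k (α : Vec ℕ k) →
  sumOver S (λ μ → fromℕ (c μ) · e (parts μ)) k α ≡ fromℕ (total (List.map (λ μ → c μ * e-coefficient (parts μ) α) S))
sumOver-e c []      k α = refl
sumOver-e c (μ ∷ S) k α = +-value (c μ * e-coefficient (parts μ) α) (total (List.map (λ μ → c μ * e-coefficient (parts μ) α) S))
  (·e-value (c μ) (parts μ) α) (sumOver-e c S k α)

-- `deduplicate` supplies a support without repetitions, and `coefficient` adds up equal partitions,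
-- so the partitions of `ts` need not be shown to be distinct.
e-expansion : ∀ {F} (ts : Terms) → (∀ k (α : Vec ℕ k) → F k α ≡ fromℕ (evaluate (λ μ → e-coefficient (parts μ) α) ts)) →
  EExpansion F (fromℕ ∘ coefficient ts)
e-expansion {F} ts F-value = record
  { support  = S
  ; unique   = unique
  ; vanishes = λ μ μ∉S → cong fromℕ (coefficient-∉ ts μ (μ∉S ∘ ∈-deduplicate⁺ _≟ₚ_))
  ; expands  = λ k α → trans (F-value k α) (trans
      (cong fromℕ (sym (evaluate-coefficients (λ μ → e-coefficient (parts μ) α) ts unique
        (All.tabulate (∈-deduplicate⁺ _≟ₚ_)))))
      (sym (sumOver-e (coefficient ts) S k α)))
  }
  where
  S = deduplicate _≟ₚ_ (List.map proj₂ ts)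
  unique = Unique.deduplicate-! _≟ₚ_ (List.map proj₂ ts)

total-tabulate : ∀ n (f : ℕ → ℕ) → total (List.tabulate {n = n} (f ∘ toℕ)) ≡ ∑< n f
total-tabulate zero    f = refl
total-tabulate (suc n) f = trans (cong (f 0 +_) (total-tabulate n (f ∘ suc))) (sym (∑<-suc n f))

evaluate-++ : ∀ w ts us → evaluate w (ts List.++ us) ≡ evaluate w ts + evaluate w us
evaluate-++ w ts us = trans (cong total (List.map-++ _ ts us)) (sum-++ (List.map _ ts) _)

-- The index lives in a finite type because its bound is what shows that the smaller part β + 1 - d
-- is positive.
two-part-terms : ∀ b → Fin (suc b) → ℕ × Partition
two-part-terms b i = β ! * (β * coefficient² d) , partition (β + 2 + d ∷ β + 1 ∸ d ∷ [])
  (≤-trans (m∸n≤m (β + 1) d) (≤-trans (+-monoʳ-≤ β (s≤s z≤n)) (m≤m+n (β + 2) d)) ∷ [-])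
  (z<s ∷ m<n⇒0<n∸m (<-≤-trans (Fin.toℕ<n i) (m≤m+n β 1)) ∷ [])
  where
  β = suc b
  d = toℕ i

three-part-terms : ∀ b → Fin b → ℕ × Partition
three-part-terms b i = β ! * coefficient³ d , partition (β + d + 1 ∷ β + 1 ∸ d ∷ 1 ∷ [])
  (≤-trans (m∸n≤m (β + 1) d) (+-monoˡ-≤ 1 (m≤m+n β d)) ∷ positive ∷ [-])
  (z<s ∷ positive ∷ z<s ∷ [])
  where
  β = suc b
  d = 2 + toℕ i
  positive : 0 < β + 1 ∸ d
  positive = m<n⇒0<n∸m (subst (d <_) (+-comm 1 β) (s≤s (s≤s (Fin.toℕ<n i))))

e-terms : ℕ → Terms
e-terms b =
  (β ! * coefficient₁ β , partition (2 * β + 3 ∷ []) [-] (z<s ∷ [])) ∷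
  (β ! * coefficient₂ β , partition (2 * β + 2 ∷ 1 ∷ []) (s≤s z≤n ∷ [-]) (z<s ∷ z<s ∷ [])) ∷
  (β ! , partition (β + 1 ∷ β + 1 ∷ 1 ∷ []) (≤-refl ∷ s≤s z≤n ∷ [-]) (z<s ∷ z<s ∷ z<s ∷ [])) ∷
  (List.tabulate (two-part-terms b) List.++ List.tabulate (three-part-terms b))
  where
  β = suc b

e-terms-value : ∀ b {k} (α : Vec ℕ k) → let β = suc b in
  β ! * expansionℕ β α ≡ evaluate (λ μ → e-coefficient (parts μ) α) (e-terms b)
e-terms-value b α = sym (begin
  β ! * coefficient₁ β * z + (β ! * coefficient₂ β * y + (β ! * x + evaluate w (ts² List.++ ts³)))
    ≡⟨ cong (λ v → β ! * coefficient₁ β * z + (β ! * coefficient₂ β * y + (β ! * x + v)))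
         (trans (evaluate-++ w ts² ts³) (cong₂ _+_ sum² sum³)) ⟩
  β ! * coefficient₁ β * z + (β ! * coefficient₂ β * y + (β ! * x + (β ! * (β * S) + β ! * T)))
    ≡⟨ regroup (β !) (coefficient₁ β) z (coefficient₂ β) y x (β * S) T ⟩
  β ! * expansionℕ β α
    ∎)
  where
  β = suc b
  w : Partition → ℕ
  w μ = e-coefficient (parts μ) α
  x = e-coefficient (β + 1 ∷ β + 1 ∷ 1 ∷ []) α
  y = e-coefficient (2 * β + 2 ∷ 1 ∷ []) α
  z = e-coefficient (2 * β + 3 ∷ []) α
  f² f³ : ℕ → ℕ
  f² d = coefficient² d * e-coefficient (β + 2 + d ∷ β + 1 ∸ d ∷ []) α
  f³ i = coefficient³ (2 + i) * e-coefficient (β + (2 + i) + 1 ∷ β + 1 ∸ (2 + i) ∷ 1 ∷ []) α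
  S = ∑< β f²
  T = ∑< b f³
  ts² = List.tabulate (two-part-terms b)
  ts³ = List.tabulate (three-part-terms b)
  assoc : ∀ p q r → p * q * r ≡ p * (q * r)
  assoc = solve-∀
  assoc′ : ∀ p q r s → p * (q * r) * s ≡ p * (q * (r * s))
  assoc′ = solve-∀
  sum² : evaluate w ts² ≡ β ! * (β * S)
  sum² = begin
    evaluate w ts²
      ≡⟨ cong total (List.map-tabulate (two-part-terms b) (λ (x , μ) → x * w μ)) ⟩
    total (List.tabulate {n = β} (h ∘ toℕ))
      ≡⟨ total-tabulate β h ⟩
    ∑< β h
      ≡⟨ ∑<-cong β (λ d _ → assoc′ (β !) β (coefficient² d) (e-coefficient (β + 2 + d ∷ β + 1 ∸ d ∷ []) α)) ⟩
    ∑< β (λ d → β ! * (β * f² d))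
      ≡⟨ *-distribˡ-∑< β (β !) (λ d → β * f² d) ⟨
    β ! * ∑< β (λ d → β * f² d)
      ≡⟨ cong (β ! *_) (*-distribˡ-∑< β β f²) ⟨
    β ! * (β * S)
      ∎
    where
    h : ℕ → ℕ
    h d = β ! * (β * coefficient² d) * e-coefficient (β + 2 + d ∷ β + 1 ∸ d ∷ []) α
  sum³ : evaluate w ts³ ≡ β ! * T
  sum³ = begin
    evaluate w ts³
      ≡⟨ cong total (List.map-tabulate (three-part-terms b) (λ (x , μ) → x * w μ)) ⟩
    total (List.tabulate {n = b} (h ∘ toℕ))
      ≡⟨ total-tabulate b h ⟩
    ∑< b h
      ≡⟨ ∑<-cong b (λ i _ → assoc (β !) (coefficient³ (2 + i)) (e-coefficient (β + (2 + i) + 1 ∷ β + 1 ∸ (2 + i) ∷ 1 ∷ []) α)) ⟩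
    ∑< b (λ i → β ! * f³ i)
      ≡⟨ *-distribˡ-∑< b (β !) f³ ⟨
    β ! * T
      ∎
    where
    h : ℕ → ℕ
    h i = β ! * coefficient³ (2 + i) * e-coefficient (β + (2 + i) + 1 ∷ β + 1 ∸ (2 + i) ∷ 1 ∷ []) α
  regroup : ∀ f c z d y x s t → f * c * z + (f * d * y + (f * x + (f * s + f * t))) ≡ f * (c * z + s + d * y + x + t)
  regroup = solve-∀

theorem1p2 : (β : ℕ) → 1 ≤ β →
    (X (K ⟨3,2^ β ⟩) ≈
      fromℕ (β !) ·
        ( fromℕ (β * (2 * β + 3) * a (β + 1)) · e (2 * β + 3 ∷ [])
        ⊕ fromℕ β · ∑[ 0 ⋯ β ∸ 1 ] (λ d →
            fromℕ ((2 * d + 1) * a d) · e (β + 2 + d ∷ β + 1 ∸ d ∷ []))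
        ⊕ fromℕ (a (β + 1) + (2 * β ^ 2 + β ∸ 1) * a β) · e (2 * β + 2 ∷ 1 ∷ [])
        ⊕ e (β + 1 ∷ β + 1 ∷ 1 ∷ [])
        ⊕ ∑[ 2 ⋯ β ] (λ d →
            fromℕ ((4 * d ∸ 3) * a (d ∸ 1) + a (d ∸ 2))
              · e (β + d + 1 ∷ β + 1 ∸ d ∷ 1 ∷ []))))
    × EPositive (K ⟨3,2^ β ⟩)
theorem1p2 (suc b) _ =
  (λ k α → trans (X-value b k α) (sym (expansion-value b k α))) ,
  fromℕ ∘ coefficient (e-terms b) ,
  e-expansion (e-terms b) (λ k α → trans (X-value b k α) (cong fromℕ (e-terms-value b α))) ,
  λ μ → fromℕ-nonNegative (coefficient (e-terms b) μ)
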